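{- Let $q$ be an odd prime power, let $n \ge 3$ be an integer, and let $f(x,y,z)=x+yz$, viewed as a function from $M_n(\mathbb{F}_q)\times SL_n(\mathbb{F}_q)\times SL_n(\mathbb{F}_q)$ to $M_n(\mathbb{F}_q)$. There is a constant $c>0$ (independent of $q$ and of the sets below) such that for all $A\subset M_n(\mathbb{F}_q)$ and $B,C\subset SL_n(\mathbb{F}_q)$, \[ |f(A,B,C)| \ge c\,\min\left\{q^{n^2},\; q^{2n}|A|,\; \frac{|A||B|^2|C|^2}{q^{4n^2-4n-2}},\; \frac{|B||C|}{q^{n^2-n-1}}\right\}.\]
   Context: $M_n(\mathbb{F}_q)$ is the ring of $n\times n$ matrices over the finite field $\mathbb{F}_q$ and $SL_n(\mathbb{F}_q)$ the matrices of determinant $1$. For sets $A,B,C$, $f(A,B,C)=\{a+bc: a\in A, b\in B, c\in C\}$ (matrix product and sum). -}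

module Defs where

open import Level using (0ℓ)
open import Data.Nat as ℕ using (ℕ; zero; suc)
open import Data.Fin using (Fin; toℕ)
open import Data.Vec as Vec using (Vec; []; _∷_; lookup; tabulate; removeAt)
open import Data.Vec.Properties using (≡-dec)
open import Data.List as List using (List; deduplicate; length)
open import Data.Integer using (+_)
open import Data.Rational using (ℚ; _/_; 0ℚ)
open import Data.Product using (Σ; _×_)
open import Data.Nat.Primality using (Prime)
open import Function.Bundles using (_↔_)
open import Relation.Binary.PropositionalEquality using (_≡_; _≢_)
open import Relation.Binary.Definitions using (DecidableEquality)
open import Algebra.Structures using (IsCommutativeRing)

record FiniteField (q : ℕ) : Set₁ where
  infixl 7 _*_
  infixl 6 _+_
  field
    Carrier : Set
    _+_ _*_ : Carrier → Carrier → Carrier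
    -_ : Carrier → Carrier
    0# 1# : Carrier
    isCommutativeRing : IsCommutativeRing _≡_ _+_ _*_ -_ 0# 1#
    0≢1 : 0# ≢ 1#
    inverse : ∀ x → x ≢ 0# → Σ Carrier (λ y → x * y ≡ 1#)
    _≟_ : DecidableEquality Carrier
    size : Carrier ↔ Fin q

OddPrimePower : ℕ → Set
OddPrimePower q = Σ ℕ λ p → Σ ℕ λ k → Prime p × (p ℕ.% 2 ≡ 1) × (1 ℕ.≤ k) × (q ≡ p ℕ.^ k)

-- a / d as a rational number (d is always a positive power of q ≥ 3 below;
-- the d = 0 clause is never used in the statement).
_over_ : ℕ → ℕ → ℚ
a over zero = 0ℚ
a over suc d = (+ a) / suc d

module Matrices {q : ℕ} (F : FiniteField q) where
  open FiniteField F

  Mat : ℕ → Set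
  Mat n = Vec (Vec Carrier n) n

  _≟M_ : ∀ {n} → DecidableEquality (Mat n)
  _≟M_ = ≡-dec (≡-dec _≟_)

  Σᶠ : ∀ {n} → (Fin n → Carrier) → Carrier
  Σᶠ {zero} f = 0#
  Σᶠ {suc n} f = f Fin.zero + Σᶠ (λ i → f (Fin.suc i))
    where import Data.Fin as Fin

  _+M_ : ∀ {n} → Mat n → Mat n → Mat n
  A +M B = tabulate λ i → tabulate λ j → lookup (lookup A i) j + lookup (lookup B i) j

  _*M_ : ∀ {n} → Mat n → Mat n → Mat n
  A *M B = tabulate λ i → tabulate λ j → Σᶠ λ k → lookup (lookup A i) k * lookup (lookup B k) j

  sign : ℕ → Carrier
  sign zero = 1#
  sign (suc k) = - sign k

  det : ∀ {n} → Mat n → Carrier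
  det {zero} [] = 1#
  det {suc n} (r ∷ rs) = Σᶠ λ j → sign (toℕ j) * lookup r j * det (Vec.map (λ row → removeAt row j) rs)

  InSL : ∀ {n} → Mat n → Set
  InSL M = det M ≡ 1#

  card : ∀ {n} → List (Mat n) → ℕ
  card L = length (deduplicate _≟M_ L)

  fImg : ∀ {n} → List (Mat n) → List (Mat n) → List (Mat n) → List (Mat n)
  fImg A B C = List.concatMap (λ a → List.concatMap (λ b → List.map (λ c → a +M (b *M c)) C) B) A

ℕ→ℚ : ℕ → ℚ
ℕ→ℚ a = (+ a) / 1

{-# OPTIONS --safe #-}
module Submission where

-- Write G for SL_n, γ for its indicator, r for the number of representations of a matrix as a product bc.
--
-- Product sets.  |BC| is at least a constant times min(q^(n²-1), |B||C| / q^(n²-n)), by bounding E = Σ r².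
-- The group H of row operations into one row is abelian of order q^(n-1), and for n ≥ 3 its nontrivial elements are
-- conjugate in G. A Bessel inequality for H then bounds the part of E orthogonal to the left H-invariant functions by
-- |G||B||C| / |H|. The indicator of B may thus be replaced by its average over each root subgroup of a fixed word, one
-- after the other; a suitable word spreads mass over SL_n with density at most a constant times q^(1-n²).
--
-- Sum sets.  Let S = BC, X = A + S, and compare [det = 1] with [det ≠ 0] / (q - 1). The second function contributes at
-- most |A||X| / (q - 1) to the number of (x, a) ∈ X × A with x - a ∈ G. The difference τ, scaled by q - 1, has zero sum
-- along m + w ηᵀ (η ∈ F^n) for every w ≠ 0. Hence for a convolution u of τ, summing over all matrices d the squared
-- norm of k ↦ Σ_z τ(z) u(k + z d) leaves only diagonal terms, while each d ∈ SL_n contributes the same amount; so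
-- convolution by τ has squared norm at most q^(n²+2). With S = BC the two bounds combine to the theorem.

-- All estimates are second moments of integer functions, with no characters: averages stay
-- unnormalised and powers of q are cancelled last. In Fourier terms the zero sums of τ say that its
-- transform lives on invertible frequencies; there it depends only on the determinant, so every
-- value occurs at least |SL_n| times, and Parseval with ‖τ‖² at most q² |SL_n| gives q^(n²+2).
-- Subtracting [det ≠ 0] / (q - 1) thus removes all singular frequencies at once, zero among them.
--
-- For h in H, the number of x in SL_n and y, y′ in C with h x y⁻¹ = x y′⁻¹ depends only on the
-- conjugacy class of h. Conjugacy of the nontrivial elements therefore takes the place of a lower
-- bound on the dimensions of representations. Each letter of the word costs one error of that size,
-- so its length may depend on n only.
--
-- The four terms of the minimum answer two dichotomies: whether |X| is at least q |S| / 4, and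
-- which of the two lower bounds holds for |BC|. If |X| is large, these give q^(n²) and |B||C| /
-- q^(n²-n-1); otherwise q^(2n) |A| and the term in |A||B|²|C|².

open import Defs

-- Integer sums over finite types

module FiniteSums where
  open import Data.Nat.Base as ℕ using (ℕ; zero; suc)
  open import Data.Fin.Base as Fin using (Fin; zero; suc)
  import Data.Fin.Properties as Fin
  open import Data.Vec.Base using (Vec; []; _∷_)
  open import Data.Integer.Base hiding (suc; neg)
  import Data.Integer.Properties as ℤ
  open import Data.Integer.Tactic.RingSolver using (solve-∀)
  open import Data.Product.Base using (proj₁; proj₂)
  open import Function.Base using (_∘_)
  open import Function.Bundles using (_↔_; Inverse; mk↔ₛ′)
  open import Relation.Nullary.Decidable using (Dec; yes; no; via-injection)
  open import Relation.Nullary.Negation using (contradiction; ¬_)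
  open import Relation.Binary.PropositionalEquality
  open import Algebra.Properties.Semiring.Sum ℤ.+-*-semiring using (sum; sum-cong-≗; ∑-distrib-+; ∑-comm; sum-permute; *-distribˡ-sum)

  record Finite (A : Set) : Set where
    field
      size : ℕ
      enum : A ↔ Fin size
    open Inverse enum public using (to; from; strictlyInverseˡ; strictlyInverseʳ)

  open Finite using (to; from; strictlyInverseˡ; strictlyInverseʳ)

  ∣_∣F : (A : Set) → {{Finite A}} → ℕ
  ∣ A ∣F {{fin}} = Finite.size fin

  [_]? : {P : Set} → Dec P → ℤ
  [ yes _ ]? = 1ℤ
  [ no _ ]? = 0ℤ

  0≤[]? : {P : Set} (P? : Dec P) → 0ℤ ≤ [ P? ]?
  0≤[]? (yes _) = +≤+ ℕ.z≤n
  0≤[]? (no _) = +≤+ ℕ.z≤n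

  []?≤1 : {P : Set} (P? : Dec P) → [ P? ]? ≤ 1ℤ
  []?≤1 (yes _) = ℤ.≤-refl
  []?≤1 (no _) = +≤+ ℕ.z≤n

  []?-cong : {P Q : Set} (P? : Dec P) (Q? : Dec Q) → (P → Q) → (Q → P) → [ P? ]? ≡ [ Q? ]?
  []?-cong (yes _) (yes _) _ _ = refl
  []?-cong (no _) (no _) _ _ = refl
  []?-cong (yes p) (no ¬q) f _ = contradiction (f p) ¬q
  []?-cong (no ¬p) (yes q) _ g = contradiction (g q) ¬p

  []?-yes : {P : Set} (P? : Dec P) → P → [ P? ]? ≡ 1ℤ
  []?-yes (yes _) _ = refl
  []?-yes (no ¬p) p = contradiction p ¬p

  []?-no : {P : Set} (P? : Dec P) → ¬ P → [ P? ]? ≡ 0ℤ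
  []?-no (yes p) ¬p = contradiction p ¬p
  []?-no (no _) _ = refl

  sq-nonneg : ∀ x → 0ℤ ≤ x * x
  sq-nonneg (+ n) = subst (0ℤ ≤_) (ℤ.pos-* n n) (+≤+ ℕ.z≤n)
  sq-nonneg (-[1+ n ]) = +≤+ ℕ.z≤n

  *-nonneg : ∀ {a b} → 0ℤ ≤ a → 0ℤ ≤ b → 0ℤ ≤ a * b
  *-nonneg {a} {b} 0≤a 0≤b = subst (_≤ a * b) (ℤ.*-zeroʳ a) (ℤ.*-monoˡ-≤-nonNeg a {{nonNegative 0≤a}} 0≤b)

  *-monoˡ : ∀ {a b c} → 0ℤ ≤ c → a ≤ b → c * a ≤ c * b
  *-monoˡ {c = c} 0≤c = ℤ.*-monoˡ-≤-nonNeg c {{nonNegative 0≤c}}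

  *-monoʳ : ∀ {a b c} → 0ℤ ≤ c → a ≤ b → a * c ≤ b * c
  *-monoʳ {c = c} 0≤c = ℤ.*-monoʳ-≤-nonNeg c {{nonNegative 0≤c}}

  abstract
    -- Kept abstract: a sum over all matrices is handled through its laws and never unfolded into an
    -- enumeration.
    ∑ : {A : Set} → {{Finite A}} → (A → ℤ) → ℤ
    ∑ {{fin}} f = sum (f ∘ from fin)

    ∑-cong : {A : Set} {{_ : Finite A}} {f g : A → ℤ} → (∀ x → f x ≡ g x) → ∑ f ≡ ∑ g
    ∑-cong {{fin}} eq = sum-cong-≗ (eq ∘ from fin)

    ∑-+ : {A : Set} {{_ : Finite A}} (f g : A → ℤ) → ∑ (λ x → f x + g x) ≡ ∑ f + ∑ g
    ∑-+ {{fin}} f g = ∑-distrib-+ (f ∘ from fin) (g ∘ from fin)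

    ∑-* : {A : Set} {{_ : Finite A}} (c : ℤ) (f : A → ℤ) → ∑ (λ x → c * f x) ≡ c * ∑ f
    ∑-* {{fin}} c f = sym (*-distribˡ-sum c (f ∘ from fin))

    ∑-swap : {A B : Set} {{_ : Finite A}} {{_ : Finite B}} (f : A → B → ℤ) →
      ∑ (λ x → ∑ (λ y → f x y)) ≡ ∑ (λ y → ∑ (λ x → f x y))
    ∑-swap {{fA}} {{fB}} f = ∑-comm (λ i j → f (from fA i) (from fB j))

    ∑-bij : {A B : Set} {{_ : Finite A}} {{_ : Finite B}} (φ : A → B) (ψ : B → A) →
      (∀ y → φ (ψ y) ≡ y) → (∀ x → ψ (φ x) ≡ x) → (f : B → ℤ) → ∑ (f ∘ φ) ≡ ∑ f
    ∑-bij {{fA}} {{fB}} φ ψ φψ ψφ f = sym (trans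
      (sum-permute (f ∘ from fB) (mk↔ₛ′ (to fB ∘ φ ∘ from fA) (to fA ∘ ψ ∘ from fB)
        (λ y → trans (cong (to fB ∘ φ) (strictlyInverseʳ fA _))
                (trans (cong (to fB) (φψ _)) (strictlyInverseˡ fB y)))
        (λ x → trans (cong (to fA ∘ ψ) (strictlyInverseʳ fB _))
                (trans (cong (to fA) (ψφ _)) (strictlyInverseˡ fA x)))))
      (sum-cong-≗ {n = Finite.size fA} (λ i → cong f (strictlyInverseʳ fB (φ (from fA i))))))

    ∑-mono : {A : Set} {{_ : Finite A}} {f g : A → ℤ} → (∀ x → f x ≤ g x) → ∑ f ≤ ∑ g
    ∑-mono {{fin}} le = go (le ∘ from fin)
      where
      go : ∀ {n} {f g : Fin n → ℤ} → (∀ i → f i ≤ g i) → sum f ≤ sum g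
      go {zero} _ = ℤ.≤-refl
      go {suc n} h = ℤ.+-mono-≤ (h zero) (go (h ∘ suc))

    ∑-const : (A : Set) {{_ : Finite A}} (c : ℤ) → ∑ {A} (λ _ → c) ≡ + ∣ A ∣F * c
    ∑-const A {{fin}} c = go (Finite.size fin)
      where
      go : ∀ n → sum {n} (λ _ → c) ≡ + n * c
      go zero = refl
      go (suc n) = trans (cong (_+_ c) (go n)) (solve-suc c (+ n))
        where
        solve-suc : ∀ c m → c + m * c ≡ (1ℤ + m) * c
        solve-suc = solve-∀

    infix 4 _≟F_
    _≟F_ : {A : Set} {{_ : Finite A}} (x y : A) → Dec (x ≡ y)
    _≟F_ {{fin}} = via-injection (Inverse⇒Injection (Finite.enum fin)) Fin._≟_
      where open import Function.Properties.Inverse using (Inverse⇒Injection)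

  δ : {A : Set} {{_ : Finite A}} → A → A → ℤ
  δ x y = [ x ≟F y ]?

  δ-sym : {A : Set} {{_ : Finite A}} (x y : A) → δ x y ≡ δ y x
  δ-sym x y = []?-cong (x ≟F y) (y ≟F x) sym sym

  δ-cong : {A B : Set} {{_ : Finite A}} {{_ : Finite B}} {x y : A} {u v : B} →
    (x ≡ y → u ≡ v) → (u ≡ v → x ≡ y) → δ x y ≡ δ u v
  δ-cong {x = x} {y} {u} {v} = []?-cong (x ≟F y) (u ≟F v)

  δ-subst : {A : Set} {{_ : Finite A}} (f : A → ℤ) (x y : A) → δ x y * f x ≡ δ x y * f y
  δ-subst f x y with x ≟F y
  ... | yes refl = refl
  ... | no _ = refl

  ∑-0 : {A : Set} {{_ : Finite A}} {f : A → ℤ} → (∀ x → f x ≡ 0ℤ) → ∑ f ≡ 0ℤ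
  ∑-0 {A} eq = trans (∑-cong eq) (trans (∑-const A 0ℤ) (ℤ.*-zeroʳ (+ ∣ A ∣F)))

  abstract
    ∑-δ : {A : Set} {{_ : Finite A}} (a : A) → ∑ (λ x → δ x a) ≡ 1ℤ
    ∑-δ {A} {{fin}} a = trans (sum-cong-≗ (λ i → []?-cong (from fin i ≟F a) (i Fin.≟ to fin a)
          (λ e → trans (sym (strictlyInverseˡ fin i)) (cong (to fin) e))
          (λ e → trans (cong (from fin) e) (strictlyInverseʳ fin a))))
        (go (to fin a))
      where
      0s : ∀ n {f : Fin n → ℤ} → (∀ i → f i ≡ 0ℤ) → sum f ≡ 0ℤ
      0s zero _ = refl
      0s (suc n) eq = cong₂ _+_ (eq zero) (0s n (eq ∘ suc))
      go : ∀ {n} (k : Fin n) → sum (λ i → [ i Fin.≟ k ]?) ≡ 1ℤ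
      go {suc n} zero = cong₂ _+_ ([]?-yes (zero {n} Fin.≟ zero) refl)
        (0s n (λ i → []?-no (suc i Fin.≟ zero) (λ ())))
      go {suc n} (suc k) = cong₂ _+_ ([]?-no (zero Fin.≟ suc k) (λ ()))
        (trans (sum-cong-≗ (λ i → []?-cong (suc i Fin.≟ suc k) (i Fin.≟ k) Fin.suc-injective (cong suc))) (go k))

  ∑-*ʳ : {A : Set} {{_ : Finite A}} (f : A → ℤ) (c : ℤ) → ∑ (λ x → f x * c) ≡ ∑ f * c
  ∑-*ʳ f c = trans (∑-cong (λ x → ℤ.*-comm (f x) c)) (trans (∑-* c f) (ℤ.*-comm c (∑ f)))

  ∑-δ* : {A : Set} {{_ : Finite A}} (a : A) (f : A → ℤ) → ∑ (λ x → δ x a * f x) ≡ f a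
  ∑-δ* a f = trans (∑-cong (λ x → δ-subst f x a))
    (trans (∑-*ʳ (λ x → δ x a) (f a)) (trans (cong (_* f a) (∑-δ a)) (ℤ.*-identityˡ (f a))))

  ∑-- : {A : Set} {{_ : Finite A}} (f g : A → ℤ) → ∑ (λ x → f x - g x) ≡ ∑ f - ∑ g
  ∑-- f g = trans (∑-+ f (λ x → - g x)) (cong (_+_ (∑ f))
    (trans (∑-cong (λ x → sym (ℤ.-1*i≡-i (g x)))) (trans (∑-* -1ℤ g) (ℤ.-1*i≡-i (∑ g)))))

  ∑-nonneg : {A : Set} {{_ : Finite A}} {f : A → ℤ} → (∀ x → 0ℤ ≤ f x) → 0ℤ ≤ ∑ f
  ∑-nonneg {f = f} h = subst (_≤ ∑ f) (∑-0 (λ _ → refl)) (∑-mono h)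

  ∑-product : {A B : Set} {{_ : Finite A}} {{_ : Finite B}} (f : A → ℤ) (g : B → ℤ) →
    ∑ f * ∑ g ≡ ∑ (λ x → ∑ (λ y → f x * g y))
  ∑-product f g = trans (sym (∑-*ʳ f (∑ g))) (∑-cong (λ x → sym (∑-* (f x) g)))

  -- Lagrange's identity: the squares of `f x * g y - f y * g x`, summed over all pairs, give twice
  -- the difference of the two sides.
  cauchy-schwarz : {A : Set} {{_ : Finite A}} (f g : A → ℤ) →
    ∑ (λ x → f x * g x) * ∑ (λ x → f x * g x) ≤ ∑ (λ x → f x * f x) * ∑ (λ x → g x * g x)
  cauchy-schwarz f g = ℤ.*-cancelˡ-≤-pos _ _ (+ 2) (ℤ.i-j≤0⇒i≤j neg)
    where
    FG = ∑ (λ x → f x * g x)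
    FF = ∑ (λ x → f x * f x)
    GG = ∑ (λ x → g x * g x)
    expand : ∀ a b c d → (a * d - c * b) * (a * d - c * b) ≡
      (a * a) * (d * d) + (c * c) * (b * b) - + 2 * ((a * b) * (c * d))
    expand = solve-∀
    total : ∑ (λ x → ∑ (λ y → (f x * g y - f y * g x) * (f x * g y - f y * g x)))
      ≡ FF * GG + FF * GG - + 2 * (FG * FG)
    total = begin
      ∑ (λ x → ∑ (λ y → (f x * g y - f y * g x) * (f x * g y - f y * g x)))
        ≡⟨ ∑-cong (λ x → ∑-cong (λ y → expand (f x) (g x) (f y) (g y))) ⟩
      ∑ (λ x → ∑ (λ y → P x y + P y x - + 2 * R x y))
        ≡⟨ ∑-cong (λ x → trans (∑-- (λ y → P x y + P y x) (λ y → + 2 * R x y))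
             (cong₂ _-_ (∑-+ (P x) (λ y → P y x)) (∑-* (+ 2) (R x)))) ⟩
      ∑ (λ x → ∑ (P x) + ∑ (λ y → P y x) - + 2 * ∑ (R x))
        ≡⟨ trans (∑-- (λ x → ∑ (P x) + ∑ (λ y → P y x)) (λ x → + 2 * ∑ (R x)))
             (cong₂ _-_ (∑-+ (λ x → ∑ (P x)) (λ x → ∑ (λ y → P y x))) (∑-* (+ 2) (λ x → ∑ (R x)))) ⟩
      ∑ (λ x → ∑ (P x)) + ∑ (λ x → ∑ (λ y → P y x)) - + 2 * ∑ (λ x → ∑ (R x))
        ≡⟨ cong₂ (λ s t → s + t - + 2 * ∑ (λ x → ∑ (R x))) (sym (∑-product _ _))
             (trans (∑-swap (λ x y → P y x)) (sym (∑-product _ _))) ⟩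
      FF * GG + FF * GG - + 2 * ∑ (λ x → ∑ (R x))
        ≡⟨ cong (λ s → FF * GG + FF * GG - + 2 * s) (sym (∑-product _ _)) ⟩
      FF * GG + FF * GG - + 2 * (FG * FG) ∎
      where
      open ≡-Reasoning
      P R : _ → _ → ℤ
      P x y = (f x * f x) * (g y * g y)
      R x y = (f x * g x) * (f y * g y)
    double : ∀ s u → s + s - + 2 * u ≡ - (+ 2 * u - + 2 * s)
    double = solve-∀
    neg : + 2 * (FG * FG) - + 2 * (FF * GG) ≤ 0ℤ
    neg = subst (_≤ 0ℤ) (ℤ.neg-involutive _) (ℤ.neg-mono-≤
      (subst (0ℤ ≤_) (trans total (double (FF * GG) (FG * FG)))
        (∑-nonneg (λ x → ∑-nonneg (λ y → sq-nonneg (f x * g y - f y * g x))))))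

  instance
    -- The size is literally a power, so that the numbers of rows and of matrices become powers of
    -- `q` by computation.
    Finite-Vec : {A : Set} {n : ℕ} {{_ : Finite A}} → Finite (Vec A n)
    Finite-Vec {A} {n} {{fin}} = record { size = N ℕ.^ n ; enum = mk↔ₛ′ (enc {n}) (dec {n}) (enc-dec {n}) (dec-enc {n}) }
      where
      N = Finite.size fin
      enc : ∀ {n} → Vec A n → Fin (N ℕ.^ n)
      enc [] = zero
      enc (x ∷ v) = Fin.combine (to fin x) (enc v)
      dec : ∀ {n} → Fin (N ℕ.^ n) → Vec A n
      dec {zero} _ = []
      dec {suc n} i = from fin (proj₁ (Fin.remQuot {N} (N ℕ.^ n) i)) ∷ dec (proj₂ (Fin.remQuot {N} (N ℕ.^ n) i))
      enc-dec : ∀ {n} i → enc {n} (dec i) ≡ i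
      enc-dec {zero} zero = refl
      enc-dec {suc n} i = trans (cong₂ Fin.combine (strictlyInverseˡ fin _) (enc-dec {n} _))
        (Fin.combine-remQuot {N} (N ℕ.^ n) i)
      dec-enc : ∀ {n} v → dec {n} (enc {n} v) ≡ v
      dec-enc [] = refl
      dec-enc (_∷_ {n} x v) = cong₂ _∷_
        (trans (cong (from fin ∘ proj₁) (Fin.remQuot-combine {N} (to fin x) (enc v))) (strictlyInverseʳ fin x))
        (trans (cong (dec {n} ∘ proj₂) (Fin.remQuot-combine {N} (to fin x) (enc v))) (dec-enc v))

  ∑-swap² : {A B C D : Set} {{_ : Finite A}} {{_ : Finite B}} {{_ : Finite C}} {{_ : Finite D}} (f : A → B → C → D → ℤ) →
    ∑ (λ a → ∑ (λ b → ∑ (λ c → ∑ (λ d → f a b c d)))) ≡ ∑ (λ c → ∑ (λ d → ∑ (λ a → ∑ (λ b → f a b c d))))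
  ∑-swap² f = begin
    ∑ (λ a → ∑ (λ b → ∑ (λ c → ∑ (λ d → f a b c d))))
      ≡⟨ ∑-cong (λ a → trans (∑-swap (λ b c → ∑ (f a b c))) (∑-cong (λ c → ∑-swap (λ b d → f a b c d)))) ⟩
    ∑ (λ a → ∑ (λ c → ∑ (λ d → ∑ (λ b → f a b c d)))) ≡⟨ ∑-swap (λ a c → ∑ (λ d → ∑ (λ b → f a b c d))) ⟩
    ∑ (λ c → ∑ (λ a → ∑ (λ d → ∑ (λ b → f a b c d)))) ≡⟨ ∑-cong (λ c → ∑-swap (λ a d → ∑ (λ b → f a b c d))) ⟩
    ∑ (λ c → ∑ (λ d → ∑ (λ a → ∑ (λ b → f a b c d)))) ∎
    where open ≡-Reasoning

  2ab≤a²+b² : ∀ a b → + 2 * (a * b) ≤ a * a + b * b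
  2ab≤a²+b² a b = ℤ.i-j≤0⇒i≤j (subst (_≤ 0ℤ) (expand a b) (ℤ.neg-mono-≤ (sq-nonneg (a - b))))
    where
    expand : ∀ a b → - ((a - b) * (a - b)) ≡ + 2 * (a * b) - (a * a + b * b)
    expand = solve-∀

  card-pos : {A : Set} {{_ : Finite A}} → A → Positive (+ ∣ A ∣F)
  card-pos {A} {{fin}} a with Finite.size fin | to fin a
  ... | suc _ | _ = _

  pos-^ : ∀ q k → (+ q) ^ k ≡ + (q ℕ.^ k)
  pos-^ q zero = refl
  pos-^ q (suc k) = trans (cong (λ z → + q * z) (pos-^ q k)) (sym (ℤ.pos-* q (q ℕ.^ k)))

  nat : ∀ a → + a ≡ + a
  nat a = refl

  infixl 7 _⟨*⟩_
  -- Together with `_⟨+⟩_`, follows the shape of an integer expression to present it as the cast of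
  -- a natural number; `to-ℕ` then transfers a whole inequality at once.
  _⟨*⟩_ : ∀ {i j a b} → i ≡ + a → j ≡ + b → i * j ≡ + (a ℕ.* b)
  _⟨*⟩_ {a = a} {b} refl refl = sym (ℤ.pos-* a b)

  infixl 6 _⟨+⟩_
  _⟨+⟩_ : ∀ {i j a b} → i ≡ + a → j ≡ + b → i + j ≡ + (a ℕ.+ b)
  refl ⟨+⟩ refl = refl

  abs : ∀ {i} → 0ℤ ≤ i → i ≡ + ∣ i ∣
  abs 0≤i = sym (ℤ.0≤i⇒+∣i∣≡i 0≤i)

  ∣i∣²≡i² : ∀ i → i * i ≡ + (∣ i ∣ ℕ.* ∣ i ∣)
  ∣i∣²≡i² (+ n) = sym (ℤ.pos-* n n)
  ∣i∣²≡i² -[1+ n ] = refl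

  i≤∣i∣ : ∀ i → i ≤ + ∣ i ∣
  i≤∣i∣ (+ n) = ℤ.≤-refl
  i≤∣i∣ -[1+ n ] = -≤+

  to-ℕ : ∀ {i j a b} → i ≡ + a → j ≡ + b → i ≤ j → a ℕ.≤ b
  to-ℕ refl refl = ℤ.drop‿+≤+

-- A Bessel inequality for actions of finite abelian groups

module Bessel where
  open import Data.Integer.Base hiding (suc; neg)
  import Data.Integer.Properties as ℤ
  open import Data.Integer.Tactic.RingSolver using (solve-∀)
  open import Relation.Binary.PropositionalEquality
  open FiniteSums

  module BesselInequality {W Z : Set} {{fW : Finite W}} {{fZ : Finite Z}}
    (_⊞_ : W → W → W) (𝟎 : W) (⊟_ : W → W)
    (assoc : ∀ u v w → (u ⊞ v) ⊞ w ≡ u ⊞ (v ⊞ w)) (comm : ∀ u v → u ⊞ v ≡ v ⊞ u)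
    (identity : ∀ u → 𝟎 ⊞ u ≡ u) (inverse : ∀ u → (⊟ u) ⊞ u ≡ 𝟎)
    (_▹_ : W → Z → Z) (▹-⊞ : ∀ u v z → (u ⊞ v) ▹ z ≡ u ▹ (v ▹ z)) (▹-𝟎 : ∀ z → 𝟎 ▹ z ≡ z) where

    -- The autocorrelation of `f` along the action: in Fourier terms it encodes the mass of `f` at
    -- each character of `W`.
    corr : (Z → ℤ) → W → ℤ
    corr f k = ∑ (λ z → f z * f (k ▹ z))

    cancelʳ : ∀ u v → (u ⊞ (⊟ v)) ⊞ v ≡ u
    cancelʳ u v = trans (assoc u (⊟ v) v) (trans (cong (u ⊞_) (inverse v)) (trans (comm u 𝟎) (identity u)))

    cancelʳ′ : ∀ u v → (u ⊞ v) ⊞ (⊟ v) ≡ u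
    cancelʳ′ u v = trans (assoc u v (⊟ v)) (trans (cong (u ⊞_) (trans (comm v (⊟ v)) (inverse v))) (trans (comm u 𝟎) (identity u)))

    unique : ∀ u v → u ⊞ v ≡ 𝟎 → u ≡ ⊟ v
    unique u v eq = trans (sym (cancelʳ′ u v)) (trans (cong (_⊞ (⊟ v)) eq) (identity (⊟ v)))

    ⊟-diff : ∀ u v → u ⊞ (⊟ v) ≡ ⊟ (v ⊞ (⊟ u))
    ⊟-diff u v = unique _ _ (begin
      (u ⊞ (⊟ v)) ⊞ (v ⊞ (⊟ u)) ≡⟨ sym (assoc (u ⊞ (⊟ v)) v (⊟ u)) ⟩
      ((u ⊞ (⊟ v)) ⊞ v) ⊞ (⊟ u) ≡⟨ cong (_⊞ (⊟ u)) (cancelʳ u v) ⟩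
      u ⊞ (⊟ u) ≡⟨ trans (comm u (⊟ u)) (inverse u) ⟩
      𝟎 ∎)
      where open ≡-Reasoning

    ∑-▹ : ∀ w (f : Z → ℤ) → ∑ (λ z → f (w ▹ z)) ≡ ∑ f
    ∑-▹ w f = ∑-bij (w ▹_) ((⊟ w) ▹_)
      (λ z → trans (sym (▹-⊞ w (⊟ w) z)) (trans (cong (_▹ z) (trans (comm w (⊟ w)) (inverse w))) (▹-𝟎 z)))
      (λ z → trans (sym (▹-⊞ (⊟ w) w z)) (trans (cong (_▹ z) (inverse w)) (▹-𝟎 z))) f

    ∑-⊞ : ∀ w (f : W → ℤ) → ∑ (λ s → f (s ⊞ w)) ≡ ∑ f
    ∑-⊞ w = ∑-bij (_⊞ w) (_⊞ (⊟ w)) (λ s → cancelʳ s w) (λ s → cancelʳ′ s w)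

    -- The identity u + (s - u) = v + (s - v) in the abelian group W lets β ⋆ g at two points be paired either way;
    -- AM-GM then separates the autocorrelations of β and g.
    bessel : (β g : Z → ℤ) →
      ∑ (λ s → ∑ (λ z → β z * g (s ▹ z)) * ∑ (λ z → β z * g (s ▹ z))) ≤ ∑ (λ k → corr β k * corr g (⊟ k))
    bessel β g = ℤ.*-cancelˡ-≤-pos _ _ (+ 2) (ℤ.*-cancelˡ-≤-pos _ _ N {{card-pos 𝟎}} (ℤ.*-cancelˡ-≤-pos _ _ N {{card-pos 𝟎}} doubled))
      where
      pull : ∀ n x → n * (n * (+ 2 * x)) ≡ + 2 * (n * (n * x))
      pull = solve-∀
      double : ∀ n x → n * (n * x) + n * (n * x) ≡ n * (n * (+ 2 * x))
      double = solve-∀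
      N = + ∣ W ∣F
      _⊖′_ : W → W → W
      u ⊖′ v = u ⊞ (⊟ v)
      G : W → ℤ
      G s = ∑ (λ z → β z * g (s ▹ z))
      -- Convolves `β` along the orbit of `y` with `g` along the orbit of `z`. The products
      -- `K z′ z s * K z z′ s` sum to `N * N` times the left side of the inequality, the squares to
      -- `N * N` times the right side.
      K : Z → Z → W → ℤ
      K y z s = ∑ (λ u → β (u ▹ y) * g ((s ⊖′ u) ▹ z))

      G-shift : ∀ u t → ∑ (λ z → β (u ▹ z) * g ((t ⊞ u) ▹ z)) ≡ G t
      G-shift u t = trans (∑-cong (λ z → cong (λ x → β (u ▹ z) * g x) (▹-⊞ t u z))) (∑-▹ u (λ z → β z * g (t ▹ z)))

      corr-shift : ∀ (f : Z → ℤ) u k → ∑ (λ z → f (u ▹ z) * f ((k ⊞ u) ▹ z)) ≡ corr f k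
      corr-shift f u k = trans (∑-cong (λ z → cong (λ x → f (u ▹ z) * f x) (▹-⊞ k u z))) (∑-▹ u (λ z → f z * f (k ▹ z)))

      cross : ∑ (λ s → ∑ (λ z → ∑ (λ z′ → K z′ z s * K z z′ s))) ≡ N * (N * ∑ (λ s → G s * G s))
      cross = begin
        ∑ (λ s → ∑ (λ z → ∑ (λ z′ → K z′ z s * K z z′ s)))
          ≡⟨ ∑-cong (λ s → trans (∑-cong (λ z → ∑-cong (λ z′ → ∑-product _ _))) (∑-swap² _)) ⟩
        ∑ (λ s → ∑ (λ u → ∑ (λ v → ∑ (λ z → ∑ (λ z′ →
            (β (u ▹ z′) * g ((s ⊖′ u) ▹ z)) * (β (v ▹ z) * g ((s ⊖′ v) ▹ z′)))))))
          ≡⟨ ∑-cong (λ s → ∑-cong (λ u → ∑-cong (λ v → trans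
               (∑-cong (λ z → ∑-cong (λ z′ → regroup (β (u ▹ z′)) _ (β (v ▹ z)) _)))
               (trans (sym (∑-product (λ z → β (v ▹ z) * g ((s ⊖′ u) ▹ z)) (λ z′ → β (u ▹ z′) * g ((s ⊖′ v) ▹ z′))))
                 (cong₂ _*_
                   (trans (∑-cong (λ z → cong (λ x → β (v ▹ z) * g (x ▹ z)) (sym (cancelʳ (s ⊖′ u) v)))) (G-shift v _))
                   (trans (∑-cong (λ z → cong (λ x → β (u ▹ z) * g (x ▹ z)) (trans (sym (cancelʳ (s ⊖′ v) u)) (cong (_⊞ u) (exchange s v u))))) (G-shift u _))))))) ⟩
        ∑ (λ s → ∑ (λ u → ∑ (λ v → G ((s ⊖′ u) ⊖′ v) * G ((s ⊖′ u) ⊖′ v))))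
          ≡⟨ trans (∑-swap _) (∑-cong (λ u → ∑-swap _)) ⟩
        ∑ (λ u → ∑ (λ v → ∑ (λ s → G ((s ⊖′ u) ⊖′ v) * G ((s ⊖′ u) ⊖′ v))))
          ≡⟨ ∑-cong (λ u → trans (∑-cong (λ v → trans (∑-⊞ (⊟ u) (λ s → G (s ⊖′ v) * G (s ⊖′ v))) (∑-⊞ (⊟ v) (λ s → G s * G s)))) (∑-const W _)) ⟩
        ∑ (λ u → N * ∑ (λ s → G s * G s)) ≡⟨ ∑-const W _ ⟩
        N * (N * ∑ (λ s → G s * G s)) ∎
        where
        open ≡-Reasoning
        regroup : ∀ a b c d → (a * b) * (c * d) ≡ (c * b) * (a * d)
        regroup = solve-∀
        exchange : ∀ s v u → (s ⊖′ v) ⊖′ u ≡ (s ⊖′ u) ⊖′ v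
        exchange s v u = trans (assoc s (⊟ v) (⊟ u)) (trans (cong (s ⊞_) (comm (⊟ v) (⊟ u))) (sym (assoc s (⊟ u) (⊟ v))))

      square : ∑ (λ s → ∑ (λ z → ∑ (λ z′ → K z′ z s * K z′ z s))) ≡ N * (N * ∑ (λ k → corr β k * corr g (⊟ k)))
      square = begin
        ∑ (λ s → ∑ (λ z → ∑ (λ z′ → K z′ z s * K z′ z s)))
          ≡⟨ ∑-cong (λ s → trans (∑-cong (λ z → ∑-cong (λ z′ → ∑-product _ _))) (∑-swap² _)) ⟩
        ∑ (λ s → ∑ (λ u → ∑ (λ v → ∑ (λ z → ∑ (λ z′ →
            (β (u ▹ z′) * g ((s ⊖′ u) ▹ z)) * (β (v ▹ z′) * g ((s ⊖′ v) ▹ z)))))))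
          ≡⟨ ∑-cong (λ s → ∑-cong (λ u → ∑-cong (λ v → trans
               (∑-cong (λ z → ∑-cong (λ z′ → regroup (β (u ▹ z′)) _ (β (v ▹ z′)) _)))
               (trans (sym (∑-product (λ z → g ((s ⊖′ u) ▹ z) * g ((s ⊖′ v) ▹ z)) (λ z′ → β (u ▹ z′) * β (v ▹ z′))))
                 (trans (ℤ.*-comm (∑ (λ z → g ((s ⊖′ u) ▹ z) * g ((s ⊖′ v) ▹ z))) _) (cong₂ _*_
                   (trans (∑-cong (λ z → cong (λ x → β (u ▹ z) * β (x ▹ z)) (sym (cancelʳ v u)))) (corr-shift β u (v ⊖′ u)))
                   (trans (∑-cong (λ z → cong (λ x → g ((s ⊖′ u) ▹ z) * g (x ▹ z)) (rebase s u v))) (corr-shift g (s ⊖′ u) (⊟ (v ⊖′ u)))))))))) ⟩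
        ∑ (λ s → ∑ (λ u → ∑ (λ v → H (v ⊖′ u))))
          ≡⟨ ∑-cong (λ s → ∑-cong (λ u → ∑-⊞ (⊟ u) H)) ⟩
        ∑ {W} (λ s → ∑ {W} (λ u → ∑ H)) ≡⟨ trans (∑-cong (λ s → ∑-const W _)) (∑-const W _) ⟩
        N * (N * ∑ H) ∎
        where
        open ≡-Reasoning
        H : W → ℤ
        H k = corr β k * corr g (⊟ k)
        regroup : ∀ a b c d → (a * b) * (c * d) ≡ (b * d) * (a * c)
        regroup = solve-∀
        rebase : ∀ s u v → s ⊖′ v ≡ (⊟ (v ⊖′ u)) ⊞ (s ⊖′ u)
        rebase s u v = begin
          s ⊖′ v ≡⟨ cong (_⊖′ v) (sym (cancelʳ s u)) ⟩
          ((s ⊖′ u) ⊞ u) ⊖′ v ≡⟨ assoc (s ⊖′ u) u (⊟ v) ⟩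
          (s ⊖′ u) ⊞ (u ⊖′ v) ≡⟨ cong ((s ⊖′ u) ⊞_) (⊟-diff u v) ⟩
          (s ⊖′ u) ⊞ (⊟ (v ⊖′ u)) ≡⟨ comm _ _ ⟩
          (⊟ (v ⊖′ u)) ⊞ (s ⊖′ u) ∎

      symmetric : ∑ (λ s → ∑ (λ z → ∑ (λ z′ → K z z′ s * K z z′ s))) ≡ ∑ (λ s → ∑ (λ z → ∑ (λ z′ → K z′ z s * K z′ z s)))
      symmetric = ∑-cong (λ s → ∑-swap (λ z z′ → K z z′ s * K z z′ s))

      doubled : N * (N * (+ 2 * ∑ (λ s → G s * G s))) ≤ N * (N * (+ 2 * ∑ (λ k → corr β k * corr g (⊟ k))))
      doubled = begin
        N * (N * (+ 2 * ∑ (λ s → G s * G s))) ≡⟨ pull N _ ⟩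
        + 2 * (N * (N * ∑ (λ s → G s * G s))) ≡⟨ cong (+ 2 *_) (sym cross) ⟩
        + 2 * ∑ (λ s → ∑ (λ z → ∑ (λ z′ → K z′ z s * K z z′ s)))
          ≡⟨ sym (trans (∑-cong (λ s → trans (∑-cong (λ z → ∑-* (+ 2) _)) (∑-* (+ 2) _))) (∑-* (+ 2) _)) ⟩
        ∑ (λ s → ∑ (λ z → ∑ (λ z′ → + 2 * (K z′ z s * K z z′ s))))
          ≤⟨ ∑-mono (λ s → ∑-mono (λ z → ∑-mono (λ z′ → 2ab≤a²+b² (K z′ z s) (K z z′ s)))) ⟩
        ∑ (λ s → ∑ (λ z → ∑ (λ z′ → K z′ z s * K z′ z s + K z z′ s * K z z′ s)))
          ≡⟨ trans (∑-cong (λ s → trans (∑-cong (λ z → ∑-+ _ _)) (∑-+ _ _))) (∑-+ _ _) ⟩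
        ∑ (λ s → ∑ (λ z → ∑ (λ z′ → K z′ z s * K z′ z s))) + ∑ (λ s → ∑ (λ z → ∑ (λ z′ → K z z′ s * K z z′ s)))
          ≡⟨ cong₂ _+_ square (trans symmetric square) ⟩
        N * (N * ∑ (λ k → corr β k * corr g (⊟ k))) + N * (N * ∑ (λ k → corr β k * corr g (⊟ k))) ≡⟨ double N _ ⟩
        N * (N * (+ 2 * ∑ (λ k → corr β k * corr g (⊟ k)))) ∎
        where open ℤ.≤-Reasoning

-- A ring solver with integer coefficients for the given field

module FieldAlgebra where
  open import Level using (0ℓ)
  open import Data.Nat.Base as ℕ using (ℕ; zero; suc)
  open import Data.Integer.Base as ℤ using (ℤ; +_; -[1+_]; _⊖_)
  import Data.Integer.Properties as ℤ
  import Data.Maybe.Base as Maybe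
  open import Algebra.Bundles using (CommutativeRing)
  open import Algebra.Solver.Ring.AlmostCommutativeRing using (_-Raw-AlmostCommutative⟶_; fromCommutativeRing)
  open import Relation.Nullary.Decidable.Core using (dec⇒maybe)
  open import Relation.Binary.PropositionalEquality
  open ≡-Reasoning

  module FieldSolver {q : ℕ} (F : FiniteField q) where
    open FiniteField F

    commutativeRing : CommutativeRing 0ℓ 0ℓ
    commutativeRing = record { isCommutativeRing = isCommutativeRing }

    open CommutativeRing commutativeRing public using
      ( +-assoc; +-comm; +-identityˡ; +-identityʳ; -‿inverseˡ; -‿inverseʳ
      ; *-assoc; *-comm; *-identityˡ; *-identityʳ; zeroˡ; zeroʳ; distribˡ; distribʳ )
    open import Algebra.Properties.Ring (CommutativeRing.ring commutativeRing) using (-‿distribˡ-*; -‿distribʳ-*; -‿+-comm; -‿involutive; -0#≈0#)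
    open import Algebra.Properties.Semiring.Mult.TCOptimised (CommutativeRing.semiring commutativeRing) using (_×_; 1+×; ×-homo-+; ×1-homo-*)

    private
      -- The canonical map from the integers. With it as coefficient morphism, `con` denotes an
      -- integer constant in an arbitrary field, and equality of coefficients is decided among
      -- integers.
      ⟦_⟧ : ℤ → Carrier
      ⟦ + n ⟧ = n × 1#
      ⟦ -[1+ n ] ⟧ = - (suc n × 1#)

      ⟦⟧-neg : ∀ i → ⟦ ℤ.- i ⟧ ≡ - ⟦ i ⟧
      ⟦⟧-neg (+ zero) = sym -0#≈0#
      ⟦⟧-neg (+ suc n) = refl
      ⟦⟧-neg -[1+ n ] = sym (-‿involutive _)

      cancel : ∀ x y → x + - y ≡ (1# + x) + - (1# + y)
      cancel x y = begin
        x + - y ≡⟨ sym (+-identityˡ _) ⟩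
        0# + (x + - y) ≡⟨ cong (_+ (x + - y)) (sym (-‿inverseʳ 1#)) ⟩
        1# + - 1# + (x + - y) ≡⟨ +-assoc 1# (- 1#) (x + - y) ⟩
        1# + (- 1# + (x + - y)) ≡⟨ cong (_+_ 1#) (trans (sym (+-assoc _ _ _)) (trans (cong (_+ - y) (+-comm _ _)) (+-assoc _ _ _))) ⟩
        1# + (x + (- 1# + - y)) ≡⟨ sym (+-assoc _ _ _) ⟩
        1# + x + (- 1# + - y) ≡⟨ cong (_+_ (1# + x)) (-‿+-comm 1# y) ⟩
        (1# + x) + - (1# + y) ∎

      ⟦⟧-⊖ : ∀ m n → ⟦ m ⊖ n ⟧ ≡ m × 1# + - (n × 1#)
      ⟦⟧-⊖ zero zero = sym (-‿inverseʳ 0#)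
      ⟦⟧-⊖ zero (suc n) = sym (+-identityˡ _)
      ⟦⟧-⊖ (suc m) zero = sym (trans (cong (_+_ (suc m × 1#)) -0#≈0#) (+-identityʳ _))
      ⟦⟧-⊖ (suc m) (suc n) = begin
        ⟦ suc m ⊖ suc n ⟧ ≡⟨ cong ⟦_⟧ (ℤ.[1+m]⊖[1+n]≡m⊖n m n) ⟩
        ⟦ m ⊖ n ⟧ ≡⟨ ⟦⟧-⊖ m n ⟩
        m × 1# + - (n × 1#) ≡⟨ cancel _ _ ⟩
        (1# + m × 1#) + - (1# + n × 1#) ≡⟨ cong₂ (λ s t → s + - t) (sym (1+× m 1#)) (sym (1+× n 1#)) ⟩
        suc m × 1# + - (suc n × 1#) ∎

      ⟦⟧-+ : ∀ i j → ⟦ i ℤ.+ j ⟧ ≡ ⟦ i ⟧ + ⟦ j ⟧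
      ⟦⟧-+ (+ m) (+ n) = ×-homo-+ 1# m n
      ⟦⟧-+ (+ m) -[1+ n ] = ⟦⟧-⊖ m (suc n)
      ⟦⟧-+ -[1+ m ] (+ n) = trans (⟦⟧-⊖ n (suc m)) (+-comm _ _)
      ⟦⟧-+ -[1+ m ] -[1+ n ] = begin
        - (suc (suc (m ℕ.+ n)) × 1#) ≡⟨ cong (λ k → - (suc k × 1#)) (sym (ℕ.+-suc m n)) ⟩
        - ((suc m ℕ.+ suc n) × 1#) ≡⟨ cong -_ (×-homo-+ 1# (suc m) (suc n)) ⟩
        - (suc m × 1# + suc n × 1#) ≡⟨ sym (-‿+-comm _ _) ⟩
        - (suc m × 1#) + - (suc n × 1#) ∎
        where import Data.Nat.Properties as ℕ

      ⟦⟧-*⁺ : ∀ m n → ⟦ + m ℤ.* + n ⟧ ≡ m × 1# * (n × 1#)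
      ⟦⟧-*⁺ m n = trans (cong ⟦_⟧ (sym (ℤ.pos-* m n))) (×1-homo-* m n)

      ⟦⟧-* : ∀ i j → ⟦ i ℤ.* j ⟧ ≡ ⟦ i ⟧ * ⟦ j ⟧
      ⟦⟧-* (+ m) (+ n) = ⟦⟧-*⁺ m n
      ⟦⟧-* (+ m) -[1+ n ] = begin
        ⟦ + m ℤ.* -[1+ n ] ⟧ ≡⟨ cong ⟦_⟧ (sym (ℤ.neg-distribʳ-* (+ m) (+ suc n))) ⟩
        ⟦ ℤ.- (+ m ℤ.* + suc n) ⟧ ≡⟨ trans (⟦⟧-neg (+ m ℤ.* + suc n)) (cong -_ (⟦⟧-*⁺ m (suc n))) ⟩
        - (m × 1# * (suc n × 1#)) ≡⟨ -‿distribʳ-* _ _ ⟩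
        m × 1# * - (suc n × 1#) ∎
      ⟦⟧-* -[1+ m ] (+ n) = begin
        ⟦ -[1+ m ] ℤ.* + n ⟧ ≡⟨ cong ⟦_⟧ (sym (ℤ.neg-distribˡ-* (+ suc m) (+ n))) ⟩
        ⟦ ℤ.- (+ suc m ℤ.* + n) ⟧ ≡⟨ trans (⟦⟧-neg (+ suc m ℤ.* + n)) (cong -_ (⟦⟧-*⁺ (suc m) n)) ⟩
        - (suc m × 1# * (n × 1#)) ≡⟨ -‿distribˡ-* _ _ ⟩
        - (suc m × 1#) * (n × 1#) ∎
      ⟦⟧-* -[1+ m ] -[1+ n ] = begin
        ⟦ + suc m ℤ.* + suc n ⟧ ≡⟨ ⟦⟧-*⁺ (suc m) (suc n) ⟩
        x * y ≡⟨ sym (-‿involutive _) ⟩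
        - - (x * y) ≡⟨ cong -_ (-‿distribʳ-* x y) ⟩
        - (x * - y) ≡⟨ -‿distribˡ-* x (- y) ⟩
        - x * - y ∎
        where
        x = suc m × 1#
        y = suc n × 1#

      morphism : ℤ.+-*-rawRing -Raw-AlmostCommutative⟶ fromCommutativeRing commutativeRing
      morphism = record
        { ⟦_⟧ = ⟦_⟧ ; +-homo = ⟦⟧-+ ; *-homo = ⟦⟧-* ; -‿homo = ⟦⟧-neg ; 0-homo = refl ; 1-homo = refl }

    open import Algebra.Solver.Ring ℤ.+-*-rawRing (fromCommutativeRing commutativeRing) morphism
      (λ i j → Maybe.map (cong ⟦_⟧) (dec⇒maybe (i ℤ.≟ j))) public using (solve; _:=_; _:+_; _:*_; _:-_; :-_; con)

-- Determinants as multilinear alternating functions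

module Determinants where
  open import Data.Nat.Base using (ℕ; zero; suc)
  open import Data.Fin.Base using (Fin; zero; suc; toℕ; punchIn)
  open import Data.Vec.Base using (Vec; []; _∷_; map; lookup; tabulate; replicate; zipWith; insertAt; removeAt; head; tail; _[_]≔_)
  import Data.Vec.Properties as Vec
  import Data.Integer.Base as ℤ
  open import Data.Product.Base using (_×_; _,_; proj₁; proj₂)
  open import Data.Unit.Base using (⊤; tt)
  open import Function.Base using (_∘_)
  open import Relation.Nullary.Negation using (contradiction)
  open import Relation.Binary.PropositionalEquality
  open FieldAlgebra
  open ≡-Reasoning

  lookup-ext : {A : Set} {n : ℕ} {u v : Vec A n} → (∀ i → lookup u i ≡ lookup v i) → u ≡ v
  lookup-ext {u = u} {v} eq = trans (sym (Vec.tabulate∘lookup u)) (trans (Vec.tabulate-cong eq) (Vec.tabulate∘lookup v))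

  lookup-removeAt : {A : Set} {n : ℕ} (v : Vec A (suc n)) (j : Fin (suc n)) (k : Fin n) →
    lookup (removeAt v j) k ≡ lookup v (punchIn j k)
  lookup-removeAt (x ∷ v) zero k = refl
  lookup-removeAt (x ∷ v@(_ ∷ _)) (suc j) zero = refl
  lookup-removeAt (x ∷ v@(_ ∷ _)) (suc j) (suc k) = lookup-removeAt v j k

  module Determinant {q : ℕ} (F : FiniteField q) where
    open FiniteField F
    open FieldSolver F
    open Matrices F

    Row : ℕ → Set
    Row = Vec Carrier

    Σᶠ-cong : ∀ {n} {f g : Fin n → Carrier} → (∀ i → f i ≡ g i) → Σᶠ f ≡ Σᶠ g
    Σᶠ-cong {zero} eq = refl
    Σᶠ-cong {suc n} eq = cong₂ _+_ (eq zero) (Σᶠ-cong (eq ∘ suc))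

    Σᶠ-0 : ∀ {n} {f : Fin n → Carrier} → (∀ i → f i ≡ 0#) → Σᶠ f ≡ 0#
    Σᶠ-0 {zero} eq = refl
    Σᶠ-0 {suc n} eq = trans (cong₂ _+_ (eq zero) (Σᶠ-0 (eq ∘ suc))) (+-identityˡ 0#)

    Σᶠ-+ : ∀ {n} (f g : Fin n → Carrier) → Σᶠ (λ i → f i + g i) ≡ Σᶠ f + Σᶠ g
    Σᶠ-+ {zero} f g = sym (+-identityˡ 0#)
    Σᶠ-+ {suc n} f g = trans (cong (_+_ (f zero + g zero)) (Σᶠ-+ (f ∘ suc) (g ∘ suc)))
      (solve 4 (λ a b c d → (a :+ b) :+ (c :+ d) := (a :+ c) :+ (b :+ d)) refl _ _ _ _)

    Σᶠ-* : ∀ {n} (c : Carrier) (f : Fin n → Carrier) → Σᶠ (λ i → c * f i) ≡ c * Σᶠ f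
    Σᶠ-* {zero} c f = sym (zeroʳ c)
    Σᶠ-* {suc n} c f = trans (cong (_+_ (c * f zero)) (Σᶠ-* c (f ∘ suc))) (sym (distribˡ c _ _))

    Σᶠ-*ʳ : ∀ {n} (f : Fin n → Carrier) (c : Carrier) → Σᶠ (λ i → f i * c) ≡ Σᶠ f * c
    Σᶠ-*ʳ f c = trans (Σᶠ-cong (λ i → *-comm (f i) c)) (trans (Σᶠ-* c f) (*-comm c _))

    Σᶠ-swap : ∀ {m n} (f : Fin m → Fin n → Carrier) → Σᶠ (λ i → Σᶠ (f i)) ≡ Σᶠ (λ j → Σᶠ (λ i → f i j))
    Σᶠ-swap {zero} {n} f = sym (Σᶠ-0 {n} (λ _ → refl))
    Σᶠ-swap {suc m} f = trans (cong (_+_ (Σᶠ (f zero))) (Σᶠ-swap (f ∘ suc))) (sym (Σᶠ-+ (f zero) _))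

    𝟘 : ∀ {m} → Row m
    𝟘 = replicate _ 0#

    infixl 6 _⊹_
    infixr 7 _∙_
    _⊹_ : ∀ {m} → Row m → Row m → Row m
    _⊹_ = zipWith _+_

    _∙_ : ∀ {m} → Carrier → Row m → Row m
    a ∙ u = map (a *_) u

    lookup-⊹ : ∀ {m} (u v : Row m) i → lookup (u ⊹ v) i ≡ lookup u i + lookup v i
    lookup-⊹ u v i = Vec.lookup-zipWith _+_ i u v

    lookup-∙ : ∀ {m} a (u : Row m) i → lookup (a ∙ u) i ≡ a * lookup u i
    lookup-∙ a u i = Vec.lookup-map i (a *_) u

    e : ∀ {m} → Fin m → Row m
    e zero = 1# ∷ 𝟘
    e (suc i) = 0# ∷ e i

    Id : ∀ n → Mat n
    Id n = tabulate e

    -- Multilinearity and the alternating property in the rows, by recursion on the number of rows, so that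
    -- fixing the first row of a multilinear alternating function leaves one in the remaining rows.
    Lin : ∀ {m} n → (Vec (Row m) n → Carrier) → Set
    Lin zero f = ⊤
    Lin (suc n) f = (∀ c u v w → f ((c ∙ u ⊹ v) ∷ w) ≡ c * f (u ∷ w) + f (v ∷ w)) × (∀ u → Lin n (λ w → f (u ∷ w)))

    Alt : ∀ {m} n → (Vec (Row m) n → Carrier) → Set
    Alt zero f = ⊤
    Alt (suc zero) f = ⊤
    Alt (suc (suc n)) f = (∀ u w → f (u ∷ u ∷ w) ≡ 0#) × (∀ u → Alt (suc n) (λ w → f (u ∷ w)))

    Alt-fix : ∀ {m} n {f : Vec (Row m) (suc n) → Carrier} → Alt (suc n) f → ∀ u → Alt n (λ w → f (u ∷ w))
    Alt-fix zero _ u = tt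
    Alt-fix (suc n) alt u = proj₂ alt u

    Lin-comb : ∀ {m} n {f g h : Vec (Row m) n → Carrier} c → (∀ v → h v ≡ c * f v + g v) → Lin n f → Lin n g → Lin n h
    Lin-comb zero c eq _ _ = tt
    Lin-comb (suc n) {f} {g} {h} c eq lf lg =
      (λ d u v w → begin
        h ((d ∙ u ⊹ v) ∷ w) ≡⟨ eq _ ⟩
        c * f ((d ∙ u ⊹ v) ∷ w) + g ((d ∙ u ⊹ v) ∷ w) ≡⟨ cong₂ (λ s t → c * s + t) (proj₁ lf d u v w) (proj₁ lg d u v w) ⟩
        c * (d * f (u ∷ w) + f (v ∷ w)) + (d * g (u ∷ w) + g (v ∷ w))
          ≡⟨ solve 6 (λ c d f₁ f₂ g₁ g₂ → c :* (d :* f₁ :+ f₂) :+ (d :* g₁ :+ g₂) := d :* (c :* f₁ :+ g₁) :+ (c :* f₂ :+ g₂)) refl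
               c d (f (u ∷ w)) (f (v ∷ w)) (g (u ∷ w)) (g (v ∷ w)) ⟩
        d * (c * f (u ∷ w) + g (u ∷ w)) + (c * f (v ∷ w) + g (v ∷ w)) ≡⟨ sym (cong₂ (λ s t → d * s + t) (eq _) (eq _)) ⟩
        d * h (u ∷ w) + h (v ∷ w) ∎) ,
      (λ u → Lin-comb n c (λ w → eq (u ∷ w)) (proj₂ lf u) (proj₂ lg u))

    Alt-comb : ∀ {m} n {f g h : Vec (Row m) n → Carrier} c → (∀ v → h v ≡ c * f v + g v) → Alt n f → Alt n g → Alt n h
    Alt-comb zero c eq _ _ = tt
    Alt-comb (suc zero) c eq _ _ = tt
    Alt-comb (suc (suc n)) c eq (f0 , af) (g0 , ag) =
      (λ u w → trans (eq _) (trans (cong₂ (λ s t → c * s + t) (f0 u w) (g0 u w)) (trans (+-identityʳ _) (zeroʳ c)))) ,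
      (λ u → Alt-comb (suc n) c (λ w → eq (u ∷ w)) (af u) (ag u))

    -- Brings a scalar multiple into the form that `Lin-comb` and `Alt-comb` accept, with the same
    -- function in both places.
    c≡[c-1]+1 : ∀ c x → c * x ≡ (c + - 1#) * x + x
    c≡[c-1]+1 = solve 2 (λ c x → c :* x := (c :+ :- con (ℤ.+ 1)) :* x :+ x) refl

    Lin-scale : ∀ {m} n {f : Vec (Row m) n → Carrier} c → Lin n f → Lin n (λ v → c * f v)
    Lin-scale n {f} c lf = Lin-comb n (c + - 1#) (λ v → c≡[c-1]+1 c (f v)) lf lf

    Alt-scale : ∀ {m} n {f : Vec (Row m) n → Carrier} c → Alt n f → Alt n (λ v → c * f v)
    Alt-scale n {f} c af = Alt-comb n (c + - 1#) (λ v → c≡[c-1]+1 c (f v)) af af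

    Lin-map : ∀ {m k} n (φ : Row m → Row k) → (∀ c u v → φ (c ∙ u ⊹ v) ≡ c ∙ φ u ⊹ φ v) →
      {f : Vec (Row k) n → Carrier} → Lin n f → Lin n (f ∘ map φ)
    Lin-map zero φ _ _ = tt
    Lin-map (suc n) φ φ-lin {f} (l , ls) =
      (λ c u v w → trans (cong (λ r → f (r ∷ map φ w)) (φ-lin c u v)) (l c (φ u) (φ v) (map φ w))) ,
      (λ u → Lin-map n φ φ-lin (ls (φ u)))

    Alt-map : ∀ {m k} n (φ : Row m → Row k) → {f : Vec (Row k) n → Carrier} → Alt n f → Alt n (f ∘ map φ)
    Alt-map zero φ _ = tt
    Alt-map (suc zero) φ _ = tt
    Alt-map (suc (suc n)) φ (a , as) = (λ u w → a (φ u) (map φ w)) , (λ u → Alt-map (suc n) φ (as (φ u)))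

    -- Expand the vanishing value at the doubled row `1# ∙ u ⊹ v`; two of the four resulting terms
    -- vanish as well.
    swap-rows : ∀ {m} n {f : Vec (Row m) (suc (suc n)) → Carrier} → Lin (suc (suc n)) f → Alt (suc (suc n)) f →
      ∀ u v w → f (u ∷ v ∷ w) ≡ - f (v ∷ u ∷ w)
    swap-rows n {f} (l , ls) (a , _) u v w = begin
      f (u ∷ v ∷ w)
        ≡⟨ solve 4 (λ s t x y → x := (con (ℤ.+ 1) :* (con (ℤ.+ 1) :* s :+ x) :+ (con (ℤ.+ 1) :* y :+ t)) :+ :- s :+ :- t :+ :- y) refl
            (f (u ∷ u ∷ w)) (f (v ∷ v ∷ w)) (f (u ∷ v ∷ w)) (f (v ∷ u ∷ w)) ⟩
      (1# * (1# * f (u ∷ u ∷ w) + f (u ∷ v ∷ w)) + (1# * f (v ∷ u ∷ w) + f (v ∷ v ∷ w))) + - f (u ∷ u ∷ w) + - f (v ∷ v ∷ w) + - f (v ∷ u ∷ w)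
        ≡⟨ cong (λ s → s + - f (u ∷ u ∷ w) + - f (v ∷ v ∷ w) + - f (v ∷ u ∷ w)) (sym (begin
            f (r ∷ r ∷ w) ≡⟨ l 1# u v (r ∷ w) ⟩
            1# * f (u ∷ r ∷ w) + f (v ∷ r ∷ w) ≡⟨ cong₂ (λ s t → 1# * s + t) (proj₁ (ls u) 1# u v w) (proj₁ (ls v) 1# u v w) ⟩
            1# * (1# * f (u ∷ u ∷ w) + f (u ∷ v ∷ w)) + (1# * f (v ∷ u ∷ w) + f (v ∷ v ∷ w)) ∎)) ⟩
      f (r ∷ r ∷ w) + - f (u ∷ u ∷ w) + - f (v ∷ v ∷ w) + - f (v ∷ u ∷ w)
        ≡⟨ cong₂ (λ s t → s + t + - f (v ∷ u ∷ w)) (cong₂ (λ s t → s + - t) (a r w) (a u w)) (cong -_ (a v w)) ⟩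
      0# + - 0# + - 0# + - f (v ∷ u ∷ w)
        ≡⟨ solve 1 (λ x → con (ℤ.+ 0) :+ :- con (ℤ.+ 0) :+ :- con (ℤ.+ 0) :+ :- x := :- x) refl _ ⟩
      - f (v ∷ u ∷ w) ∎
      where
      r = 1# ∙ u ⊹ v

    alt-head : ∀ {m} n {f : Vec (Row m) (suc n) → Carrier} → Lin (suc n) f → Alt (suc n) f →
      ∀ u v j → lookup v j ≡ u → f (u ∷ v) ≡ 0#
    alt-head (suc n) lf af u (.u ∷ v) zero refl = proj₁ af u v
    alt-head (suc n) {f} lf af u (b ∷ v) (suc j) eq = trans (swap-rows n {f} lf af u b v)
      (trans (cong -_ (alt-head n (proj₂ lf b) (proj₂ af b) u v j eq)) (solve 0 (:- con (ℤ.+ 0) := con (ℤ.+ 0)) refl))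

    alt-rows : ∀ {m} n {f : Vec (Row m) n → Carrier} → Lin n f → Alt n f →
      ∀ v i j → i ≢ j → lookup v i ≡ lookup v j → f v ≡ 0#
    alt-rows (suc n) lf af (u ∷ v) zero zero i≢j eq = contradiction refl i≢j
    alt-rows (suc n) lf af (u ∷ v) zero (suc j) i≢j eq = alt-head n lf af u v j (sym eq)
    alt-rows (suc n) lf af (u ∷ v) (suc i) zero i≢j eq = alt-head n lf af u v i eq
    alt-rows (suc n) lf af (u ∷ v) (suc i) (suc j) i≢j eq =
      alt-rows n (proj₂ lf u) (Alt-fix n af u) v i j (i≢j ∘ cong suc) eq

    lin-row : ∀ {m} n {f : Vec (Row m) n → Carrier} → Lin n f →
      ∀ x i c u v → f (x [ i ]≔ (c ∙ u ⊹ v)) ≡ c * f (x [ i ]≔ u) + f (x [ i ]≔ v)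
    lin-row (suc n) lf (r ∷ x) zero c u v = proj₁ lf c u v x
    lin-row (suc n) lf (r ∷ x) (suc i) c u v = lin-row n (proj₂ lf r) x i c u v

    linear-expand : ∀ m (L : Row m → Carrier) → (∀ c u v → L (c ∙ u ⊹ v) ≡ c * L u + L v) →
      ∀ r → L r ≡ Σᶠ (λ j → lookup r j * L (e j))
    linear-expand zero L lin [] = begin
      -- Linearity at the empty row says that `L []` is its own double, which forces zero.
      L [] ≡⟨ solve 1 (λ x → x := con (ℤ.+ 1) :* x :+ x :+ :- x) refl (L []) ⟩
      1# * L [] + L [] + - L [] ≡⟨ cong (_+ - L []) (sym (lin 1# [] [])) ⟩
      L [] + - L [] ≡⟨ -‿inverseʳ _ ⟩
      0# ∎
    linear-expand (suc m) L lin (x ∷ r) = begin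
      L (x ∷ r) ≡⟨ cong L (sym (cong₂ _∷_ (solve 1 (λ x → x :* con (ℤ.+ 1) :+ con (ℤ.+ 0) := x) refl x) (lookup-ext (λ i →
        begin
          lookup (x ∙ 𝟘 ⊹ r) i ≡⟨ lookup-⊹ (x ∙ 𝟘) r i ⟩
          lookup (x ∙ 𝟘) i + lookup r i ≡⟨ cong (_+ lookup r i) (trans (lookup-∙ x 𝟘 i) (cong (x *_) (Vec.lookup-replicate i 0#))) ⟩
          x * 0# + lookup r i ≡⟨ solve 2 (λ x y → x :* con (ℤ.+ 0) :+ y := y) refl x (lookup r i) ⟩
          lookup r i ∎)))) ⟩
      L (x ∙ e zero ⊹ (0# ∷ r)) ≡⟨ lin x (e zero) (0# ∷ r) ⟩
      x * L (e zero) + L (0# ∷ r) ≡⟨ cong (_+_ (x * L (e zero))) (linear-expand m (λ r → L (0# ∷ r))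
        (λ c u v → trans (cong (λ z → L (z ∷ (c ∙ u ⊹ v))) (solve 1 (λ c → con (ℤ.+ 0) := c :* con (ℤ.+ 0) :+ con (ℤ.+ 0)) refl c)) (lin c (0# ∷ u) (0# ∷ v))) r) ⟩
      Σᶠ (λ j → lookup (x ∷ r) j * L (e j)) ∎

    -- Row `j` passes over the `j` rows above it, at one sign per transposition.
    move-row : ∀ {m} n {f : Vec (Row m) (suc n) → Carrier} → Lin (suc n) f → Alt (suc n) f →
      ∀ v j → f (lookup v j ∷ removeAt v j) ≡ sign (toℕ j) * f v
    move-row n lf af (u ∷ v) zero = sym (*-identityˡ _)
    move-row (suc n) {f} lf af (u ∷ v@(_ ∷ _)) (suc j) = begin
      f (lookup v j ∷ u ∷ removeAt v j) ≡⟨ swap-rows n {f} lf af (lookup v j) u (removeAt v j) ⟩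
      - f (u ∷ lookup v j ∷ removeAt v j) ≡⟨ cong -_ (move-row n (proj₂ lf u) (proj₂ af u) v j) ⟩
      - (sign (toℕ j) * f (u ∷ v)) ≡⟨ solve 2 (λ x y → :- (x :* y) := :- x :* y) refl _ _ ⟩
      - sign (toℕ j) * f (u ∷ v) ∎

    -- Linearity in each row, where the added multiple of `a` contributes nothing. In `det-unique`
    -- the row `a` is one already fixed in front.
    clear-rows : ∀ {m} n {f : Vec (Row m) n → Carrier} (a : Row m) (κ : Row m → Carrier) → Lin n f →
      (∀ v j → lookup v j ≡ a → f v ≡ 0#) → ∀ v → f (map (λ r → κ r ∙ a ⊹ r) v) ≡ f v
    clear-rows zero a κ lf vanish [] = refl
    clear-rows (suc n) {f} a κ lf vanish (b ∷ v) = begin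
      f ((κ b ∙ a ⊹ b) ∷ v′) ≡⟨ proj₁ lf (κ b) a b v′ ⟩
      κ b * f (a ∷ v′) + f (b ∷ v′) ≡⟨ cong₂ (λ s t → κ b * s + t) (vanish (a ∷ v′) zero refl)
        (clear-rows n a κ (proj₂ lf b) (λ w j → vanish (b ∷ w) (suc j)) v) ⟩
      κ b * 0# + f (b ∷ v) ≡⟨ solve 2 (λ x y → x :* con (ℤ.+ 0) :+ y := y) refl _ _ ⟩
      f (b ∷ v) ∎
      where
      v′ = map (λ r → κ r ∙ a ⊹ r) v

    ∙𝟘⊹ : ∀ {m} c (r : Row m) → c ∙ 𝟘 ⊹ r ≡ r
    ∙𝟘⊹ c [] = refl
    ∙𝟘⊹ c (x ∷ r) = cong₂ _∷_ (solve 2 (λ c x → c :* con (ℤ.+ 0) :+ x := x) refl c x) (∙𝟘⊹ c r)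

    -- Zeroing column `j` is a row operation with the basis row `e j`; this is how a minor arises
    -- from rows of full width.
    insert-remove : ∀ {m} (j : Fin (suc m)) (r : Row (suc m)) →
      insertAt (removeAt r j) j 0# ≡ - lookup r j ∙ e j ⊹ r
    insert-remove zero (x ∷ r) = cong₂ _∷_ (solve 1 (λ x → con (ℤ.+ 0) := :- x :* con (ℤ.+ 1) :+ x) refl x) (sym (∙𝟘⊹ (- x) r))
    insert-remove (suc j) (x ∷ r@(_ ∷ _)) = cong₂ _∷_ (solve 2 (λ x y → x := :- y :* con (ℤ.+ 0) :+ x) refl x (lookup r j)) (insert-remove j r)

    insert-linear : ∀ {m} (j : Fin (suc m)) c (u v : Row m) → insertAt (c ∙ u ⊹ v) j 0# ≡ c ∙ insertAt u j 0# ⊹ insertAt v j 0#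
    insert-linear zero c u v = cong (_∷ _) (solve 1 (λ c → con (ℤ.+ 0) := c :* con (ℤ.+ 0) :+ con (ℤ.+ 0)) refl c)
    insert-linear (suc j) c (x ∷ u) (y ∷ v) = cong (_ ∷_) (insert-linear j c u v)

    insert-e : ∀ {m} (j : Fin (suc m)) (k : Fin m) → insertAt (e k) j 0# ≡ e (punchIn j k)
    insert-e zero k = refl
    insert-e (suc j) zero = cong (1# ∷_) (insert-𝟘 j)
      where
      insert-𝟘 : ∀ {m} (j : Fin (suc m)) → insertAt 𝟘 j 0# ≡ 𝟘
      insert-𝟘 zero = refl
      insert-𝟘 {suc m} (suc j) = cong (0# ∷_) (insert-𝟘 j)
    insert-e (suc j) (suc k) = cong (0# ∷_) (insert-e j k)

    remove-Id : ∀ n (j : Fin (suc n)) → removeAt (Id (suc n)) j ≡ map (λ r → insertAt r j 0#) (Id n)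
    remove-Id n j = lookup-ext λ k → begin
      lookup (removeAt (Id (suc n)) j) k ≡⟨ lookup-removeAt (Id (suc n)) j k ⟩
      lookup (Id (suc n)) (punchIn j k) ≡⟨ Vec.lookup∘tabulate e (punchIn j k) ⟩
      e (punchIn j k) ≡⟨ sym (insert-e j k) ⟩
      insertAt (e k) j 0# ≡⟨ cong (λ r → insertAt r j 0#) (sym (Vec.lookup∘tabulate e k)) ⟩
      insertAt (lookup (Id n) k) j 0# ≡⟨ sym (Vec.lookup-map k (λ r → insertAt r j 0#) (Id n)) ⟩
      lookup (map (λ r → insertAt r j 0#) (Id n)) k ∎

    -- Expand row 0 into basis rows. Below `e j` the column `j` may be cleared, so what remains is
    -- multilinear and alternating in the rows of the minor, and the induction applies; its value at
    -- the identity carries the sign of moving row `j` to the top.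
    det-unique : ∀ n {f : Mat n → Carrier} → Lin n f → Alt n f → ∀ M → f M ≡ det M * f (Id n)
    det-unique zero lf af [] = sym (*-identityˡ _)
    det-unique (suc n) {f} lf af (r ∷ rs) = begin
      f (r ∷ rs) ≡⟨ linear-expand (suc n) (λ u → f (u ∷ rs)) (λ c u v → proj₁ lf c u v rs) r ⟩
      Σᶠ (λ j → lookup r j * f (e j ∷ rs)) ≡⟨ Σᶠ-cong term ⟩
      Σᶠ (λ j → sign (toℕ j) * lookup r j * det (map (λ row → removeAt row j) rs) * f (Id (suc n)))
        ≡⟨ Σᶠ-*ʳ (λ j → sign (toℕ j) * lookup r j * det (map (λ row → removeAt row j) rs)) (f (Id (suc n))) ⟩
      det (r ∷ rs) * f (Id (suc n)) ∎
      where
      expand : ∀ j → f (e j ∷ rs) ≡ det (map (λ row → removeAt row j) rs) * (sign (toℕ j) * f (Id (suc n)))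
      expand j = begin
        f (e j ∷ rs) ≡⟨ sym (clear-rows n (e j) (λ s → - lookup s j) (proj₂ lf (e j)) (alt-head n lf af (e j)) rs) ⟩
        f (e j ∷ map (λ s → - lookup s j ∙ e j ⊹ s) rs) ≡⟨ cong (λ v → f (e j ∷ v))
          (trans (Vec.map-cong (λ s → sym (insert-remove j s)) rs) (Vec.map-∘ ins (λ s → removeAt s j) rs)) ⟩
        f (e j ∷ map ins (map (λ s → removeAt s j) rs))
          ≡⟨ det-unique n {λ v → f (e j ∷ map ins v)} (Lin-map n ins (insert-linear j) (proj₂ lf (e j)))
               (Alt-map n ins (Alt-fix n af (e j))) (map (λ s → removeAt s j) rs) ⟩
        det (map (λ s → removeAt s j) rs) * f (e j ∷ map ins (Id n))
          ≡⟨ cong (λ s → det (map (λ s → removeAt s j) rs) * s) (begin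
             f (e j ∷ map ins (Id n)) ≡⟨ cong₂ (λ s t → f (s ∷ t)) (sym (Vec.lookup∘tabulate e j)) (sym (remove-Id n j)) ⟩
             f (lookup (Id (suc n)) j ∷ removeAt (Id (suc n)) j) ≡⟨ move-row n lf af (Id (suc n)) j ⟩
             sign (toℕ j) * f (Id (suc n)) ∎) ⟩
        det (map (λ s → removeAt s j) rs) * (sign (toℕ j) * f (Id (suc n))) ∎
        where
        ins : Row n → Row (suc n)
        ins s = insertAt s j 0#
      term : ∀ j → lookup r j * f (e j ∷ rs) ≡ sign (toℕ j) * lookup r j * det (map (λ row → removeAt row j) rs) * f (Id (suc n))
      term j = trans (cong (lookup r j *_) (expand j))
        (solve 4 (λ x d s y → x :* (d :* (s :* y)) := s :* x :* d :* y) refl _ _ _ _)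

    -- Laplace expansion along the first column, written without minors: its multilinearity and alternation
    -- are immediate inductions, and they transfer to det through det-unique.
    colExpand : ∀ {n} m → (Vec (Row n) m → Carrier) → Vec (Row (suc n)) (suc m) → Carrier
    colExpand zero D (a ∷ []) = head a * D []
    colExpand (suc m) D (a ∷ v) = head a * D (map tail v) + - colExpand m (λ w → D (tail a ∷ w)) v

    colExpand-comb : ∀ {n} m {D₁ D₂ D₃ : Vec (Row n) m → Carrier} c → (∀ w → D₃ w ≡ c * D₁ w + D₂ w) →
      ∀ v → colExpand m D₃ v ≡ c * colExpand m D₁ v + colExpand m D₂ v
    colExpand-comb zero c eq (a ∷ []) = trans (cong (head a *_) (eq []))
      (solve 4 (λ h c x y → h :* (c :* x :+ y) := c :* (h :* x) :+ h :* y) refl _ _ _ _)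
    colExpand-comb (suc m) c eq (a ∷ v) = trans
      (cong₂ (λ s t → head a * s + - t) (eq (map tail v)) (colExpand-comb m c (λ w → eq (tail a ∷ w)) v))
      (solve 6 (λ h c x y z w → h :* (c :* x :+ y) :+ :- (c :* z :+ w) := c :* (h :* x :+ :- z) :+ (h :* y :+ :- w)) refl _ _ _ _ _ _)

    colExpand-lin : ∀ {n} m {D : Vec (Row n) m → Carrier} → Lin m D → Lin (suc m) (colExpand m D)
    colExpand-lin zero {D} ld =
      (λ { c (x ∷ u) (y ∷ v) [] → solve 4 (λ c x y d → (c :* x :+ y) :* d := c :* (x :* d) :+ y :* d) refl c x y (D []) }) , λ _ → tt
    colExpand-lin {n} (suc m) {D} ld =
      (λ { c (x ∷ u) (y ∷ v) w → trans
        (cong (λ t → (c * x + y) * D (map tail w) + - t) (colExpand-comb m c (λ w → proj₁ ld c u v w) w))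
        (solve 6 (λ c x y d s t → (c :* x :+ y) :* d :+ :- (c :* s :+ t) := c :* (x :* d :+ :- s) :+ (y :* d :+ :- t)) refl
          c x y (D (map tail w)) (colExpand m (λ w → D (u ∷ w)) w) (colExpand m (λ w → D (v ∷ w)) w)) }) ,
      (λ a → Lin-comb (suc m) {f = colExpand m (λ w → D (tail a ∷ w))} {g = λ v → head a * D (map tail v)} (- 1#)
        (λ v → solve 2 (λ s t → s :+ :- t := :- con (ℤ.+ 1) :* t :+ s) refl _ _)
        (colExpand-lin m (proj₂ ld (tail a)))
        (Lin-scale (suc m) {f = D ∘ map tail} (head a) (Lin-map (suc m) tail tail-lin {f = D} ld)))
      where
      tail-lin : ∀ c (u v : Row (suc n)) → tail (c ∙ u ⊹ v) ≡ c ∙ tail u ⊹ tail v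
      tail-lin c (x ∷ u) (y ∷ v) = refl

    colExpand-0 : ∀ {n} m {D : Vec (Row n) m → Carrier} → (∀ w → D w ≡ 0#) → ∀ v → colExpand m D v ≡ 0#
    colExpand-0 zero eq (a ∷ []) = trans (cong (head a *_) (eq [])) (zeroʳ _)
    colExpand-0 (suc m) eq (a ∷ v) = trans
      (cong₂ (λ s t → head a * s + - t) (eq (map tail v)) (colExpand-0 m (λ w → eq (tail a ∷ w)) v))
      (solve 1 (λ h → h :* con (ℤ.+ 0) :+ :- con (ℤ.+ 0) := con (ℤ.+ 0)) refl _)

    colExpand-alt : ∀ {n} m {D : Vec (Row n) m → Carrier} → Alt m D → Alt (suc m) (colExpand m D)
    colExpand-alt zero ad = tt
    colExpand-alt (suc m) {D} ad = cancel m ad ,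
      (λ a → Alt-comb (suc m) {f = colExpand m (λ w → D (tail a ∷ w))} {g = λ v → head a * D (map tail v)} (- 1#)
        (λ v → solve 2 (λ s t → s :+ :- t := :- con (ℤ.+ 1) :* t :+ s) refl _ _)
        (colExpand-alt m (Alt-fix m {D} ad (tail a)))
        (Alt-scale (suc m) {f = D ∘ map tail} (head a) (Alt-map (suc m) tail {f = D} ad)))
      where
      cancel : ∀ m {D : Vec (Row _) (suc m) → Carrier} → Alt (suc m) D → ∀ u w → colExpand (suc m) D (u ∷ u ∷ w) ≡ 0#
      cancel zero ad u [] = -‿inverseʳ _
      cancel (suc m) {D} ad u w = trans
        (cong (λ t → head u * D (tail u ∷ map tail w) + - (head u * D (tail u ∷ map tail w) + - t))
          (colExpand-0 m (proj₁ ad (tail u)) w))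
        (solve 1 (λ x → x :+ :- (x :+ :- con (ℤ.+ 0)) := con (ℤ.+ 0)) refl _)

    colExpand-heads-0 : ∀ {n} m {D : Vec (Row n) m → Carrier} → ∀ v → (∀ i → head (lookup v i) ≡ 0#) → colExpand m D v ≡ 0#
    colExpand-heads-0 zero (a ∷ []) h = trans (cong (_* _) (h zero)) (zeroˡ _)
    colExpand-heads-0 (suc m) {D} (a ∷ v) h = trans
      (cong₂ (λ s t → s * D (map tail v) + - t) (h zero) (colExpand-heads-0 m v (h ∘ suc)))
      (solve 1 (λ h → con (ℤ.+ 0) :* h :+ :- con (ℤ.+ 0) := con (ℤ.+ 0)) refl _)

    colDet : ∀ n → Mat n → Carrier
    colDet zero _ = 1#
    colDet (suc n) = colExpand n (colDet n)

    colDet-lin : ∀ n → Lin n (colDet n)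
    colDet-lin zero = tt
    colDet-lin (suc n) = colExpand-lin n (colDet-lin n)

    colDet-alt : ∀ n → Alt n (colDet n)
    colDet-alt zero = tt
    colDet-alt (suc n) = colExpand-alt n (colDet-alt n)

    colDet-Id : ∀ n → colDet n (Id n) ≡ 1#
    colDet-Id zero = refl
    colDet-Id (suc zero) = *-identityˡ 1#
    colDet-Id (suc (suc n)) = begin
      1# * colDet (suc n) (map tail (tabulate (λ i → 0# ∷ e i))) + - colExpand n (λ w → colDet (suc n) (𝟘 ∷ w)) (tabulate (λ i → 0# ∷ e i))
        ≡⟨ cong₂ (λ s t → 1# * colDet (suc n) s + - t) (sym (Vec.tabulate-∘ tail (λ i → 0# ∷ e i)))
             (colExpand-heads-0 n (tabulate (λ i → 0# ∷ e i)) (λ i → cong head (Vec.lookup∘tabulate (λ i → 0# ∷ e i) i))) ⟩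
      1# * colDet (suc n) (Id (suc n)) + - 0# ≡⟨ solve 1 (λ x → con (ℤ.+ 1) :* x :+ :- con (ℤ.+ 0) := x) refl _ ⟩
      colDet (suc n) (Id (suc n)) ≡⟨ colDet-Id (suc n) ⟩
      1# ∎

    det≡colDet : ∀ n (M : Mat n) → det M ≡ colDet n M
    det≡colDet n M = sym (trans (det-unique n (colDet-lin n) (colDet-alt n) M)
      (trans (cong (det M *_) (colDet-Id n)) (*-identityʳ _)))

    det-Id : ∀ n → det (Id n) ≡ 1#
    det-Id n = trans (det≡colDet n (Id n)) (colDet-Id n)

    det-row : ∀ {n} (x : Mat n) i c u v → det (x [ i ]≔ (c ∙ u ⊹ v)) ≡ c * det (x [ i ]≔ u) + det (x [ i ]≔ v)
    det-row {n} x i c u v = trans (det≡colDet n _) (trans (lin-row n (colDet-lin n) x i c u v)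
      (sym (cong₂ (λ s t → c * s + t) (det≡colDet n _) (det≡colDet n _))))

    det-alt : ∀ {n} (x : Mat n) i j → i ≢ j → lookup x i ≡ lookup x j → det x ≡ 0#
    det-alt {n} x i j i≢j eq = trans (det≡colDet n x) (alt-rows n (colDet-lin n) (colDet-alt n) x i j i≢j eq)

-- Matrix multiplication and inverses in SL

module MatrixProducts where
  open import Data.Nat.Base using (ℕ; zero; suc)
  open import Data.Fin.Base as Fin using (Fin; zero; suc)
  import Data.Fin.Properties as Fin
  open import Data.Vec.Base using (Vec; map; lookup; tabulate; _[_]≔_)
  import Data.Vec.Properties as Vec
  open import Function.Base using (_∘_)
  open import Relation.Nullary.Decidable using (Dec; yes; no)
  open import Relation.Binary.PropositionalEquality
  open FieldAlgebra
  open Determinants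
  open ≡-Reasoning

  module MatrixAlgebra {q : ℕ} (F : FiniteField q) where
    open FiniteField F
    open FieldSolver F
    open Matrices F
    open Determinant F

    entry : ∀ {n} → Mat n → Fin n → Fin n → Carrier
    entry x i j = lookup (lookup x i) j

    mk : ∀ {n} → (Fin n → Fin n → Carrier) → Mat n
    mk f = tabulate λ i → tabulate (f i)

    entry-mk : ∀ {n} (f : Fin n → Fin n → Carrier) i j → entry (mk f) i j ≡ f i j
    entry-mk f i j = trans (cong (λ r → lookup r j) (Vec.lookup∘tabulate (λ i → tabulate (f i)) i)) (Vec.lookup∘tabulate (f i) j)

    mat-ext : ∀ {n} {x y : Mat n} → (∀ i j → entry x i j ≡ entry y i j) → x ≡ y
    mat-ext eq = lookup-ext (λ i → lookup-ext (eq i))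

    -- The Kronecker delta with values in the field.
    κ : ∀ {n} → Fin n → Fin n → Carrier
    κ i j = lookup (e i) j

    κ-diag : ∀ {n} (i : Fin n) → κ i i ≡ 1#
    κ-diag zero = refl
    κ-diag (suc i) = κ-diag i

    κ-off : ∀ {n} {i j : Fin n} → i ≢ j → κ i j ≡ 0#
    κ-off {i = zero} {zero} i≢j = contradiction refl i≢j
      where open import Relation.Nullary.Negation using (contradiction)
    κ-off {i = zero} {suc j} i≢j = Vec.lookup-replicate j 0#
    κ-off {i = suc i} {zero} i≢j = refl
    κ-off {i = suc i} {suc j} i≢j = κ-off (i≢j ∘ cong suc)

    κ-sym : ∀ {n} (i j : Fin n) → κ i j ≡ κ j i
    κ-sym i j with i Fin.≟ j
    ... | yes refl = refl
    ... | no i≢j = trans (κ-off i≢j) (sym (κ-off (i≢j ∘ sym)))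

    Σᶠ-κ : ∀ {n} (i : Fin n) (f : Fin n → Carrier) → Σᶠ (λ j → κ i j * f j) ≡ f i
    Σᶠ-κ {suc n} zero f = begin
      1# * f zero + Σᶠ (λ j → lookup 𝟘 j * f (suc j)) ≡⟨ cong₂ _+_ (*-identityˡ _)
        (Σᶠ-0 (λ j → trans (cong (_* f (suc j)) (Vec.lookup-replicate j 0#)) (zeroˡ _))) ⟩
      f zero + 0# ≡⟨ +-identityʳ _ ⟩
      f zero ∎
    Σᶠ-κ (suc i) f = trans (cong₂ _+_ (zeroˡ _) (Σᶠ-κ i (f ∘ suc))) (+-identityˡ _)

    Σᶠ-κʳ : ∀ {n} (i : Fin n) (f : Fin n → Carrier) → Σᶠ (λ j → f j * κ j i) ≡ f i
    Σᶠ-κʳ i f = trans (Σᶠ-cong (λ j → trans (*-comm (f j) (κ j i)) (cong (_* f j) (κ-sym j i)))) (Σᶠ-κ i f)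

    entry-Id : ∀ {n} (i j : Fin n) → entry (Id n) i j ≡ κ i j
    entry-Id i j = cong (λ r → lookup r j) (Vec.lookup∘tabulate e i)

    entry-* : ∀ {n} (x y : Mat n) i j → entry (x *M y) i j ≡ Σᶠ (λ k → entry x i k * entry y k j)
    entry-* x y = entry-mk _

    entry-+ : ∀ {n} (x y : Mat n) i j → entry (x +M y) i j ≡ entry x i j + entry y i j
    entry-+ x y = entry-mk _

    *M-assoc : ∀ {n} (x y z : Mat n) → (x *M y) *M z ≡ x *M (y *M z)
    *M-assoc x y z = mat-ext λ i j → begin
      entry ((x *M y) *M z) i j ≡⟨ entry-* (x *M y) z i j ⟩
      Σᶠ (λ k → entry (x *M y) i k * entry z k j)
        ≡⟨ Σᶠ-cong (λ k → trans (cong (_* entry z k j) (entry-* x y i k)) (sym (Σᶠ-*ʳ (λ l → entry x i l * entry y l k) (entry z k j)))) ⟩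
      Σᶠ (λ k → Σᶠ (λ l → entry x i l * entry y l k * entry z k j)) ≡⟨ Σᶠ-swap (λ k l → entry x i l * entry y l k * entry z k j) ⟩
      Σᶠ (λ l → Σᶠ (λ k → entry x i l * entry y l k * entry z k j))
        ≡⟨ Σᶠ-cong (λ l → trans (trans (Σᶠ-cong (λ k → *-assoc (entry x i l) (entry y l k) (entry z k j))) (Σᶠ-* (entry x i l) (λ k → entry y l k * entry z k j)))
             (cong (entry x i l *_) (sym (entry-* y z l j)))) ⟩
      Σᶠ (λ l → entry x i l * entry (y *M z) l j) ≡⟨ sym (entry-* x (y *M z) i j) ⟩
      entry (x *M (y *M z)) i j ∎

    *M-identityˡ : ∀ {n} (x : Mat n) → Id n *M x ≡ x
    *M-identityˡ x = mat-ext λ i j → trans (entry-* (Id _) x i j)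
      (trans (Σᶠ-cong (λ k → cong (_* entry x k j) (entry-Id i k))) (Σᶠ-κ i (λ k → entry x k j)))

    *M-identityʳ : ∀ {n} (x : Mat n) → x *M Id n ≡ x
    *M-identityʳ x = mat-ext λ i j → trans (entry-* x (Id _) i j)
      (trans (Σᶠ-cong (λ k → cong (entry x i k *_) (entry-Id k j))) (Σᶠ-κʳ j (λ k → entry x i k)))

    -- As a function of the rows of `x` the left side is multilinear and alternating, so
    -- `det-unique` applies.
    det-* : ∀ {n} (x y : Mat n) → det (x *M y) ≡ det x * det y
    det-* {n} x y = begin
      det (x *M y) ≡⟨ cong det (*M-map x) ⟩
      det (map rowMul x) ≡⟨ det≡colDet n (map rowMul x) ⟩
      colDet n (map rowMul x) ≡⟨ det-unique n (Lin-map n rowMul rowMul-lin {f = colDet n} (colDet-lin n)) (Alt-map n rowMul {f = colDet n} (colDet-alt n)) x ⟩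
      det x * colDet n (map rowMul (Id n)) ≡⟨ cong (det x *_) (trans (sym (det≡colDet n _)) (cong det (trans (sym (*M-map (Id n))) (*M-identityˡ y)))) ⟩
      det x * det y ∎
      where
      rowMul : Row n → Row n
      rowMul r = tabulate λ j → Σᶠ (λ k → lookup r k * entry y k j)
      *M-map : ∀ x → x *M y ≡ map rowMul x
      *M-map x = lookup-ext λ i → trans (Vec.lookup∘tabulate (λ i → rowMul (lookup x i)) i) (sym (Vec.lookup-map i rowMul x))
      rowMul-lin : ∀ c u v → rowMul (c ∙ u ⊹ v) ≡ c ∙ rowMul u ⊹ rowMul v
      rowMul-lin c u v = lookup-ext λ j → begin
        lookup (rowMul (c ∙ u ⊹ v)) j ≡⟨ Vec.lookup∘tabulate _ j ⟩
        Σᶠ (λ k → lookup (c ∙ u ⊹ v) k * entry y k j)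
          ≡⟨ Σᶠ-cong (λ k → trans (cong (_* entry y k j) (trans (lookup-⊹ (c ∙ u) v k) (cong (_+ lookup v k) (lookup-∙ c u k))))
               (solve 4 (λ c u v y → (c :* u :+ v) :* y := c :* (u :* y) :+ v :* y) refl c (lookup u k) (lookup v k) (entry y k j))) ⟩
        Σᶠ (λ k → c * (lookup u k * entry y k j) + lookup v k * entry y k j) ≡⟨ Σᶠ-+ (λ k → c * (lookup u k * entry y k j)) (λ k → lookup v k * entry y k j) ⟩
        Σᶠ (λ k → c * (lookup u k * entry y k j)) + Σᶠ (λ k → lookup v k * entry y k j) ≡⟨ cong (_+ _) (Σᶠ-* c (λ k → lookup u k * entry y k j)) ⟩
        c * Σᶠ (λ k → lookup u k * entry y k j) + Σᶠ (λ k → lookup v k * entry y k j)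
          ≡⟨ sym (trans (lookup-⊹ (c ∙ rowMul u) (rowMul v) j)
               (cong₂ _+_ (trans (lookup-∙ c (rowMul u) j) (cong (c *_) (Vec.lookup∘tabulate _ j))) (Vec.lookup∘tabulate _ j))) ⟩
        lookup (c ∙ rowMul u ⊹ rowMul v) j ∎

    -- The adjugate: replacing row `i` by `e s` yields a cofactor with its sign included. On SL it
    -- serves as the inverse.
    adj : ∀ {n} → Mat n → Mat n
    adj x = mk λ s i → det (x [ i ]≔ e s)

    det-update : ∀ {n} (x : Mat n) i z → det (x [ i ]≔ z) ≡ Σᶠ (λ s → lookup z s * entry (adj x) s i)
    det-update x i z = trans (linear-expand _ (λ z → det (x [ i ]≔ z)) (λ c u v → det-row x i c u v) z)
      (Σᶠ-cong (λ s → cong (lookup z s *_) (sym (entry-mk (λ s i → det (x [ i ]≔ e s)) s i))))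

    -- Both sides are the determinant after replacing row `i` by row `t`, which repeats a row unless
    -- `t` is `i`.
    adj-row : ∀ {n} (x : Mat n) t i → Σᶠ (λ s → entry x t s * entry (adj x) s i) ≡ κ t i * det x
    adj-row x t i = trans (sym (det-update x i (lookup x t))) (cases (t Fin.≟ i))
      where
      cases : Dec (t ≡ i) → det (x [ i ]≔ lookup x t) ≡ κ t i * det x
      cases (yes refl) = trans (cong det (Vec.[]≔-lookup x t)) (sym (trans (cong (_* det x) (κ-diag t)) (*-identityˡ _)))
      cases (no t≢i) = trans (det-alt (x [ i ]≔ lookup x t) t i t≢i
          (trans (Vec.lookup∘update′ t≢i x (lookup x t)) (sym (Vec.lookup∘update i x (lookup x t)))))
        (sym (trans (cong (_* det x) (κ-off t≢i)) (zeroˡ _)))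

    *M-adj : ∀ {n} (x : Mat n) → det x ≡ 1# → x *M adj x ≡ Id n
    *M-adj x d = mat-ext λ i j → trans (entry-* x (adj x) i j) (trans (adj-row x i j)
      (trans (cong (κ i j *_) d) (trans (*-identityʳ _) (sym (entry-Id i j)))))

    det-adj : ∀ {n} (x : Mat n) → det x ≡ 1# → det (adj x) ≡ 1#
    det-adj {n} x d = begin
      det (adj x) ≡⟨ sym (*-identityˡ _) ⟩
      1# * det (adj x) ≡⟨ cong (_* det (adj x)) (sym d) ⟩
      det x * det (adj x) ≡⟨ sym (det-* x (adj x)) ⟩
      det (x *M adj x) ≡⟨ cong det (*M-adj x d) ⟩
      det (Id n) ≡⟨ det-Id n ⟩
      1# ∎

    -- The right inverse `adj x` has a right inverse of its own, and associativity identifies that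
    -- one with `x`. This makes right inverses two-sided.
    adj-adj : ∀ {n} (x : Mat n) → det x ≡ 1# → adj (adj x) ≡ x
    adj-adj {n} x d = begin
      adj (adj x) ≡⟨ sym (*M-identityˡ _) ⟩
      Id n *M adj (adj x) ≡⟨ cong (_*M adj (adj x)) (sym (*M-adj x d)) ⟩
      (x *M adj x) *M adj (adj x) ≡⟨ *M-assoc x (adj x) (adj (adj x)) ⟩
      x *M (adj x *M adj (adj x)) ≡⟨ cong (x *M_) (*M-adj (adj x) (det-adj x d)) ⟩
      x *M Id n ≡⟨ *M-identityʳ x ⟩
      x ∎

    adj-* : ∀ {n} (x : Mat n) → det x ≡ 1# → adj x *M x ≡ Id n
    adj-* x d = trans (cong (adj x *M_) (sym (adj-adj x d))) (*M-adj (adj x) (det-adj x d))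

    *M-cancelˡ : ∀ {n} (x y : Mat n) → det x ≡ 1# → adj x *M (x *M y) ≡ y
    *M-cancelˡ x y d = trans (sym (*M-assoc (adj x) x y)) (trans (cong (_*M y) (adj-* x d)) (*M-identityˡ y))

    *M-cancelʳ : ∀ {n} (x y : Mat n) → det y ≡ 1# → (x *M y) *M adj y ≡ x
    *M-cancelʳ x y d = trans (*M-assoc x y (adj y)) (trans (cong (x *M_) (*M-adj y d)) (*M-identityʳ x))

    *M-cancelʳ′ : ∀ {n} (x y : Mat n) → det y ≡ 1# → (x *M adj y) *M y ≡ x
    *M-cancelʳ′ x y d = trans (*M-assoc x (adj y) y) (trans (cong (x *M_) (adj-* y d)) (*M-identityʳ x))

-- The abelian group of row operations into one row

module RowOperations where
  open import Data.Nat.Base using (ℕ)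
  open import Data.Fin.Base as Fin using (Fin)
  import Data.Fin.Properties as Fin
  open import Data.Vec.Base using (Vec; lookup; tabulate; _[_]≔_)
  import Data.Vec.Properties as Vec
  import Data.Integer.Base as ℤ
  open import Function.Base using (_∘_)
  open import Relation.Nullary.Decidable using (Dec; yes; no)
  open import Relation.Binary.PropositionalEquality
  open FieldAlgebra
  open Determinants
  open MatrixProducts
  open ≡-Reasoning

  module RowAction {q : ℕ} (F : FiniteField q) where
    open FiniteField F
    open FieldSolver F
    open Matrices F
    open Determinant F
    open MatrixAlgebra F

    -- A mask that keeps row `i` out of the combination which `act` adds to row `i`.
    off : ∀ {n} → Fin n → Fin n → Carrier
    off i t = 1# + - κ i t

    off-diag : ∀ {n} (i : Fin n) → off i i ≡ 0#
    off-diag i = trans (cong (λ z → 1# + - z) (κ-diag i)) (-‿inverseʳ 1#)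

    off-off : ∀ {n} {i t : Fin n} → i ≢ t → off i t ≡ 1#
    off-off i≢t = trans (cong (λ z → 1# + - z) (κ-off i≢t)) (solve 0 (con (ℤ.+ 1) :+ :- con (ℤ.+ 0) := con (ℤ.+ 1)) refl)

    off-κ : ∀ {n} (i t : Fin n) → off i t * κ t i ≡ 0#
    off-κ i t with i Fin.≟ t
    ... | yes refl = trans (cong (_* κ i i) (off-diag i)) (zeroˡ _)
    ... | no i≢t = trans (cong (off i t *_) (κ-off (i≢t ∘ sym))) (zeroʳ _)

    comb : ∀ {n} → Fin n → Row n → Mat n → Fin n → Carrier
    comb i w x s = Σᶠ λ t → lookup w t * (off i t * entry x t s)

    -- The coordinate w i plays no role: the index group is Row n for every i, each row operation being counted q times.
    act : ∀ {n} → Fin n → Row n → Mat n → Mat n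
    act i w x = mk λ r s → entry x r s + κ r i * comb i w x s

    entry-act : ∀ {n} (i : Fin n) w x r s → entry (act i w x) r s ≡ entry x r s + κ r i * comb i w x s
    entry-act i w x = entry-mk _

    act-cong : ∀ {n} (i : Fin n) {v w : Row n} → (∀ t → i ≢ t → lookup v t ≡ lookup w t) → ∀ x → act i v x ≡ act i w x
    act-cong i {v} {w} eq x = mat-ext λ r s → begin
      entry (act i v x) r s ≡⟨ entry-act i v x r s ⟩
      entry x r s + κ r i * comb i v x s ≡⟨ cong (λ z → entry x r s + κ r i * z) (Σᶠ-cong (term s)) ⟩
      entry x r s + κ r i * comb i w x s ≡⟨ sym (entry-act i w x r s) ⟩
      entry (act i w x) r s ∎
      where
      term : ∀ s t → lookup v t * (off i t * entry x t s) ≡ lookup w t * (off i t * entry x t s)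
      term s t with i Fin.≟ t
      ... | yes refl = trans (vanish (lookup v i)) (sym (vanish (lookup w i)))
        where
        vanish : ∀ c → c * (off i i * entry x i s) ≡ 0#
        vanish c = trans (cong (λ o → c * (o * entry x i s)) (off-diag i))
          (solve 2 (λ c x → c :* (con (ℤ.+ 0) :* x) := con (ℤ.+ 0)) refl c (entry x i s))
      ... | no i≢t = cong (_* (off i t * entry x t s)) (eq t i≢t)

    -- Only rows other than `i` enter, and `act i` leaves those alone; hence the operations compose
    -- by adding their coefficients.
    comb-act : ∀ {n} (i : Fin n) v w x s → comb i v (act i w x) s ≡ comb i v x s
    comb-act i v w x s = Σᶠ-cong λ t → begin
      lookup v t * (off i t * entry (act i w x) t s) ≡⟨ cong (λ z → lookup v t * (off i t * z)) (entry-act i w x t s) ⟩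
      lookup v t * (off i t * (entry x t s + κ t i * comb i w x s))
        ≡⟨ solve 5 (λ v o x k c → v :* (o :* (x :+ k :* c)) := v :* (o :* x) :+ v :* ((o :* k) :* c)) refl _ _ _ _ _ ⟩
      lookup v t * (off i t * entry x t s) + lookup v t * ((off i t * κ t i) * comb i w x s)
        ≡⟨ cong (λ z → lookup v t * (off i t * entry x t s) + lookup v t * (z * comb i w x s)) (off-κ i t) ⟩
      lookup v t * (off i t * entry x t s) + lookup v t * (0# * comb i w x s)
        ≡⟨ solve 3 (λ a v c → a :+ v :* (con (ℤ.+ 0) :* c) := a) refl _ _ _ ⟩
      lookup v t * (off i t * entry x t s) ∎

    comb-⊹ : ∀ {n} (i : Fin n) v w x s → comb i (v ⊹ w) x s ≡ comb i v x s + comb i w x s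
    comb-⊹ i v w x s = trans (Σᶠ-cong (λ t → trans (cong (_* (off i t * entry x t s)) (lookup-⊹ v w t)) (distribʳ _ _ _)))
      (Σᶠ-+ (λ t → lookup v t * (off i t * entry x t s)) (λ t → lookup w t * (off i t * entry x t s)))

    act-⊹ : ∀ {n} (i : Fin n) v w x → act i (v ⊹ w) x ≡ act i v (act i w x)
    act-⊹ i v w x = mat-ext λ r s → begin
      entry (act i (v ⊹ w) x) r s ≡⟨ entry-act i (v ⊹ w) x r s ⟩
      entry x r s + κ r i * comb i (v ⊹ w) x s ≡⟨ cong (λ z → entry x r s + κ r i * z) (comb-⊹ i v w x s) ⟩
      entry x r s + κ r i * (comb i v x s + comb i w x s) ≡⟨ solve 4 (λ x k a b → x :+ k :* (a :+ b) := (x :+ k :* b) :+ k :* a) refl _ _ _ _ ⟩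
      (entry x r s + κ r i * comb i w x s) + κ r i * comb i v x s
        ≡⟨ cong₂ (λ a b → a + κ r i * b) (sym (entry-act i w x r s)) (sym (comb-act i v w x s)) ⟩
      entry (act i w x) r s + κ r i * comb i v (act i w x) s ≡⟨ sym (entry-act i v (act i w x) r s) ⟩
      entry (act i v (act i w x)) r s ∎

    act-𝟘 : ∀ {n} (i : Fin n) x → act i 𝟘 x ≡ x
    act-𝟘 i x = mat-ext λ r s → begin
      entry (act i 𝟘 x) r s ≡⟨ entry-act i 𝟘 x r s ⟩
      entry x r s + κ r i * comb i 𝟘 x s ≡⟨ cong (λ z → entry x r s + κ r i * z)
        (Σᶠ-0 (λ t → trans (cong (_* (off i t * entry x t s)) (Vec.lookup-replicate t 0#)) (zeroˡ _))) ⟩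
      entry x r s + κ r i * 0# ≡⟨ solve 2 (λ x k → x :+ k :* con (ℤ.+ 0) := x) refl _ _ ⟩
      entry x r s ∎

    ⊖_ : ∀ {n} → Row n → Row n
    ⊖ w = (- 1#) ∙ w

    ⊹-inverseˡ : ∀ {n} (w : Row n) → (⊖ w) ⊹ w ≡ 𝟘
    ⊹-inverseˡ w = lookup-ext λ i → trans (lookup-⊹ (⊖ w) w i) (trans (cong (_+ lookup w i) (lookup-∙ (- 1#) w i))
      (trans (solve 1 (λ x → :- con (ℤ.+ 1) :* x :+ x := con (ℤ.+ 0)) refl _) (sym (Vec.lookup-replicate i 0#))))

    ⊹-identityˡ : ∀ {n} (w : Row n) → 𝟘 ⊹ w ≡ w
    ⊹-identityˡ = Vec.zipWith-identityˡ +-identityˡ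

    ⊹-assoc : ∀ {n} (u v w : Row n) → (u ⊹ v) ⊹ w ≡ u ⊹ (v ⊹ w)
    ⊹-assoc = Vec.zipWith-assoc +-assoc

    ⊹-comm : ∀ {n} (u v : Row n) → u ⊹ v ≡ v ⊹ u
    ⊹-comm = Vec.zipWith-comm +-comm

    act-inverse : ∀ {n} (i : Fin n) w x → act i (⊖ w) (act i w x) ≡ x
    act-inverse i w x = trans (sym (act-⊹ i (⊖ w) w x)) (trans (cong (λ v → act i v x) (⊹-inverseˡ w)) (act-𝟘 i x))

    -- A row operation is a left multiplication, so it commutes with right multiplication; this is
    -- what allows `T` and `rootWord` to be translated on the right.
    act-* : ∀ {n} (i : Fin n) w x y → act i w x *M y ≡ act i w (x *M y)
    act-* i w x y = mat-ext λ r s → begin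
      entry (act i w x *M y) r s ≡⟨ entry-* (act i w x) y r s ⟩
      Σᶠ (λ k → entry (act i w x) r k * entry y k s)
        ≡⟨ Σᶠ-cong (λ k → trans (cong (_* entry y k s) (entry-act i w x r k))
             (solve 4 (λ x k c y → (x :+ k :* c) :* y := x :* y :+ k :* (c :* y)) refl _ _ _ _)) ⟩
      Σᶠ (λ k → entry x r k * entry y k s + κ r i * (comb i w x k * entry y k s))
        ≡⟨ trans (Σᶠ-+ (λ k → entry x r k * entry y k s) (λ k → κ r i * (comb i w x k * entry y k s)))
             (cong (_+_ (Σᶠ (λ k → entry x r k * entry y k s))) (Σᶠ-* (κ r i) (λ k → comb i w x k * entry y k s))) ⟩
      Σᶠ (λ k → entry x r k * entry y k s) + κ r i * Σᶠ (λ k → comb i w x k * entry y k s)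
        ≡⟨ cong₂ (λ a b → a + κ r i * b) (sym (entry-* x y r s)) (comb-* s) ⟩
      entry (x *M y) r s + κ r i * comb i w (x *M y) s ≡⟨ sym (entry-act i w (x *M y) r s) ⟩
      entry (act i w (x *M y)) r s ∎
      where
      comb-* : ∀ s → Σᶠ (λ k → comb i w x k * entry y k s) ≡ comb i w (x *M y) s
      comb-* s = begin
        Σᶠ (λ k → comb i w x k * entry y k s) ≡⟨ Σᶠ-cong (λ k → sym (Σᶠ-*ʳ (λ t → lookup w t * (off i t * entry x t k)) (entry y k s))) ⟩
        Σᶠ (λ k → Σᶠ (λ t → lookup w t * (off i t * entry x t k) * entry y k s))
          ≡⟨ Σᶠ-swap (λ k t → lookup w t * (off i t * entry x t k) * entry y k s) ⟩
        Σᶠ (λ t → Σᶠ (λ k → lookup w t * (off i t * entry x t k) * entry y k s))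
          ≡⟨ Σᶠ-cong (λ t → trans (Σᶠ-cong (λ k → solve 4 (λ w o x y → w :* (o :* x) :* y := (w :* o) :* (x :* y)) refl (lookup w t) (off i t) (entry x t k) (entry y k s)))
               (trans (Σᶠ-* (lookup w t * off i t) (λ k → entry x t k * entry y k s))
               (trans (*-assoc _ _ _) (cong (λ z → lookup w t * (off i t * z)) (sym (entry-* x y t s)))))) ⟩
        comb i w (x *M y) s ∎

    -- Row `i` gains a combination of the other rows, and each of these contributes zero by
    -- `adj-row`.
    det-act : ∀ {n} (i : Fin n) w x → det (act i w x) ≡ det x
    det-act i w x = begin
      det (act i w x) ≡⟨ cong det act≡update ⟩
      det (x [ i ]≔ z) ≡⟨ det-update x i z ⟩
      Σᶠ (λ s → lookup z s * entry (adj x) s i)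
        ≡⟨ Σᶠ-cong (λ s → trans (cong (_* entry (adj x) s i) (Vec.lookup∘tabulate _ s)) (distribʳ _ _ _)) ⟩
      Σᶠ (λ s → entry x i s * entry (adj x) s i + comb i w x s * entry (adj x) s i)
        ≡⟨ Σᶠ-+ (λ s → entry x i s * entry (adj x) s i) (λ s → comb i w x s * entry (adj x) s i) ⟩
      Σᶠ (λ s → entry x i s * entry (adj x) s i) + Σᶠ (λ s → comb i w x s * entry (adj x) s i)
        ≡⟨ cong₂ _+_ (trans (adj-row x i i) (trans (cong (_* det x) (κ-diag i)) (*-identityˡ _))) rest ⟩
      det x + 0# ≡⟨ +-identityʳ _ ⟩
      det x ∎
      where
      z = tabulate λ s → entry x i s + comb i w x s
      act≡update : act i w x ≡ x [ i ]≔ z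
      act≡update = mat-ext λ r s → trans (entry-act i w x r s) (sym (cases r s (r Fin.≟ i)))
        where
        cases : ∀ r s → Dec (r ≡ i) → entry (x [ i ]≔ z) r s ≡ entry x r s + κ r i * comb i w x s
        cases r s (yes refl) = trans (cong (λ v → lookup v s) (Vec.lookup∘update i x z)) (trans (Vec.lookup∘tabulate _ s)
          (cong (_+_ (entry x i s)) (sym (trans (cong (_* comb i w x s) (κ-diag i)) (*-identityˡ _)))))
        cases r s (no r≢i) = trans (cong (λ v → lookup v s) (Vec.lookup∘update′ r≢i x z))
          (sym (trans (cong (λ k → entry x r s + k * comb i w x s) (κ-off r≢i)) (solve 2 (λ x c → x :+ con (ℤ.+ 0) :* c := x) refl _ _)))
      rest : Σᶠ (λ s → comb i w x s * entry (adj x) s i) ≡ 0#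
      rest = begin
        Σᶠ (λ s → comb i w x s * entry (adj x) s i) ≡⟨ Σᶠ-cong (λ s → sym (Σᶠ-*ʳ (λ t → lookup w t * (off i t * entry x t s)) (entry (adj x) s i))) ⟩
        Σᶠ (λ s → Σᶠ (λ t → lookup w t * (off i t * entry x t s) * entry (adj x) s i))
          ≡⟨ Σᶠ-swap (λ s t → lookup w t * (off i t * entry x t s) * entry (adj x) s i) ⟩
        Σᶠ (λ t → Σᶠ (λ s → lookup w t * (off i t * entry x t s) * entry (adj x) s i))
          ≡⟨ Σᶠ-0 (λ t → trans (Σᶠ-cong (λ s → solve 4 (λ w o x y → w :* (o :* x) :* y := (w :* o) :* (x :* y)) refl (lookup w t) (off i t) (entry x t s) (entry (adj x) s i)))
               (trans (Σᶠ-* (lookup w t * off i t) (λ s → entry x t s * entry (adj x) s i))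
               (trans (cong (lookup w t * off i t *_) (adj-row x t i))
               (trans (solve 4 (λ w o k d → w :* o :* (k :* d) := w :* (o :* k) :* d) refl _ _ _ _)
               (trans (cong (λ z → lookup w t * z * det x) (off-κ i t)) (solve 2 (λ w d → w :* con (ℤ.+ 0) :* d := con (ℤ.+ 0)) refl _ _)))))) ⟩
        0# ∎

    -- Row operations into row k conjugate the group of row operations into row i.
    act-conj : ∀ {n} {i k : Fin n} → i ≢ k → ∀ (α w : Row n) → lookup α i ≡ 0# → lookup α k ≡ 0# → ∀ x →
      act k α (act i (w ⊹ lookup w k ∙ α) x) ≡ act i w (act k α x)
    act-conj {i = i} {k} i≢k α w αi αk x = mat-ext λ r s → begin
      entry (act k α y) r s ≡⟨ entry-act k α y r s ⟩
      entry y r s + κ r k * comb k α y s ≡⟨ cong₂ (λ a b → a + κ r k * b) (entry-act i w′ x r s) (comb-α y s) ⟩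
      (entry x r s + κ r i * comb i w′ x s) + κ r k * Σᶠ (λ t → lookup α t * entry y t s)
        ≡⟨ cong₂ (λ a b → (entry x r s + κ r i * a) + κ r k * b) (comb-w′ s) (Σα-y s) ⟩
      (entry x r s + κ r i * (comb i w x s + lookup w k * Σα x s)) + κ r k * Σα x s
        ≡⟨ solve 6 (λ x ki kk c w a → (x :+ ki :* (c :+ w :* a)) :+ kk :* a := (x :+ kk :* a) :+ ki :* (c :+ w :* a)) refl _ _ _ _ _ _ ⟩
      (entry x r s + κ r k * Σα x s) + κ r i * (comb i w x s + lookup w k * Σα x s)
        ≡⟨ sym (cong₂ (λ a b → a + κ r i * b) (trans (entry-act k α x r s) (cong (λ a → entry x r s + κ r k * a) (comb-α x s))) (comb-z s)) ⟩
      entry z r s + κ r i * comb i w z s ≡⟨ sym (entry-act i w z r s) ⟩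
      entry (act i w z) r s ∎
      where
      w′ = w ⊹ lookup w k ∙ α
      y = act i w′ x
      z = act k α x
      Σα : Mat _ → Fin _ → Carrier
      Σα x s = Σᶠ λ t → lookup α t * entry x t s
      α-off : ∀ j → lookup α j ≡ 0# → ∀ t → lookup α t * off j t ≡ lookup α t
      α-off j αj t with j Fin.≟ t
      ... | yes refl = trans (cong (_* off j j) αj) (trans (zeroˡ _) (sym αj))
      ... | no j≢t = trans (cong (lookup α t *_) (off-off j≢t)) (*-identityʳ _)
      comb-α′ : ∀ j → lookup α j ≡ 0# → ∀ x s → comb j α x s ≡ Σα x s
      comb-α′ j αj x s = Σᶠ-cong λ t → trans (sym (*-assoc _ _ _)) (cong (_* entry x t s) (α-off j αj t))
      comb-α : ∀ x s → comb k α x s ≡ Σα x s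
      comb-α = comb-α′ k αk
      Σα-y : ∀ s → Σα y s ≡ Σα x s
      Σα-y s = trans (sym (comb-α′ i αi y s)) (trans (comb-act i α w′ x s) (comb-α′ i αi x s))
      comb-w′ : ∀ s → comb i w′ x s ≡ comb i w x s + lookup w k * Σα x s
      comb-w′ s = trans (comb-⊹ i w _ x s) (cong (_+_ (comb i w x s)) (trans
        (Σᶠ-cong (λ t → trans (cong (_* (off i t * entry x t s)) (lookup-∙ (lookup w k) α t)) (*-assoc _ _ _)))
        (trans (Σᶠ-* (lookup w k) (λ t → lookup α t * (off i t * entry x t s))) (cong (lookup w k *_) (comb-α′ i αi x s)))))
      comb-z : ∀ s → comb i w z s ≡ comb i w x s + lookup w k * Σα x s
      comb-z s = begin
        comb i w z s ≡⟨ Σᶠ-cong (λ t → trans (cong (λ a → lookup w t * (off i t * a)) (trans (entry-act k α x t s) (cong (λ a → entry x t s + κ t k * a) (comb-α x s))))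
           (solve 5 (λ w o x k a → w :* (o :* (x :+ k :* a)) := w :* (o :* x) :+ (w :* o :* a) :* k) refl _ _ _ _ _)) ⟩
        Σᶠ (λ t → lookup w t * (off i t * entry x t s) + (lookup w t * off i t * Σα x s) * κ t k)
          ≡⟨ Σᶠ-+ (λ t → lookup w t * (off i t * entry x t s)) (λ t → (lookup w t * off i t * Σα x s) * κ t k) ⟩
        comb i w x s + Σᶠ (λ t → (lookup w t * off i t * Σα x s) * κ t k)
          ≡⟨ cong (_+_ (comb i w x s)) (trans (Σᶠ-κʳ k (λ t → lookup w t * off i t * Σα x s))
               (trans (cong (λ o → lookup w k * o * Σα x s) (off-off i≢k)) (cong (_* Σα x s) (*-identityʳ _)))) ⟩
        comb i w x s + lookup w k * Σα x s ∎

-- Weights and norms on matrices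

module MatrixSums where
  open import Data.Nat.Base using (ℕ)
  open import Data.Integer.Base using (ℤ; +_; 0ℤ; 1ℤ; _≤_; nonNegative) renaming (_*_ to _*ℤ_)
  import Data.Integer.Properties as ℤ
  open import Relation.Nullary.Decidable using (yes; no)
  open import Relation.Binary.PropositionalEquality
  open FiniteSums

  module SumsOver {q : ℕ} (F : FiniteField q) where
    open FiniteField F
    open Matrices F
    instance
      Finite-Carrier : Finite Carrier
      Finite-Carrier = record { size = q ; enum = size }

    Q : ℤ
    Q = + q

    γ : ∀ {n} → Mat n → ℤ
    γ x = [ det x ≟ 1# ]?

    -- Facts that need determinant 1, such as cancellation by `adj`, become usable under a sum
    -- weighted by `γ`.
    γ-cong : ∀ {n} (x : Mat n) {a b : ℤ} → (det x ≡ 1# → a ≡ b) → γ x *ℤ a ≡ γ x *ℤ b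
    γ-cong x {a} {b} eq with det x ≟ 1#
    ... | yes d = cong (1ℤ *ℤ_) (eq d)
    ... | no _ = trans (ℤ.*-zeroˡ a) (sym (ℤ.*-zeroˡ b))

    ‖_‖² : ∀ {n} → (Mat n → ℤ) → ℤ
    ‖ f ‖² = ∑ λ x → f x *ℤ f x

    ‖‖²-nonneg : ∀ {n} (f : Mat n → ℤ) → 0ℤ ≤ ‖ f ‖²
    ‖‖²-nonneg f = ∑-nonneg (λ x → sq-nonneg (f x))

    0≤γ : ∀ {n} (x : Mat n) → 0ℤ ≤ γ x
    0≤γ x = 0≤[]? (det x ≟ 1#)

    sum-sq-nonneg : ∀ {n} (f : Mat n → ℤ) → 0ℤ ≤ ∑ (λ x → γ x *ℤ (f x *ℤ f x))
    sum-sq-nonneg f = ∑-nonneg (λ x → subst (_≤ γ x *ℤ (f x *ℤ f x)) (ℤ.*-zeroʳ (γ x))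
      (ℤ.*-monoˡ-≤-nonNeg (γ x) {{nonNegative (0≤γ x)}} (sq-nonneg (f x))))

-- Random walks by root subgroups and their density

module RootSubgroups where
  open import Data.Nat.Base as ℕ using (ℕ; zero; suc)
  import Data.Nat.Properties as ℕ
  open import Data.Fin.Base as Fin using (Fin; zero; suc)
  import Data.Fin.Properties as Fin
  open import Data.Vec.Base using (Vec; []; _∷_; lookup; replicate)
  import Data.Vec.Properties as Vec
  open import Data.List.Base as List using (List; []; _∷_; length; _++_)
  import Data.List.Properties as List
  open import Data.List.Relation.Unary.All as All using (All; []; _∷_)
  import Data.List.Relation.Unary.All.Properties as All
  open import Data.List.Relation.Unary.AllPairs as AllPairs using (AllPairs; []; _∷_)
  import Data.List.Relation.Unary.AllPairs.Properties as AllPairs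
  open import Data.List.Relation.Unary.Unique.Propositional.Properties using (allFin⁺)
  open import Data.Integer.Base using (ℤ; +_; 0ℤ; 1ℤ; _≤_; _^_) renaming (_+_ to _+ℤ_; _*_ to _*ℤ_)
  import Data.Integer.Base as ℤᵇ
  import Data.Integer.Properties as ℤ
  open import Data.Integer.Tactic.RingSolver using (solve-∀)
  open import Data.Product.Base using (_×_; _,_; proj₁; proj₂)
  open import Function.Base using (_∘_)
  open import Relation.Nullary.Decidable using (Dec; yes; no)
  open import Relation.Binary.PropositionalEquality
  open FiniteSums
  open FieldAlgebra
  open Determinants
  open MatrixProducts
  open RowOperations
  open MatrixSums

  lift : ∀ {n} → Fin n × Fin n → Fin (suc n) × Fin (suc n)
  lift (i , j) = suc i , suc j

  Offdiag : ∀ {n} → Fin n × Fin n → Set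
  Offdiag (i , j) = i ≢ j

  lowerOps : ∀ n → List (Fin (suc n) × Fin (suc n))
  lowerOps n = List.map (λ i → suc i , zero) (List.allFin n)

  rowOps : ∀ n → List (Fin (suc (suc n)) × Fin (suc (suc n)))
  rowOps n = List.map (λ j → zero , suc (suc j)) (List.allFin n)

  sweep : ∀ n → List (Fin (suc (suc n)) × Fin (suc (suc n)))
  sweep n = (zero , suc zero) ∷ (suc zero , zero) ∷ (zero , suc zero) ∷ rowOps n

  -- Word n + 1 first randomises row 0, then acts by word n on the remaining rows modulo row 0, and finally
  -- adds random multiples of row 0 to the other rows.
  word : ∀ n → List (Fin (suc n) × Fin (suc n))
  word zero = []
  word (suc n) = sweep n ++ (List.map lift (word n) ++ lowerOps (suc n))

  word-offdiag : ∀ n → All Offdiag (word n)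
  word-offdiag zero = []
  word-offdiag (suc n) = (λ ()) ∷ (λ ()) ∷ (λ ()) ∷ All.++⁺ (All.map⁺ (All.universal (λ j → λ ()) (List.allFin n)))
    (All.++⁺ (All.map⁺ (All.map (λ i≢j → i≢j ∘ Fin.suc-injective) (word-offdiag n))) (All.map⁺ (All.universal (λ i → λ ()) (List.allFin (suc n)))))

  -- dim m = n² - 1 and word m acts on n × n matrices, where n = m + 1.
  dim : ℕ → ℕ
  dim zero = 0
  dim (suc m) = dim m ℕ.+ (2 ℕ.* suc m ℕ.+ 1)


  module RootWords {q : ℕ} (F : FiniteField q) where
    open FiniteField F
    open FieldSolver F
    open Matrices F
    open Determinant F
    open MatrixAlgebra F
    open RowAction F
    open SumsOver F

    root : ∀ {n} → Fin n → Fin n → (Mat n → ℤ) → Mat n → ℤ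
    root i j f x = ∑ λ a → f (act i (a ∙ e j) x)

    -- Up to the factor `q ^ length W`, the mean of `f` at the end of a random walk that starts at
    -- `x` and uses the letters from left to right.
    rootWord : ∀ {n} → List (Fin n × Fin n) → (Mat n → ℤ) → Mat n → ℤ
    rootWord [] f = f
    rootWord ((i , j) ∷ W) f = root i j (rootWord W f)

    entry-root : ∀ {n} {i j : Fin n} → i ≢ j → ∀ a x r s → entry (act i (a ∙ e j) x) r s ≡ entry x r s + κ r i * (a * entry x j s)
    entry-root {i = i} {j} i≢j a x r s = trans (entry-act i (a ∙ e j) x r s) (cong (λ z → entry x r s + κ r i * z) (begin
      Σᶠ (λ t → lookup (a ∙ e j) t * (off i t * entry x t s))
        ≡⟨ Σᶠ-cong (λ t → trans (cong (_* (off i t * entry x t s)) (lookup-∙ a (e j) t)) (solve 4 (λ a k o x → a :* k :* (o :* x) := k :* (a :* (o :* x))) refl a (κ j t) (off i t) (entry x t s))) ⟩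
      Σᶠ (λ t → κ j t * (a * (off i t * entry x t s))) ≡⟨ Σᶠ-κ j (λ t → a * (off i t * entry x t s)) ⟩
      a * (off i j * entry x j s) ≡⟨ cong (λ o → a * (o * entry x j s)) (off-off i≢j) ⟩
      a * (1# * entry x j s) ≡⟨ cong (a *_) (*-identityˡ _) ⟩
      a * entry x j s ∎))
      where open ≡-Reasoning

    entry-root-≢ : ∀ {n} {i : Fin n} j a x {r} s → r ≢ i → entry (act i (a ∙ e j) x) r s ≡ entry x r s
    entry-root-≢ {i = i} j a x {r} s r≢i = trans (entry-act i (a ∙ e j) x r s) (trans (cong (λ k → entry x r s + k * comb i (a ∙ e j) x s) (κ-off r≢i))
      (solve 2 (λ x c → x :+ con (+ 0) :* c := x) refl _ _))

    entry-root-≡ : ∀ {n} {i j : Fin n} → i ≢ j → ∀ a x s → entry (act i (a ∙ e j) x) i s ≡ entry x i s + a * entry x j s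
    entry-root-≡ {i = i} {j} i≢j a x s = trans (entry-root i≢j a x i s) (trans (cong (λ k → entry x i s + k * (a * entry x j s)) (κ-diag i))
      (cong (_+_ (entry x i s)) (*-identityˡ _)))

    rootWord-++ : ∀ {n} (W V : List (Fin n × Fin n)) f x → rootWord (W ++ V) f x ≡ rootWord W (rootWord V f) x
    rootWord-++ [] V f x = refl
    rootWord-++ ((i , j) ∷ W) V f x = ∑-cong λ a → rootWord-++ W V f _

    rootWord-cong : ∀ {n} (W : List (Fin n × Fin n)) {f g : Mat n → ℤ} → (∀ x → f x ≡ g x) → ∀ x → rootWord W f x ≡ rootWord W g x
    rootWord-cong [] eq = eq
    rootWord-cong ((i , j) ∷ W) eq x = ∑-cong λ a → rootWord-cong W eq _

    rootWord-mono : ∀ {n} (W : List (Fin n × Fin n)) {f g : Mat n → ℤ} → (∀ x → det x ≡ 1# → f x ≤ g x) →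
      ∀ x → det x ≡ 1# → rootWord W f x ≤ rootWord W g x
    rootWord-mono [] le = le
    rootWord-mono ((i , j) ∷ W) le x d = ∑-mono λ a → rootWord-mono W le _ (trans (det-act i (a ∙ e j) x) d)

    rootWord-mono′ : ∀ {n} (W : List (Fin n × Fin n)) {f g : Mat n → ℤ} → (∀ x → f x ≤ g x) → ∀ x → rootWord W f x ≤ rootWord W g x
    rootWord-mono′ [] le = le
    rootWord-mono′ ((i , j) ∷ W) le x = ∑-mono λ a → rootWord-mono′ W le _

    rootWord-* : ∀ {n} (W : List (Fin n × Fin n)) c f (x : Mat n) → rootWord W (λ x → c *ℤ f x) x ≡ c *ℤ rootWord W f x
    rootWord-* [] c f x = refl
    rootWord-* ((i , j) ∷ W) c f x = trans (∑-cong (λ a → rootWord-* W c f _)) (∑-* c _)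

    Fixes : ∀ {n} → (Mat n → Set) → (Mat n → ℤ) → Fin n × Fin n → Set
    Fixes P h (i , j) = ∀ a x → P x → h (act i (a ∙ e j) x) ≡ h x

    Preserves : ∀ {n} → (Mat n → Set) → Fin n × Fin n → Set
    Preserves P (i , j) = ∀ a x → P x → P (act i (a ∙ e j) x)

    -- `h` does not change along the walk, so it factors out. The predicate `P` is carried along
    -- because letters may fix `h` only where `P` holds.
    rootWord-fix : ∀ {n} (P : Mat n → Set) (h f : Mat n → ℤ) (W : List (Fin n × Fin n)) → All (Preserves P) W → All (Fixes P h) W →
      ∀ x → P x → rootWord W (λ x → h x *ℤ f x) x ≡ h x *ℤ rootWord W f x
    rootWord-fix P h f [] _ _ x px = refl
    rootWord-fix P h f ((i , j) ∷ W) (pr ∷ prs) (fx ∷ fxs) x px = trans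
      (∑-cong (λ a → trans (rootWord-fix P h f W prs fxs _ (pr a x px)) (cong (_*ℤ rootWord W f (act i (a ∙ e j) x)) (fx a x px))))
      (∑-* (h x) _)

    rootWord-translate : ∀ {n} (W : List (Fin n × Fin n)) f (x y : Mat n) → rootWord W f (x *M y) ≡ rootWord W (λ x → f (x *M y)) x
    rootWord-translate [] f x y = refl
    rootWord-translate ((i , j) ∷ W) f x y = ∑-cong λ a → trans (cong (rootWord W f) (sym (act-* i (a ∙ e j) x y))) (rootWord-translate W f _ y)

    ∑-δ-shift : ∀ (b t : Carrier) → ∑ (λ a → δ (b + a) t) ≡ 1ℤ
    ∑-δ-shift b t = trans (∑-cong (λ a → δ-cong
        (λ eq → trans (solve 2 (λ a b → a := (b :+ a) :+ :- b) refl a b) (cong (_+ - b) eq))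
        (λ eq → trans (cong (_+_ b) eq) (solve 2 (λ t b → b :+ (t :+ :- b) := t) refl t b)))) (∑-δ (t + - b))

    -- If every parameter of the word can be read off from its own entry of the final matrix, each matrix is reached at most once.
    pinned : ∀ {n} (P : Mat n → Set) (g h : Mat n → ℤ) (z : Mat n) (W : List (Fin n × Fin n)) → All (Preserves P) W →
      All (λ (i , j) → ∀ x → P x → i ≢ j × entry x j j ≡ 1#) W →
      AllPairs (λ (i , j) → Fixes P (λ x → δ (entry x i j) (entry z i j))) W →
      All (λ (i , j) → ∀ x → g x ≡ δ (entry x i j) (entry z i j) *ℤ g x) W →
      All (Fixes P h) W → (∀ x → 0ℤ ≤ h x) → (∀ x → g x ≤ h x) → ∀ x → P x → rootWord W g x ≤ h x
    pinned P g h z [] _ _ _ _ _ 0≤h le x px = le x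
    pinned P g h z ((i , j) ∷ W) (pr ∷ prs) (un ∷ uns) (pin ∷ pins) (gd ∷ gds) (hf ∷ hfs) 0≤h le x px = begin
      ∑ (λ a → rootWord W g (x′ a)) ≡⟨ ∑-cong (λ a → trans (rootWord-cong W gd _) (rootWord-fix P _ g W prs pin _ (pr a x px))) ⟩
      ∑ (λ a → δ (entry (x′ a) i j) (entry z i j) *ℤ rootWord W g (x′ a))
        ≤⟨ ∑-mono (λ a → *-monoˡ (0≤[]? (entry (x′ a) i j ≟F entry z i j)) (pinned P g h z W prs uns pins gds hfs 0≤h le (x′ a) (pr a x px))) ⟩
      ∑ (λ a → δ (entry (x′ a) i j) (entry z i j) *ℤ h (x′ a))
        ≡⟨ ∑-cong (λ a → cong₂ (λ s t → δ s (entry z i j) *ℤ t) (trans (entry-root-≡ (proj₁ (un x px)) a x j)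
             (cong (_+_ (entry x i j)) (trans (cong (a *_) (proj₂ (un x px))) (*-identityʳ a)))) (hf a x px)) ⟩
      ∑ (λ a → δ (entry x i j + a) (entry z i j) *ℤ h x) ≡⟨ trans (∑-*ʳ _ (h x)) (trans (cong (_*ℤ h x) (∑-δ-shift _ _)) (ℤ.*-identityˡ _)) ⟩
      h x ∎
      where
      open ℤ.≤-Reasoning
      x′ : Carrier → Mat _
      x′ a = act i (a ∙ e j) x

    minor : ∀ {n} → Mat (suc n) → Mat n
    minor x = mk λ r s → entry x (suc r) (suc s)

    blockEntry : ∀ {n} → Mat n → Fin (suc n) → Fin (suc n) → Carrier
    blockEntry M zero s = κ zero s
    blockEntry M (suc r) zero = 0#
    blockEntry M (suc r) (suc s) = entry M r s

    -- The block matrix with corner 1 and lower block `M`, on which a lifted word acts as the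
    -- shorter word acts on `M`.
    block : ∀ {n} → Mat n → Mat (suc n)
    block M = mk (blockEntry M)

    entry-block : ∀ {n} (M : Mat n) r s → entry (block M) r s ≡ blockEntry M r s
    entry-block M = entry-mk (blockEntry M)

    entry-minor : ∀ {n} (x : Mat (suc n)) r s → entry (minor x) r s ≡ entry x (suc r) (suc s)
    entry-minor x = entry-mk (λ r s → entry x (suc r) (suc s))

    minor-block : ∀ {n} (M : Mat n) → minor (block M) ≡ M
    minor-block M = mat-ext λ r s → trans (entry-minor (block M) r s) (entry-block M (suc r) (suc s))

    block-Id : ∀ n → block (Id n) ≡ Id (suc n)
    block-Id n = mat-ext λ r s → trans (entry-block (Id n) r s) (trans (cases r s) (sym (entry-Id r s)))
      where
      cases : ∀ r s → blockEntry (Id n) r s ≡ κ r s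
      cases zero s = refl
      cases (suc r) zero = refl
      cases (suc r) (suc s) = entry-Id r s

    act-block : ∀ {n} {i j : Fin n} → i ≢ j → ∀ a M → act (suc i) (a ∙ e (suc j)) (block M) ≡ block (act i (a ∙ e j) M)
    act-block {n} {i} {j} i≢j a M = mat-ext λ r s → trans (entry-root (i≢j ∘ Fin.suc-injective) a (block M) r s)
      (trans (cong₂ (λ b c → b + κ r (suc i) * (a * c)) (entry-block M r s) (entry-block M (suc j) s)) (trans (cases r s) (sym (entry-block (act i (a ∙ e j) M) r s))))
      where
      cases : ∀ r s → blockEntry M r s + κ r (suc i) * (a * blockEntry M (suc j) s) ≡ blockEntry (act i (a ∙ e j) M) r s
      cases zero s = trans (cong (λ k → κ zero s + k * (a * blockEntry M (suc j) s)) (κ-off {i = zero} {suc i} (λ ())))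
        (solve 2 (λ k c → k :+ con (+ 0) :* c := k) refl (κ zero s) (a * blockEntry M (suc j) s))
      cases (suc r) zero = solve 2 (λ k a → con (+ 0) :+ k :* (a :* con (+ 0)) := con (+ 0)) refl (κ r i) a
      cases (suc r) (suc s) = sym (entry-root i≢j a M r s)

    rootWord-block : ∀ {n} (W : List (Fin n × Fin n)) → All Offdiag W → ∀ f M → rootWord (List.map lift W) f (block M) ≡ rootWord W (f ∘ block) M
    rootWord-block [] _ f M = refl
    rootWord-block ((i , j) ∷ W) (o ∷ os) f M = ∑-cong λ a → trans (cong (rootWord (List.map lift W) f) (act-block o a M)) (rootWord-block W os f _)

    0≤δ : ∀ {A : Set} {{_ : Finite A}} (x y : A) → 0ℤ ≤ δ x y
    0≤δ x y = 0≤[]? (x ≟F y)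

    δ-≤ : ∀ {A B : Set} {{_ : Finite A}} {{_ : Finite B}} {x y : A} {u v : B} → (x ≡ y → u ≡ v) → δ x y ≤ δ u v
    δ-≤ {x = x} {y} {u} {v} f with x ≟F y
    ... | yes eq = ℤ.≤-reflexive (sym ([]?-yes (u ≟F v) (f eq)))
    ... | no _ = 0≤δ u v

    -- Makes a necessary condition an explicit factor, which `rootWord-fix` can pull out of the sum.
    δ-factor : ∀ {A B : Set} {{_ : Finite A}} {{_ : Finite B}} {x y : A} {u v : B} → (x ≡ y → u ≡ v) → δ x y ≡ δ u v *ℤ δ x y
    δ-factor {x = x} {y} {u} {v} f with x ≟F y
    ... | yes eq = sym (cong (_*ℤ 1ℤ) ([]?-yes (u ≟F v) (f eq)))
    ... | no _ = sym (ℤ.*-zeroʳ (δ u v))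

    -- Row 0 of `block M` is the first basis row, so each letter shifts one entry of column 0 by its
    -- parameter. Column 0 of `z` thus determines all parameters, while the minor never changes.
    rootWord-lower : ∀ {n} (M : Mat n) z → rootWord (lowerOps n) (λ x → δ x z) (block M) ≤ δ M (minor z)
    rootWord-lower {n} M z = subst (λ y → rootWord (lowerOps n) (λ x → δ x z) (block M) ≤ δ y (minor z)) (minor-block M)
      (pinned P (λ x → δ x z) (λ x → δ (minor x) (minor z)) z (lowerOps n)
        (All.map⁺ (All.universal (λ i a x px s → trans (entry-root-≢ {i = suc i} zero a x {zero} s (λ ())) (px s)) _))
        (All.map⁺ (All.universal (λ i x px → (λ ()) , px zero) _))
        (AllPairs.map⁺ (AllPairs.map (λ {i} {i′} i≢i′ a x px → cong (λ t → δ t (entry z (suc i) zero))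
          (entry-root-≢ {i = suc i′} zero a x {suc i} zero (i≢i′ ∘ Fin.suc-injective))) (allFin⁺ n)))
        (All.map⁺ (All.universal (λ i x → δ-factor {x = x} {z} (cong (λ y → entry y (suc i) zero))) _))
        (All.map⁺ (All.universal (λ i a x px → cong (λ y → δ y (minor z)) (mat-ext λ r s →
          trans (entry-minor (act (suc i) (a ∙ e zero) x) r s) (trans (entry-root {i = suc i} (λ ()) a x (suc r) (suc s))
            (trans (cong (λ t → entry x (suc r) (suc s) + κ (suc r) (suc i) * (a * t)) (trans (px (suc s)) (Vec.lookup-replicate s 0#)))
            (trans (solve 3 (λ x k a → x :+ k :* (a :* con (+ 0)) := x) refl (entry x (suc r) (suc s)) (κ (suc r) (suc i)) a) (sym (entry-minor x r s))))))) _))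
        (λ x → 0≤δ (minor x) (minor z)) (λ x → δ-≤ (cong minor)) (block M) (λ s → entry-block M zero s))
      where
      P : Mat (suc n) → Set
      P x = ∀ s → entry x zero s ≡ κ zero s

    -- The rows from 2 on are basis rows, so each letter shifts its own entry of row 0 and leaves
    -- the first two entries alone.
    rootWord-row : ∀ {n} (x : Mat (suc (suc n))) → (∀ j s → entry x (suc (suc j)) s ≡ κ (suc (suc j)) s) → ∀ t →
      rootWord (rowOps n) (λ y → δ (lookup y zero) t) x ≤ δ (entry x zero zero) (lookup t zero) *ℤ δ (entry x zero (suc zero)) (lookup t (suc zero))
    rootWord-row {n} x px t = pinned P g h (t ∷ replicate _ 𝟘) (rowOps n)
        (All.map⁺ (All.universal (λ j a x px k s → trans (entry-root-≢ {i = zero} (suc (suc j)) a x {suc (suc k)} s (λ ())) (px k s)) _))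
        (All.map⁺ (All.universal (λ j x px → (λ ()) , trans (px j (suc (suc j))) (κ-diag j)) _))
        (AllPairs.map⁺ (AllPairs.map (λ {j} {j′} j≢j′ a x px → cong (λ s → δ s (lookup t (suc (suc j))))
          (untouched j′ (suc (suc j)) a x px (λ eq → j≢j′ (sym (Fin.suc-injective (Fin.suc-injective eq)))))) (allFin⁺ n)))
        (All.map⁺ (All.universal (λ j x → δ-factor {x = lookup x zero} {t} (cong (λ r → lookup r (suc (suc j))))) _))
        (All.map⁺ (All.universal (λ j a x px → cong₂ (λ u v → δ u (lookup t zero) *ℤ δ v (lookup t (suc zero)))
          (untouched j zero a x px (λ ())) (untouched j (suc zero) a x px (λ ()))) _))
        (λ x → *-nonneg (0≤δ _ _) (0≤δ _ _)) le x px
      where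
      P : Mat (suc (suc n)) → Set
      P x = ∀ j s → entry x (suc (suc j)) s ≡ κ (suc (suc j)) s
      g h : Mat (suc (suc n)) → ℤ
      g y = δ (lookup y zero) t
      h y = δ (entry y zero zero) (lookup t zero) *ℤ δ (entry y zero (suc zero)) (lookup t (suc zero))
      untouched : ∀ j s a x → P x → suc (suc j) ≢ s → entry (act zero (a ∙ e (suc (suc j))) x) zero s ≡ entry x zero s
      untouched j s a x px j≢s = trans (entry-root-≡ {i = zero} {suc (suc j)} (λ ()) a x s)
        (trans (cong (λ t → entry x zero s + a * t) (trans (px j s) (κ-off j≢s))) (solve 2 (λ x a → x :+ a :* con (+ 0) := x) refl (entry x zero s) a))
      le : ∀ y → g y ≤ h y
      le y = ℤ.≤-trans (ℤ.≤-reflexive (δ-factor {x = lookup y zero} {t} (cong (λ r → lookup r zero))))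
        (*-monoˡ (0≤δ (entry y zero zero) (lookup t zero)) (δ-≤ {x = lookup y zero} {t} (cong (λ r → lookup r (suc zero)))))

    ∑-δ-line : ∀ (b k t : Carrier) → k ≢ 0# → ∑ (λ a → δ (b + a * k) t) ≡ 1ℤ
    ∑-δ-line b k t k≢0 = trans (∑-cong (λ a → δ-cong
        (λ eq → begin
          a ≡⟨ solve 1 (λ a → a := a :* con (+ 1)) refl a ⟩
          a * 1# ≡⟨ cong (a *_) (sym (proj₂ (inverse k k≢0))) ⟩
          a * (k * k⁻¹) ≡⟨ solve 4 (λ a k i b → a :* (k :* i) := ((b :+ a :* k) :+ :- b) :* i) refl a k k⁻¹ b ⟩
          ((b + a * k) + - b) * k⁻¹ ≡⟨ cong (λ z → (z + - b) * k⁻¹) eq ⟩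
          (t + - b) * k⁻¹ ∎)
        (λ eq → begin
          b + a * k ≡⟨ cong (λ z → b + z * k) eq ⟩
          b + (t + - b) * k⁻¹ * k ≡⟨ solve 4 (λ b t k i → b :+ (t :+ :- b) :* i :* k := b :+ (t :+ :- b) :* (k :* i)) refl b t k k⁻¹ ⟩
          b + (t + - b) * (k * k⁻¹) ≡⟨ cong (λ z → b + (t + - b) * z) (proj₂ (inverse k k≢0)) ⟩
          b + (t + - b) * 1# ≡⟨ solve 2 (λ b t → b :+ (t :+ :- b) :* con (+ 1) := t) refl b t ⟩
          t ∎))) (∑-δ ((t + - b) * k⁻¹))
      where
      open ≡-Reasoning
      k⁻¹ = proj₁ (inverse k k≢0)

    -- For `k` zero the line degenerates to a point; the second summand pays for that case with all
    -- `q` parameters.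
    count-line : ∀ t₀ k → ∑ (λ b → δ (1# + b * k) t₀) ≤ 1ℤ +ℤ δ k 0# *ℤ Q
    count-line t₀ k with k ≟F 0#
    ... | no k≢0 = ℤ.≤-reflexive (trans (∑-δ-line 1# k t₀ k≢0) (sym (cong (1ℤ +ℤ_) (ℤ.*-zeroˡ Q))))
    ... | yes _ = begin
      ∑ (λ b → δ (1# + b * k) t₀) ≤⟨ ∑-mono (λ b → []?≤1 ((1# + b * k) ≟F t₀)) ⟩
      ∑ {Carrier} (λ _ → 1ℤ) ≡⟨ trans (∑-const Carrier 1ℤ) (ℤ.*-comm Q 1ℤ) ⟩
      1ℤ *ℤ Q ≤⟨ ℤ.i≤j+i (1ℤ *ℤ Q) 1ℤ ⟩
      1ℤ +ℤ 1ℤ *ℤ Q ∎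
      where open ℤ.≤-Reasoning

    -- Since `c + a * (1# + b * c)` equals `a + c * (1# + b * a)`, the second condition reads
    -- `a + c * t₀ ≡ t₁`. For `t₀` nonzero it determines `c`, and at most `2 q` pairs satisfy the
    -- first condition, the excess coming from `a` zero. For `t₀` zero, `a` is `t₁`, at most one `b`
    -- remains, and `c` is free.
    count-sweep : ∀ t₀ t₁ → ∑ (λ c → ∑ (λ b → ∑ (λ a → δ (1# + b * a) t₀ *ℤ δ (c + a * (1# + b * c)) t₁))) ≤ + 2 *ℤ Q
    count-sweep t₀ t₁ = begin
      ∑ (λ c → ∑ (λ b → ∑ (λ a → δ (1# + b * a) t₀ *ℤ δ (c + a * (1# + b * c)) t₁)))
        ≡⟨ ∑-cong (λ c → ∑-cong (λ b → ∑-cong (λ a → rewrite-t₀ c b a))) ⟩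
      ∑ (λ c → ∑ (λ b → ∑ (λ a → δ (1# + b * a) t₀ *ℤ δ (a + c * t₀) t₁))) ≤⟨ cases (t₀ ≟F 0#) ⟩
      + 2 *ℤ Q ∎
      where
      open ℤ.≤-Reasoning
      rewrite-t₀ : ∀ c b a → δ (1# + b * a) t₀ *ℤ δ (c + a * (1# + b * c)) t₁ ≡ δ (1# + b * a) t₀ *ℤ δ (a + c * t₀) t₁
      rewrite-t₀ c b a = trans (cong (λ z → δ (1# + b * a) t₀ *ℤ δ z t₁)
        (solve 3 (λ c b a → c :+ a :* (con (+ 1) :+ b :* c) := a :+ c :* (con (+ 1) :+ b :* a)) refl c b a))
        (δ-subst (λ z → δ (a + c * z) t₁) (1# + b * a) t₀)
      cases : Dec (t₀ ≡ 0#) → ∑ (λ c → ∑ (λ b → ∑ (λ a → δ (1# + b * a) t₀ *ℤ δ (a + c * t₀) t₁))) ≤ + 2 *ℤ Q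
      cases (yes refl) = begin
        ∑ (λ c → ∑ (λ b → ∑ (λ a → δ (1# + b * a) 0# *ℤ δ (a + c * 0#) t₁)))
          ≡⟨ ∑-cong (λ c → ∑-cong (λ b → trans (∑-cong (λ a → trans (ℤ.*-comm (δ (1# + b * a) 0#) (δ (a + c * 0#) t₁)) (cong (λ z → δ z t₁ *ℤ δ (1# + b * a) 0#)
               (solve 2 (λ a c → a :+ c :* con (+ 0) := a) refl a c)))) (∑-δ* t₁ (λ a → δ (1# + b * a) 0#)))) ⟩
        ∑ {Carrier} (λ c → ∑ (λ b → δ (1# + b * t₁) 0#)) ≤⟨ ∑-mono {Carrier} (λ c → count-0 (t₁ ≟F 0#)) ⟩
        ∑ {Carrier} (λ c → 1ℤ) ≡⟨ trans (∑-const Carrier 1ℤ) (ℤ.*-comm Q 1ℤ) ⟩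
        1ℤ *ℤ Q ≤⟨ *-monoʳ {1ℤ} {+ 2} (ℤᵇ.+≤+ ℕ.z≤n) (ℤᵇ.+≤+ (ℕ.s≤s ℕ.z≤n)) ⟩
        + 2 *ℤ Q ∎
        where
        count-0 : Dec (t₁ ≡ 0#) → ∑ (λ b → δ (1# + b * t₁) 0#) ≤ 1ℤ
        count-0 (no t₁≢0) = ℤ.≤-reflexive (∑-δ-line 1# t₁ 0# t₁≢0)
        count-0 (yes refl) = ℤ.≤-trans (ℤ.≤-reflexive (∑-0 (λ b → []?-no (1# + b * 0# ≟F 0#) (λ eq →
          0≢1 (trans (sym eq) (solve 1 (λ b → con (+ 1) :+ b :* con (+ 0) := con (+ 1)) refl b)))))) (ℤᵇ.+≤+ ℕ.z≤n)
      cases (no t₀≢0) = begin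
        ∑ (λ c → ∑ (λ b → ∑ (λ a → δ (1# + b * a) t₀ *ℤ δ (a + c * t₀) t₁)))
          ≡⟨ trans (∑-swap _) (∑-cong (λ b → ∑-swap _)) ⟩
        ∑ (λ b → ∑ (λ a → ∑ (λ c → δ (1# + b * a) t₀ *ℤ δ (a + c * t₀) t₁)))
          ≡⟨ ∑-cong (λ b → ∑-cong (λ a → trans (∑-* (δ (1# + b * a) t₀) (λ c → δ (a + c * t₀) t₁)) (trans (cong (δ (1# + b * a) t₀ *ℤ_) (∑-δ-line a t₀ t₁ t₀≢0)) (ℤ.*-identityʳ _)))) ⟩
        ∑ (λ b → ∑ (λ a → δ (1# + b * a) t₀)) ≡⟨ ∑-swap _ ⟩
        ∑ (λ a → ∑ (λ b → δ (1# + b * a) t₀)) ≤⟨ ∑-mono (count-line t₀) ⟩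
        ∑ (λ a → 1ℤ +ℤ δ a 0# *ℤ Q) ≡⟨ trans (∑-+ _ _) (cong₂ _+ℤ_ (trans (∑-const Carrier 1ℤ) (ℤ.*-identityʳ Q)) (trans (∑-*ʳ _ Q) (cong (_*ℤ Q) (∑-δ 0#)))) ⟩
        Q +ℤ 1ℤ *ℤ Q ≡⟨ double Q ⟩
        + 2 *ℤ Q ∎
        where
        double : ∀ x → x +ℤ 1ℤ *ℤ x ≡ + 2 *ℤ x
        double = solve-∀

    -- Three parameters serve two entries. With only `b` and `a`, the choice of `a` zero would send
    -- all `q` values of `b` to the same row; the parameter `c` spreads that mass.
    rootWord-sweep : ∀ n t → rootWord (sweep n) (λ y → δ (lookup y zero) t) (Id (suc (suc n))) ≤ + 2 *ℤ Q
    rootWord-sweep n t = begin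
      ∑ (λ c → ∑ (λ b → ∑ (λ a → rootWord (rowOps n) (λ y → δ (lookup y zero) t) (x₃ c b a))))
        ≤⟨ ∑-mono (λ c → ∑-mono (λ b → ∑-mono (λ a → rootWord-row (x₃ c b a) (rows c b a) t))) ⟩
      ∑ (λ c → ∑ (λ b → ∑ (λ a → δ (entry (x₃ c b a) zero zero) t₀ *ℤ δ (entry (x₃ c b a) zero (suc zero)) t₁)))
        ≡⟨ ∑-cong (λ c → ∑-cong (λ b → ∑-cong (λ a → cong₂ (λ u v → δ u t₀ *ℤ δ v t₁) (entry₀ c b a) (entry₁ c b a)))) ⟩
      ∑ (λ c → ∑ (λ b → ∑ (λ a → δ (1# + b * a) t₀ *ℤ δ (c + a * (1# + b * c)) t₁))) ≤⟨ count-sweep t₀ t₁ ⟩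
      + 2 *ℤ Q ∎
      where
      open ℤ.≤-Reasoning
      t₀ = lookup t zero
      t₁ = lookup t (suc zero)
      x₁ : Carrier → Mat (suc (suc n))
      x₁ c = act zero (c ∙ e (suc zero)) (Id (suc (suc n)))
      x₂ : Carrier → Carrier → Mat (suc (suc n))
      x₂ c b = act (suc zero) (b ∙ e zero) (x₁ c)
      x₃ : Carrier → Carrier → Carrier → Mat (suc (suc n))
      x₃ c b a = act zero (a ∙ e (suc zero)) (x₂ c b)
      rows : ∀ c b a j s → entry (x₃ c b a) (suc (suc j)) s ≡ κ (suc (suc j)) s
      rows c b a j s = trans (entry-root-≢ {i = zero} (suc zero) a (x₂ c b) {suc (suc j)} s (λ ()))
        (trans (entry-root-≢ {i = suc zero} zero b (x₁ c) {suc (suc j)} s (λ ()))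
        (trans (entry-root-≢ {i = zero} (suc zero) c (Id (suc (suc n))) {suc (suc j)} s (λ ())) (entry-Id (suc (suc j)) s)))
      row₀ : ∀ c s → entry (x₁ c) zero s ≡ κ zero s + c * κ (suc zero) s
      row₀ c s = trans (entry-root-≡ {i = zero} {suc zero} (λ ()) c (Id (suc (suc n))) s) (cong₂ (λ u v → u + c * v) (entry-Id zero s) (entry-Id (suc zero) s))
      row₁ : ∀ c b s → entry (x₂ c b) (suc zero) s ≡ κ (suc zero) s + b * (κ zero s + c * κ (suc zero) s)
      row₁ c b s = trans (entry-root-≡ {i = suc zero} {zero} (λ ()) b (x₁ c) s) (cong₂ (λ u v → u + b * v)
        (trans (entry-root-≢ {i = zero} (suc zero) c (Id (suc (suc n))) {suc zero} s (λ ())) (entry-Id (suc zero) s)) (row₀ c s))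
      row₃ : ∀ c b a s → entry (x₃ c b a) zero s ≡ (κ zero s + c * κ (suc zero) s) + a * (κ (suc zero) s + b * (κ zero s + c * κ (suc zero) s))
      row₃ c b a s = trans (entry-root-≡ {i = zero} {suc zero} (λ ()) a (x₂ c b) s) (cong₂ (λ u v → u + a * v)
        (trans (entry-root-≢ {i = suc zero} zero b (x₁ c) {zero} s (λ ())) (row₀ c s)) (row₁ c b s))
      entry₀ : ∀ c b a → entry (x₃ c b a) zero zero ≡ 1# + b * a
      entry₀ c b a = trans (row₃ c b a zero)
        (solve 3 (λ c b a → (con (+ 1) :+ c :* con (+ 0)) :+ a :* (con (+ 0) :+ b :* (con (+ 1) :+ c :* con (+ 0))) := con (+ 1) :+ b :* a) refl c b a)
      entry₁ : ∀ c b a → entry (x₃ c b a) zero (suc zero) ≡ c + a * (1# + b * c)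
      entry₁ c b a = trans (row₃ c b a (suc zero))
        (solve 3 (λ c b a → (con (+ 0) :+ c :* con (+ 1)) :+ a :* (con (+ 1) :+ b :* (con (+ 0) :+ c :* con (+ 1))) := c :+ a :* (con (+ 1) :+ b :* c)) refl c b a)

    -- Letters after the sweep leave row 0 alone, so the sweep must already produce row 0 of `z`, at
    -- the cost of a factor 2 per size. Right translation by `adj y` then restarts the walk at the
    -- identity, where the lifted word acts in the block by induction and the last letters fill
    -- column 0.
    density : ∀ m z → Q ^ dim m *ℤ rootWord (word m) (λ x → δ x z) (Id (suc m)) ≤ (+ 2) ^ m *ℤ Q ^ length (word m)
    density zero z = ℤ.≤-trans (ℤ.≤-reflexive (ℤ.*-identityˡ _)) ([]?≤1 (Id 1 ≟F z))
    density (suc m) z = begin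
      Q ^ dim (suc m) *ℤ rootWord (word (suc m)) f (Id n′)
        ≡⟨ cong₂ _*ℤ_ power-split word-split ⟩
      Q ^ k *ℤ Q ^ dim m *ℤ rootWord (sweep m) (rootWord V f) (Id n′) ≡⟨ trans (ℤ.*-assoc (Q ^ k) (Q ^ dim m) _) (cong (Q ^ k *ℤ_) (sym (rootWord-* (sweep m) (Q ^ dim m) _ (Id n′)))) ⟩
      Q ^ k *ℤ rootWord (sweep m) (λ y → Q ^ dim m *ℤ rootWord V f y) (Id n′)
        ≤⟨ *-monoˡ (Q^-nonneg k) (rootWord-mono (sweep m) bound (Id n′) (det-Id n′)) ⟩
      Q ^ k *ℤ rootWord (sweep m) (λ y → M *ℤ δ (lookup y zero) (lookup z zero)) (Id n′)
        ≡⟨ cong (Q ^ k *ℤ_) (rootWord-* (sweep m) M _ (Id n′)) ⟩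
      Q ^ k *ℤ (M *ℤ rootWord (sweep m) (λ y → δ (lookup y zero) (lookup z zero)) (Id n′))
        ≤⟨ *-monoˡ (Q^-nonneg k) (*-monoˡ 0≤M (rootWord-sweep m (lookup z zero))) ⟩
      Q ^ k *ℤ (M *ℤ (+ 2 *ℤ Q)) ≡⟨ arrange (Q ^ k) ((+ 2) ^ m) (Q ^ length (word m)) Q ⟩
      + 2 *ℤ (+ 2) ^ m *ℤ (Q *ℤ (Q ^ length (word m) *ℤ Q ^ k)) ≡⟨ cong₂ _*ℤ_ power-of-2 power-length ⟩
      (+ 2) ^ suc m *ℤ Q ^ length (word (suc m)) ∎
      where
      open ℤ.≤-Reasoning
      n′ = suc (suc m)
      k = 2 ℕ.* suc m ℕ.+ 1
      f : Mat n′ → ℤ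
      f x = δ x z
      V = List.map lift (word m) ++ lowerOps (suc m)
      M = (+ 2) ^ m *ℤ Q ^ length (word m)
      Q^-nonneg : ∀ k → 0ℤ ≤ Q ^ k
      Q^-nonneg zero = ℤᵇ.+≤+ ℕ.z≤n
      Q^-nonneg (suc k) = *-nonneg {Q} {Q ^ k} (ℤᵇ.+≤+ ℕ.z≤n) (Q^-nonneg k)
      2^-nonneg : ∀ k → 0ℤ ≤ (+ 2) ^ k
      2^-nonneg zero = ℤᵇ.+≤+ ℕ.z≤n
      2^-nonneg (suc k) = *-nonneg {+ 2} {(+ 2) ^ k} (ℤᵇ.+≤+ ℕ.z≤n) (2^-nonneg k)
      0≤M : 0ℤ ≤ M
      0≤M = *-nonneg (2^-nonneg m) (Q^-nonneg (length (word m)))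
      arrange : ∀ k t l q → k *ℤ (t *ℤ l *ℤ (+ 2 *ℤ q)) ≡ + 2 *ℤ t *ℤ (q *ℤ (l *ℤ k))
      arrange = solve-∀
      lengths : length (word (suc m)) ≡ suc (length (word m) ℕ.+ k)
      lengths = trans (List.length-++ (sweep m)) (trans (cong₂ (λ s t → suc (suc (suc s)) ℕ.+ t)
          (trans (List.length-map _ (List.allFin m)) (List.length-tabulate {n = m} (λ i → i)))
          (trans (List.length-++ (List.map lift (word m))) (cong₂ ℕ._+_ (List.length-map lift (word m))
            (trans (List.length-map _ (List.allFin (suc m))) (List.length-tabulate {n = suc m} (λ i → i))))))
        (count m (length (word m))))
        where
        import Data.Nat.Tactic.RingSolver as ℕ-Ring
        -- The sweep has `m + 3` letters and the last group `m + 1`, in total one more than the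
        -- growth of `dim`; the spare factor `Q` is the one in `rootWord-sweep`.
        count : ∀ m l → suc (suc (suc m)) ℕ.+ (l ℕ.+ suc m) ≡ suc (l ℕ.+ (2 ℕ.* suc m ℕ.+ 1))
        count = ℕ-Ring.solve-∀
      power-split : Q ^ dim (suc m) ≡ Q ^ k *ℤ Q ^ dim m
      power-split = trans (ℤ.^-distribˡ-+-* Q (dim m) k) (ℤ.*-comm (Q ^ dim m) (Q ^ k))
      word-split : rootWord (word (suc m)) f (Id n′) ≡ rootWord (sweep m) (rootWord V f) (Id n′)
      word-split = rootWord-++ (sweep m) V f (Id n′)
      power-of-2 : + 2 *ℤ (+ 2) ^ m ≡ (+ 2) ^ suc m
      power-of-2 = refl
      power-length : Q *ℤ (Q ^ length (word m) *ℤ Q ^ k) ≡ Q ^ length (word (suc m))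
      power-length = trans (cong (Q *ℤ_) (sym (ℤ.^-distribˡ-+-* Q (length (word m)) k))) (cong (Q ^_) (sym lengths))
      fixes-row : All (Fixes (λ _ → det (Id n′) ≡ det (Id n′)) (λ x → δ (lookup x zero) (lookup z zero))) V
      fixes-row = All.++⁺ (All.map⁺ (All.universal (λ (i , j) a x _ → fix i (suc j) a x) (word m))) (All.map⁺ (All.universal (λ i a x _ → fix i zero a x) _))
        where
        fix : ∀ i j a x → δ (lookup (act (suc i) (a ∙ e j) x) zero) (lookup z zero) ≡ δ (lookup x zero) (lookup z zero)
        fix i j a x = cong (λ r → δ r (lookup z zero)) (lookup-ext (λ s → entry-root-≢ {i = suc i} j a x {zero} s (λ ())))
      bound : ∀ y → det y ≡ 1# → Q ^ dim m *ℤ rootWord V f y ≤ M *ℤ δ (lookup y zero) (lookup z zero)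
      bound y dy = begin
        Q ^ dim m *ℤ rootWord V f y
          ≡⟨ cong (Q ^ dim m *ℤ_) (trans (rootWord-cong V (λ x → δ-factor {x = x} {z} (cong (λ x → lookup x zero))) y)
               (rootWord-fix _ (λ x → δ (lookup x zero) (lookup z zero)) f V (All.universal (λ _ _ _ _ → refl) V) fixes-row y refl)) ⟩
        Q ^ dim m *ℤ (δ (lookup y zero) (lookup z zero) *ℤ rootWord V f y) ≡⟨ shuffle (Q ^ dim m) (δ (lookup y zero) (lookup z zero)) (rootWord V f y) ⟩
        δ (lookup y zero) (lookup z zero) *ℤ (Q ^ dim m *ℤ rootWord V f y)
          ≤⟨ *-monoˡ (0≤δ (lookup y zero) (lookup z zero)) (ℤ.≤-trans (*-monoˡ (Q^-nonneg (dim m)) V-bound) (density m (minor (z *M adj y)))) ⟩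
        δ (lookup y zero) (lookup z zero) *ℤ M ≡⟨ ℤ.*-comm _ M ⟩
        M *ℤ δ (lookup y zero) (lookup z zero) ∎
        where
        shuffle : ∀ a b c → a *ℤ (b *ℤ c) ≡ b *ℤ (a *ℤ c)
        shuffle = solve-∀
        z′ = z *M adj y
        V-bound : rootWord V f y ≤ rootWord (word m) (λ x → δ x (minor z′)) (Id (suc m))
        V-bound = begin
          rootWord V f y ≡⟨ cong (rootWord V f) (sym (*M-identityˡ y)) ⟩
          rootWord V f (Id n′ *M y) ≡⟨ rootWord-translate V f (Id n′) y ⟩
          rootWord V (λ x → δ (x *M y) z) (Id n′)
            ≡⟨ rootWord-cong V (λ x → δ-cong (λ eq → trans (sym (*M-cancelʳ x y dy)) (cong (_*M adj y) eq)) (λ eq → trans (cong (_*M y) eq) (*M-cancelʳ′ z y dy))) (Id n′) ⟩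
          rootWord V (λ x → δ x z′) (Id n′) ≡⟨ rootWord-++ (List.map lift (word m)) (lowerOps (suc m)) _ (Id n′) ⟩
          rootWord (List.map lift (word m)) (rootWord (lowerOps (suc m)) (λ x → δ x z′)) (Id n′)
            ≡⟨ trans (cong (rootWord (List.map lift (word m)) _) (sym (block-Id (suc m)))) (rootWord-block (word m) (word-offdiag m) _ (Id (suc m))) ⟩
          rootWord (word m) (rootWord (lowerOps (suc m)) (λ x → δ x z′) ∘ block) (Id (suc m))
            ≤⟨ rootWord-mono′ (word m) (λ M → rootWord-lower M z′) (Id (suc m)) ⟩
          rootWord (word m) (λ x → δ x (minor z′)) (Id (suc m)) ∎

-- Energy under averaging over root subgroups

module LeftTranslates where
  open import Data.Nat.Base as ℕ using (ℕ; zero; suc)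
  open import Data.Fin.Base as Fin using (Fin; zero; suc)
  import Data.Fin.Properties as Fin
  open import Data.Vec.Base using (Vec; []; _∷_; lookup; tabulate; _[_]≔_)
  import Data.Vec.Properties as Vec
  open import Data.Integer.Base using (ℤ; +_; 0ℤ; 1ℤ; _≤_; nonNegative) renaming (_+_ to _+ℤ_; _*_ to _*ℤ_; _-_ to _-ℤ_; -_ to -ℤ_)
  import Data.Integer.Base as ℤᵇ
  import Data.Integer.Properties as ℤ
  open import Data.Integer.Tactic.RingSolver using (solve-∀)
  open import Function.Base using (_∘_)
  open import Relation.Nullary.Negation using (¬_)
  open import Relation.Binary.PropositionalEquality
  open import Data.List.Base using ([]; _∷_; length)
  open import Data.Product.Base using (_×_; _,_; proj₁; proj₂; ∃-syntax)
  open import Relation.Nullary.Decidable using (Dec; yes; no; ¬?; _×-dec_; decidable-stable)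
  open FiniteSums
  open FieldAlgebra
  open Determinants
  open MatrixProducts
  open RowOperations
  open Bessel
  open MatrixSums
  open RootSubgroups

  -- The room for a further row through which `n ≥ 3` enters the conjugacy argument.
  third : ∀ {n} → 3 ℕ.≤ n → (i j : Fin n) → ∃[ l ] i ≢ l × j ≢ l
  third {suc (suc (suc n))} (ℕ.s≤s (ℕ.s≤s (ℕ.s≤s ℕ.z≤n))) zero zero = suc zero , (λ ()) , (λ ())
  third {suc (suc (suc n))} (ℕ.s≤s (ℕ.s≤s (ℕ.s≤s ℕ.z≤n))) zero (suc zero) = suc (suc zero) , (λ ()) , (λ ())
  third {suc (suc (suc n))} (ℕ.s≤s (ℕ.s≤s (ℕ.s≤s ℕ.z≤n))) zero (suc (suc _)) = suc zero , (λ ()) , (λ ())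
  third {suc (suc (suc n))} (ℕ.s≤s (ℕ.s≤s (ℕ.s≤s ℕ.z≤n))) (suc zero) zero = suc (suc zero) , (λ ()) , (λ ())
  third {suc (suc (suc n))} (ℕ.s≤s (ℕ.s≤s (ℕ.s≤s ℕ.z≤n))) (suc (suc _)) zero = suc zero , (λ ()) , (λ ())
  third {suc (suc (suc n))} (ℕ.s≤s (ℕ.s≤s (ℕ.s≤s ℕ.z≤n))) (suc _) (suc _) = zero , (λ ()) , (λ ())

  module Translates {q : ℕ} (F : FiniteField q) {n : ℕ} (3≤n : 3 ℕ.≤ n)
    (c : Vec (Vec (FiniteField.Carrier F) n) n → ℤ) (c-idem : ∀ y → c y *ℤ c y ≡ c y)
    (0≤c : ∀ y → 0ℤ ≤ c y) (c-SL : ∀ y → Matrices.det F y ≢ FiniteField.1# F → c y ≡ 0ℤ) where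
    open FiniteField F
    open FieldSolver F
    open Matrices F
    open Determinant F
    open MatrixAlgebra F
    open RowAction F
    open SumsOver F
    open RootWords F using (root; rootWord)

    c-cong : ∀ y {a b : ℤ} → (det y ≡ 1# → a ≡ b) → c y *ℤ a ≡ c y *ℤ b
    c-cong y {a} {b} eq with det y ≟ 1#
    ... | yes d = cong (c y *ℤ_) (eq d)
    ... | no ¬d = trans (cong (_*ℤ a) (c-SL y ¬d)) (trans (ℤ.*-zeroˡ a) (sym (trans (cong (_*ℤ b) (c-SL y ¬d)) (ℤ.*-zeroˡ b))))

    -- Convolution with `c` on the right. When `c` and `f` are the indicators of `C` and `B`, it
    -- counts the representations of `x` as a product from `B` and `C`.
    T : (Mat n → ℤ) → Mat n → ℤ
    T f x = ∑ λ y → c y *ℤ f (x *M adj y)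

    -- For the indicator of `B` this is the multiplicative energy E.
    S₂ : (Mat n → ℤ) → ℤ
    S₂ f = ∑ λ x → γ x *ℤ (T f x *ℤ T f x)

    G C : ℤ
    G = ∑ {Mat n} γ
    C = ∑ c

    module Act (i : Fin n) = BesselInequality {Row n} {Mat n} _⊹_ 𝟘 ⊖_ ⊹-assoc ⊹-comm ⊹-identityˡ ⊹-inverseˡ (act i) (act-⊹ i) (act-𝟘 i)

    T-act : ∀ i w f x → T f (act i w x) ≡ T (f ∘ act i w) x
    T-act i w f x = ∑-cong λ y → cong (λ z → c y *ℤ f z) (act-* i w x (adj y))

    γ-act : ∀ i w (x : Mat n) → γ (act i w x) ≡ γ x
    γ-act i w x = cong (λ d → [ d ≟ 1# ]?) (det-act i w x)

    S₂-act : ∀ i w f → ∑ (λ x → γ x *ℤ (T (f ∘ act i w) x *ℤ T (f ∘ act i w) x)) ≡ S₂ f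
    S₂-act i w f = trans (∑-cong (λ x → sym (cong₂ _*ℤ_ (γ-act i w x) (cong₂ _*ℤ_ (T-act i w f x) (T-act i w f x)))))
      (Act.∑-▹ i w (λ x → γ x *ℤ (T f x *ℤ T f x)))

    -- For `x` in SL the indicator of the translate x C⁻¹, where C is the support of `c`. It writes
    -- `T f x` as a pairing with `f`, the shape that `bessel` requires.
    β : Mat n → Mat n → ℤ
    β x z = ∑ λ y → c y *ℤ δ z (x *M adj y)

    ∑β : ∀ x f → ∑ (λ z → β x z *ℤ f z) ≡ T f x
    ∑β x f = begin
      ∑ (λ z → β x z *ℤ f z) ≡⟨ ∑-cong (λ z → trans (sym (∑-*ʳ (λ y → c y *ℤ δ z (x *M adj y)) (f z))) (∑-cong (λ y → ℤ.*-assoc (c y) (δ z (x *M adj y)) (f z)))) ⟩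
      ∑ (λ z → ∑ (λ y → c y *ℤ (δ z (x *M adj y) *ℤ f z))) ≡⟨ ∑-swap (λ z y → c y *ℤ (δ z (x *M adj y) *ℤ f z)) ⟩
      ∑ (λ y → ∑ (λ z → c y *ℤ (δ z (x *M adj y) *ℤ f z)))
        ≡⟨ ∑-cong (λ y → trans (∑-* (c y) (λ z → δ z (x *M adj y) *ℤ f z)) (cong (c y *ℤ_) (∑-δ* (x *M adj y) f))) ⟩
      T f x ∎
      where open ≡-Reasoning

    β-act : ∀ k α x z → β (act k α x) (act k α z) ≡ β x z
    β-act k α x z = ∑-cong λ y → cong (c y *ℤ_) (trans (cong (δ (act k α z)) (act-* k α x (adj y)))
      (δ-cong (λ eq → trans (sym (act-inverse k α z)) (trans (cong (act k (⊖ α)) eq) (act-inverse k α _))) (cong (act k α))))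

    abstract
      -- Counts `x` in SL and `y`, `y′` in the support of `c` with h x y⁻¹ = x y′⁻¹, where h is the
      -- row operation of `w`. Conjugating h is absorbed by a change of `x`.
      Φ : Fin n → Row n → ℤ
      Φ i w = ∑ λ x → γ x *ℤ Act.corr i (β x) w

      -- `S₂` is unchanged when `g` is moved by a row operation, so it may be averaged over the
      -- group; `bessel` is then applied for every single `x`.
      averaged-bessel : ∀ i g → + ∣ Row n ∣F *ℤ S₂ g ≤ ∑ (λ k → Φ i k *ℤ Act.corr i g (⊖ k))
      averaged-bessel i g = begin
        + ∣ Row n ∣F *ℤ S₂ g ≡⟨ sym (∑-const (Row n) (S₂ g)) ⟩
        ∑ {Row n} (λ s → S₂ g) ≡⟨ ∑-cong (λ s → sym (S₂-act i s g)) ⟩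
        ∑ (λ s → ∑ (λ x → γ x *ℤ (T (g ∘ act i s) x *ℤ T (g ∘ act i s) x))) ≡⟨ ∑-swap _ ⟩
        ∑ (λ x → ∑ (λ s → γ x *ℤ (T (g ∘ act i s) x *ℤ T (g ∘ act i s) x)))
          ≡⟨ ∑-cong (λ x → trans (∑-* (γ x) _) (cong (γ x *ℤ_) (∑-cong (λ s → sym (cong₂ _*ℤ_ (∑β x (g ∘ act i s)) (∑β x (g ∘ act i s))))))) ⟩
        ∑ (λ x → γ x *ℤ ∑ (λ s → ∑ (λ z → β x z *ℤ g (act i s z)) *ℤ ∑ (λ z → β x z *ℤ g (act i s z))))
          ≤⟨ ∑-mono (λ x → ℤ.*-monoˡ-≤-nonNeg (γ x) {{nonNegative (0≤γ x)}} (Act.bessel i (β x) g)) ⟩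
        ∑ (λ x → γ x *ℤ ∑ (λ k → Act.corr i (β x) k *ℤ Act.corr i g (⊖ k)))
          ≡⟨ ∑-cong (λ x → sym (∑-* (γ x) _)) ⟩
        ∑ (λ x → ∑ (λ k → γ x *ℤ (Act.corr i (β x) k *ℤ Act.corr i g (⊖ k)))) ≡⟨ ∑-swap _ ⟩
        ∑ (λ k → ∑ (λ x → γ x *ℤ (Act.corr i (β x) k *ℤ Act.corr i g (⊖ k))))
          ≡⟨ ∑-cong (λ k → trans (∑-cong (λ x → sym (ℤ.*-assoc (γ x) _ _))) (∑-*ʳ (λ x → γ x *ℤ Act.corr i (β x) k) (Act.corr i g (⊖ k)))) ⟩
        ∑ (λ k → Φ i k *ℤ Act.corr i g (⊖ k)) ∎
        where open ℤ.≤-Reasoning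

      -- Substituting `act k α` into both summation variables preserves the count, and `act-conj`
      -- computes the conjugated operation.
      Φ-conj : ∀ {i k} → i ≢ k → ∀ α w → lookup α i ≡ 0# → lookup α k ≡ 0# → Φ i (w ⊹ lookup w k ∙ α) ≡ Φ i w
      Φ-conj {i} {k} i≢k α w αi αk = sym (begin
        ∑ (λ x → γ x *ℤ Act.corr i (β x) w) ≡⟨ sym (Act.∑-▹ k α _) ⟩
        ∑ (λ x → γ (act k α x) *ℤ Act.corr i (β (act k α x)) w) ≡⟨ ∑-cong (λ x → cong₂ _*ℤ_ (γ-act k α x) (begin
          ∑ (λ z → β (act k α x) z *ℤ β (act k α x) (act i w z)) ≡⟨ sym (Act.∑-▹ k α _) ⟩
          ∑ (λ z → β (act k α x) (act k α z) *ℤ β (act k α x) (act i w (act k α z)))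
            ≡⟨ ∑-cong (λ z → cong₂ _*ℤ_ (β-act k α x z) (trans (cong (β (act k α x)) (sym (act-conj i≢k α w αi αk z))) (β-act k α x _))) ⟩
          ∑ (λ z → β x z *ℤ β x (act i (w ⊹ lookup w k ∙ α) z)) ∎)) ⟩
        Φ i (w ⊹ lookup w k ∙ α) ∎)
        where open ≡-Reasoning

      Φ-cong : ∀ i v w → (∀ t → i ≢ t → lookup v t ≡ lookup w t) → Φ i v ≡ Φ i w
      Φ-cong i v w eq = ∑-cong λ x → cong (γ x *ℤ_) (∑-cong λ z → cong (λ y → β x z *ℤ β x y) (act-cong i {v} {w} eq z))

      Φ-nonneg : ∀ i w → 0ℤ ≤ Φ i w
      Φ-nonneg i w = ∑-nonneg λ x → *-nonneg (0≤γ x) (∑-nonneg λ z → *-nonneg (0≤β x z) (0≤β x (act i w z)))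
        where
        0≤β : ∀ x z → 0ℤ ≤ β x z
        0≤β x z = ∑-nonneg λ y → *-nonneg (0≤c y) (0≤[]? _)

      -- The trivial operation forces the two elements of the support to coincide.
      Φ-𝟘 : ∀ i → Φ i 𝟘 ≡ G *ℤ C
      Φ-𝟘 i = trans (∑-cong (λ x → γ-cong x (inner x))) (∑-*ʳ γ C)
        where
        open ≡-Reasoning
        inner : ∀ x → det x ≡ 1# → Act.corr i (β x) 𝟘 ≡ C
        inner x dx = begin
          ∑ (λ z → β x z *ℤ β x (act i 𝟘 z)) ≡⟨ ∑-cong (λ z → cong (λ y → β x z *ℤ β x y) (act-𝟘 i z)) ⟩
          ∑ (λ z → β x z *ℤ β x z) ≡⟨ ∑β x (β x) ⟩
          ∑ (λ y → c y *ℤ β x (x *M adj y)) ≡⟨ ∑-cong (λ y → trans (c-cong y (λ dy → begin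
            ∑ (λ y′ → c y′ *ℤ δ (x *M adj y) (x *M adj y′)) ≡⟨ ∑-cong (λ y′ → trans (c-cong y′ (λ dy′ → δ-cong (λ eq → sym (injective y y′ dy dy′ eq)) (λ eq → cong (λ z → x *M adj z) (sym eq)))) (ℤ.*-comm (c y′) _)) ⟩
            ∑ (λ y′ → δ y′ y *ℤ c y′) ≡⟨ ∑-δ* y c ⟩
            c y ∎)) (c-idem y)) ⟩
          C ∎
          where
          injective : ∀ y y′ → det y ≡ 1# → det y′ ≡ 1# → x *M adj y ≡ x *M adj y′ → y ≡ y′
          injective y y′ dy dy′ eq = begin
            y ≡⟨ sym (adj-adj y dy) ⟩
            adj (adj y) ≡⟨ cong adj (trans (sym (*M-cancelˡ x (adj y) dx)) (trans (cong (adj x *M_) eq) (*M-cancelˡ x (adj y′) dx))) ⟩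
            adj (adj y′) ≡⟨ adj-adj y′ dy′ ⟩
            y′ ∎

    Φ-pivot : ∀ {i k} → i ≢ k → ∀ v w → lookup w k ≢ 0# → lookup v k ≡ lookup w k → Φ i v ≡ Φ i w
    Φ-pivot {i} {k} i≢k v w wk≢0 vk≡wk = trans (Φ-cong i v (w ⊹ lookup w k ∙ α) agree) (Φ-conj i≢k α w
        (trans (Vec.lookup∘tabulate _ i) (trans (cong (_* ((lookup v i + - lookup w i) * inv)) (off-diag i)) (zeroˡ _)))
        (trans (Vec.lookup∘tabulate _ k) (trans (cong (λ z → off i k * ((z + - lookup w k) * inv)) vk≡wk)
          (solve 3 (λ o w i → o :* ((w :+ :- w) :* i) := con (+ 0)) refl _ _ _))))
      where
      inv = proj₁ (inverse (lookup w k) wk≢0)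
      -- Division by the pivot entry makes `w ⊹ lookup w k ∙ α` agree with `v` off `i`. The mask
      -- gives zero at `i` and `vk≡wk` gives zero at `k`, as `Φ-conj` demands.
      α = tabulate λ t → off i t * ((lookup v t + - lookup w t) * inv)
      agree : ∀ t → i ≢ t → lookup v t ≡ lookup (w ⊹ lookup w k ∙ α) t
      agree t i≢t = sym (begin
        lookup (w ⊹ lookup w k ∙ α) t ≡⟨ trans (lookup-⊹ w _ t) (cong (_+_ (lookup w t)) (trans (lookup-∙ (lookup w k) α t) (cong (lookup w k *_) (Vec.lookup∘tabulate _ t)))) ⟩
        lookup w t + lookup w k * (off i t * ((lookup v t + - lookup w t) * inv)) ≡⟨ cong (λ o → lookup w t + lookup w k * (o * ((lookup v t + - lookup w t) * inv))) (off-off i≢t) ⟩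
        lookup w t + lookup w k * (1# * ((lookup v t + - lookup w t) * inv)) ≡⟨ solve 4 (λ w p v i → w :+ p :* (con (+ 1) :* ((v :+ :- w) :* i)) := w :+ (p :* i) :* (v :+ :- w)) refl _ _ _ _ ⟩
        lookup w t + lookup w k * inv * (lookup v t + - lookup w t) ≡⟨ cong (λ z → lookup w t + z * (lookup v t + - lookup w t)) (proj₂ (inverse (lookup w k) wk≢0)) ⟩
        lookup w t + 1# * (lookup v t + - lookup w t) ≡⟨ solve 2 (λ w v → w :+ con (+ 1) :* (v :+ :- w) := v) refl _ _ ⟩
        lookup v t ∎)
        where open ≡-Reasoning

    Φ-distinct : ∀ {i j k} → i ≢ j → i ≢ k → j ≢ k → ∀ v w → lookup v j ≢ 0# → lookup w k ≢ 0# → Φ i v ≡ Φ i w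
    Φ-distinct {i} {j} {k} i≢j i≢k j≢k v w vj wk = trans
      (sym (Φ-pivot i≢j u v vj (Vec.lookup∘update′ j≢k v (lookup w k))))
      (Φ-pivot i≢k u w wk (Vec.lookup∘update k v (lookup w k)))
      where
      -- Agrees with `v` at `j` and with `w` at `k`, so a pivot at `j` leads from `v` to `u` and a
      -- pivot at `k` from `u` to `w`.
      u = v [ k ]≔ lookup w k

    -- All nontrivial elements of the group of row operations into row i are conjugate in SL; this needs n ≥ 3.
    Φ-const : ∀ {i j k} → i ≢ j → i ≢ k → ∀ v w → lookup v j ≢ 0# → lookup w k ≢ 0# → Φ i v ≡ Φ i w
    Φ-const {i} {j} {k} i≢j i≢k v w vj wk with j Fin.≟ k
    ... | no j≢k = Φ-distinct i≢j i≢k j≢k v w vj wk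
    ... | yes refl with third 3≤n i j
    ... | l , i≢l , j≢l = trans (Φ-distinct i≢j i≢l j≢l v (e l) vj el) (Φ-distinct i≢l i≢k (j≢l ∘ sym) (e l) w el wk)
      where
      el : lookup (e l) l ≢ 0#
      el eq = 0≢1 (trans (sym eq) (κ-diag l))

    -- The indicator of the rows that act trivially, written as a sum over the free coordinate so
    -- that its total `Q` is immediate.
    triv : Fin n → Row n → ℤ
    triv i w = ∑ λ a → δ w (𝟘 [ i ]≔ a)

    triv-yes : ∀ i w → (∀ j → i ≢ j → lookup w j ≡ 0#) → triv i w ≡ 1ℤ
    triv-yes i w w≡0 = trans (∑-cong (λ a → δ-cong
        (λ eq → sym (trans (cong (λ v → lookup v i) eq) (Vec.lookup∘update i 𝟘 a)))
        (λ a≡ → lookup-ext (λ t → sym (agree a a≡ t (t Fin.≟ i)))))) (∑-δ (lookup w i))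
      where
      agree : ∀ a → a ≡ lookup w i → ∀ t → Dec (t ≡ i) → lookup (𝟘 [ i ]≔ a) t ≡ lookup w t
      agree a a≡ t (yes refl) = trans (Vec.lookup∘update i 𝟘 a) a≡
      agree a a≡ t (no t≢i) = trans (Vec.lookup∘update′ t≢i 𝟘 a) (trans (Vec.lookup-replicate t 0#) (sym (w≡0 t (t≢i ∘ sym))))

    triv-no : ∀ i w {j} → i ≢ j → lookup w j ≢ 0# → triv i w ≡ 0ℤ
    triv-no i w {j} i≢j wj≢0 = ∑-0 λ a → []?-no (w ≟F (𝟘 [ i ]≔ a)) λ eq → wj≢0
      (trans (cong (λ v → lookup v j) eq) (trans (Vec.lookup∘update′ (i≢j ∘ sym) 𝟘 a) (Vec.lookup-replicate j 0#)))

    ∑-triv : ∀ i → ∑ (triv i) ≡ Q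
    ∑-triv i = trans (∑-swap (λ w a → δ w (𝟘 [ i ]≔ a))) (trans (∑-cong (λ a → ∑-δ (𝟘 [ i ]≔ a)))
      (trans (∑-const Carrier 1ℤ) (ℤ.*-identityʳ Q)))

    nontrivial? : ∀ i (w : Row n) → Dec (∃[ j ] i ≢ j × lookup w j ≢ 0#)
    nontrivial? i w = Fin.any? λ j → ¬? (i Fin.≟ j) ×-dec ¬? (lookup w j ≟ 0#)

    trivial : ∀ i (w : Row n) → ¬ (∃[ j ] i ≢ j × lookup w j ≢ 0#) → ∀ j → i ≢ j → lookup w j ≡ 0#
    trivial i w ¬∃ j i≢j = decidable-stable (lookup w j ≟ 0#) (λ wj≢0 → ¬∃ (j , i≢j , wj≢0))

    Φ-values : ∀ i → ∃[ φ ] 0ℤ ≤ φ × (∀ w → Φ i w ≡ φ +ℤ (G *ℤ C -ℤ φ) *ℤ triv i w)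
    Φ-values i with third 3≤n i i
    ... | l , i≢l , _ = φ , Φ-nonneg i (e l) , values
      where
      φ = Φ i (e l)
      values : ∀ w → Φ i w ≡ φ +ℤ (G *ℤ C -ℤ φ) *ℤ triv i w
      values w with nontrivial? i w
      ... | yes (j , i≢j , wj≢0) = trans (Φ-const i≢j i≢l w (e l) wj≢0 (λ eq → 0≢1 (trans (sym eq) (κ-diag l))))
        (trans (none φ (G *ℤ C -ℤ φ)) (cong (λ t → φ +ℤ (G *ℤ C -ℤ φ) *ℤ t) (sym (triv-no i w i≢j wj≢0))))
        where
        none : ∀ φ g → φ ≡ φ +ℤ g *ℤ 0ℤ
        none = solve-∀
      ... | no ¬∃ = trans (Φ-cong i w 𝟘 (λ t i≢t → trans (trivial i w ¬∃ t i≢t) (sym (Vec.lookup-replicate t 0#))))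
        (trans (Φ-𝟘 i) (trans (all φ (G *ℤ C)) (cong (λ t → φ +ℤ (G *ℤ C -ℤ φ) *ℤ t) (sym (triv-yes i w (trivial i w ¬∃))))))
        where
        all : ∀ φ g → g ≡ φ +ℤ (g -ℤ φ) *ℤ 1ℤ
        all = solve-∀

    ⊖-involutive : ∀ (w : Row n) → ⊖ (⊖ w) ≡ w
    ⊖-involutive w = lookup-ext λ i → trans (lookup-∙ (- 1#) (⊖ w) i) (trans (cong (- 1# *_) (lookup-∙ (- 1#) w i))
      (solve 1 (λ x → :- con (+ 1) :* (:- con (+ 1) :* x) := x) refl _))

    corr-triv : ∀ i g w → triv i w *ℤ Act.corr i g (⊖ w) ≡ triv i w *ℤ ‖ g ‖²
    corr-triv i g w with nontrivial? i w
    ... | yes (j , i≢j , wj≢0) = trans (cong (_*ℤ Act.corr i g (⊖ w)) (triv-no i w i≢j wj≢0)) (sym (cong (_*ℤ ‖ g ‖²) (triv-no i w i≢j wj≢0)))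
    ... | no ¬∃ = cong (triv i w *ℤ_) (∑-cong λ z → cong (λ y → g z *ℤ g y) (trans (act-cong i {⊖ w} {𝟘} agree z) (act-𝟘 i z)))
      where
      agree : ∀ t → i ≢ t → lookup (⊖ w) t ≡ lookup 𝟘 t
      agree t i≢t = trans (lookup-∙ (- 1#) w t) (trans (cong (- 1# *_) (trivial i w ¬∃ t i≢t))
        (trans (zeroʳ _) (sym (Vec.lookup-replicate t 0#))))

    0≤G : 0ℤ ≤ G
    0≤G = ∑-nonneg 0≤γ

    0≤C : 0ℤ ≤ C
    0≤C = ∑-nonneg 0≤c

    0≤Q : 0ℤ ≤ Q
    0≤Q = ℤᵇ.+≤+ ℕ.z≤n

    N : ℤ
    N = + ∣ Row n ∣F

    -- The constant part `φ` of `Φ` meets the sum of all correlations of `g`, which vanishes. Only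
    -- trivial operations remain, and `0≤φ` allows dropping the negative term. As `N` is q^n, the
    -- factor `Q` leaves the saving |H| = q^(n-1).
    mean-zero-bound : ∀ i g → (∀ x → ∑ (λ k → g (act i k x)) ≡ 0ℤ) → N *ℤ S₂ g ≤ G *ℤ C *ℤ (Q *ℤ ‖ g ‖²)
    mean-zero-bound i g mean0 with Φ-values i
    ... | φ , 0≤φ , values = begin
      N *ℤ S₂ g ≤⟨ averaged-bessel i g ⟩
      ∑ (λ k → Φ i k *ℤ Act.corr i g (⊖ k)) ≡⟨ ∑-cong (λ k → trans (cong (_*ℤ Act.corr i g (⊖ k)) (values k)) (split φ (G *ℤ C) (triv i k) (Act.corr i g (⊖ k)))) ⟩
      ∑ (λ k → φ *ℤ Act.corr i g (⊖ k) +ℤ (G *ℤ C -ℤ φ) *ℤ (triv i k *ℤ Act.corr i g (⊖ k)))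
        ≡⟨ trans (∑-+ _ _) (cong₂ _+ℤ_ (∑-* φ (λ k → Act.corr i g (⊖ k))) (∑-* (G *ℤ C -ℤ φ) _)) ⟩
      φ *ℤ ∑ (λ k → Act.corr i g (⊖ k)) +ℤ (G *ℤ C -ℤ φ) *ℤ ∑ (λ k → triv i k *ℤ Act.corr i g (⊖ k))
        ≡⟨ cong₂ (λ s t → φ *ℤ s +ℤ (G *ℤ C -ℤ φ) *ℤ t) ∑corr⁻ (trans (∑-cong (corr-triv i g)) (trans (∑-*ʳ (triv i) ‖ g ‖²) (cong (_*ℤ ‖ g ‖²) (∑-triv i)))) ⟩
      φ *ℤ 0ℤ +ℤ (G *ℤ C -ℤ φ) *ℤ (Q *ℤ ‖ g ‖²) ≡⟨ cong (_+ℤ (G *ℤ C -ℤ φ) *ℤ (Q *ℤ ‖ g ‖²)) (ℤ.*-zeroʳ φ) ⟩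
      0ℤ +ℤ (G *ℤ C -ℤ φ) *ℤ (Q *ℤ ‖ g ‖²) ≡⟨ ℤ.+-identityˡ _ ⟩
      (G *ℤ C -ℤ φ) *ℤ (Q *ℤ ‖ g ‖²) ≤⟨ *-monoʳ {G *ℤ C -ℤ φ} {G *ℤ C} {Q *ℤ ‖ g ‖²} (*-nonneg 0≤Q (‖‖²-nonneg g)) (ℤ.i≤j⇒i-k≤j {i = G *ℤ C} φ {{nonNegative 0≤φ}} ℤ.≤-refl) ⟩
      G *ℤ C *ℤ (Q *ℤ ‖ g ‖²) ∎
      where
      open ℤ.≤-Reasoning
      split : ∀ φ g t k → (φ +ℤ (g -ℤ φ) *ℤ t) *ℤ k ≡ φ *ℤ k +ℤ (g -ℤ φ) *ℤ (t *ℤ k)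
      split = solve-∀
      ∑corr⁻ : ∑ (λ k → Act.corr i g (⊖ k)) ≡ 0ℤ
      ∑corr⁻ = trans (∑-bij ⊖_ ⊖_ ⊖-involutive ⊖-involutive (Act.corr i g)) (trans (∑-swap (λ k z → g z *ℤ g (act i k z)))
        (∑-0 (λ z → trans (∑-* (g z) _) (trans (cong (g z *ℤ_) (mean0 z)) (ℤ.*-zeroʳ (g z))))))

    ∙-distrib : ∀ b a (v : Row n) → b ∙ v ⊹ a ∙ v ≡ (b + a) ∙ v
    ∙-distrib b a v = lookup-ext λ i → trans (lookup-⊹ (b ∙ v) (a ∙ v) i)
      (trans (cong₂ _+_ (lookup-∙ b v i) (lookup-∙ a v i)) (trans (sym (distribʳ _ b a)) (sym (lookup-∙ (b + a) v i))))

    ∑-shift : ∀ a (f : Carrier → ℤ) → ∑ (λ b → f (b + a)) ≡ ∑ f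
    ∑-shift a = ∑-bij (_+ a) (_+ - a) (λ b → solve 2 (λ b a → b :+ :- a :+ a := b) refl b a) (λ b → solve 2 (λ b a → b :+ a :+ :- a := b) refl b a)

    root-invariant : ∀ i j f a x → root i j f (act i (a ∙ e j) x) ≡ root i j f x
    root-invariant i j f a x = trans (∑-cong (λ b → cong f (trans (sym (act-⊹ i (b ∙ e j) (a ∙ e j) x)) (cong (λ v → act i v x) (∙-distrib b a (e j))))))
      (∑-shift a (λ b → f (act i (b ∙ e j) x)))

    T-root : ∀ i j f x → T (root i j f) x ≡ root i j (T f) x
    T-root i j f x = trans (∑-cong (λ y → sym (∑-* (c y) _))) (trans (∑-swap _) (∑-cong (λ a → sym (T-act i (a ∙ e j) f x))))

    -- Pythagoras: `root i j` is `Q` times an orthogonal projection for every weight `ρ` invariant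
    -- under row operations. Both the constant weight and `γ` occur.
    variance : ∀ i j (ρ : Mat n → ℤ) → (∀ w x → ρ (act i w x) ≡ ρ x) → ∀ h →
      ∑ (λ x → ρ x *ℤ ((Q *ℤ h x -ℤ root i j h x) *ℤ (Q *ℤ h x -ℤ root i j h x)))
        ≡ Q *ℤ Q *ℤ ∑ (λ x → ρ x *ℤ (h x *ℤ h x)) -ℤ ∑ (λ x → ρ x *ℤ (root i j h x *ℤ root i j h x))
    variance i j ρ ρ-act h = begin
      ∑ (λ x → ρ x *ℤ ((Q *ℤ h x -ℤ H x) *ℤ (Q *ℤ h x -ℤ H x)))
        ≡⟨ ∑-cong (λ x → expand Q (ρ x) (h x) (H x)) ⟩
      ∑ (λ x → (Q *ℤ Q *ℤ (ρ x *ℤ (h x *ℤ h x)) +ℤ ρ x *ℤ (H x *ℤ H x)) -ℤ + 2 *ℤ Q *ℤ (ρ x *ℤ (h x *ℤ H x)))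
        ≡⟨ trans (∑-- _ _) (cong₂ _-ℤ_ (trans (∑-+ _ _) (cong (_+ℤ B) (∑-* (Q *ℤ Q) (λ x → ρ x *ℤ (h x *ℤ h x))))) (∑-* (+ 2 *ℤ Q) _)) ⟩
      (Q *ℤ Q *ℤ A +ℤ B) -ℤ + 2 *ℤ Q *ℤ M ≡⟨ collect (Q *ℤ Q *ℤ A) B Q M ⟩
      (Q *ℤ Q *ℤ A +ℤ B) -ℤ + 2 *ℤ (Q *ℤ M) ≡⟨ cong (λ t → (Q *ℤ Q *ℤ A +ℤ B) -ℤ + 2 *ℤ t) (sym B≡QM) ⟩
      (Q *ℤ Q *ℤ A +ℤ B) -ℤ + 2 *ℤ B ≡⟨ cancel (Q *ℤ Q *ℤ A) B ⟩
      Q *ℤ Q *ℤ A -ℤ B ∎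
      where
      open ≡-Reasoning
      H = root i j h
      A = ∑ (λ x → ρ x *ℤ (h x *ℤ h x))
      B = ∑ (λ x → ρ x *ℤ (H x *ℤ H x))
      M = ∑ (λ x → ρ x *ℤ (h x *ℤ H x))
      expand : ∀ Q r h H → r *ℤ ((Q *ℤ h -ℤ H) *ℤ (Q *ℤ h -ℤ H)) ≡ (Q *ℤ Q *ℤ (r *ℤ (h *ℤ h)) +ℤ r *ℤ (H *ℤ H)) -ℤ + 2 *ℤ Q *ℤ (r *ℤ (h *ℤ H))
      expand = solve-∀
      collect : ∀ a b Q m → (a +ℤ b) -ℤ + 2 *ℤ Q *ℤ m ≡ (a +ℤ b) -ℤ + 2 *ℤ (Q *ℤ m)
      collect = solve-∀
      cancel : ∀ a b → (a +ℤ b) -ℤ + 2 *ℤ b ≡ a -ℤ b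
      cancel = solve-∀
      B≡QM : B ≡ Q *ℤ M
      B≡QM = begin
        ∑ (λ x → ρ x *ℤ (H x *ℤ H x)) ≡⟨ ∑-cong (λ x → trans (sym (ℤ.*-assoc (ρ x) (H x) (H x))) (trans (ℤ.*-comm _ (H x))
            (sym (∑-*ʳ-root x)))) ⟩
        ∑ (λ x → ∑ (λ a → ρ x *ℤ (h (act i (a ∙ e j) x) *ℤ H x))) ≡⟨ ∑-swap _ ⟩
        ∑ (λ a → ∑ (λ x → ρ x *ℤ (h (act i (a ∙ e j) x) *ℤ H x)))
          ≡⟨ ∑-cong (λ a → trans (∑-cong (λ x → cong₂ (λ r s → r *ℤ (h (act i (a ∙ e j) x) *ℤ s)) (sym (ρ-act (a ∙ e j) x)) (sym (root-invariant i j h a x))))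
               (Act.∑-▹ i (a ∙ e j) (λ x → ρ x *ℤ (h x *ℤ H x)))) ⟩
        ∑ {Carrier} (λ a → M) ≡⟨ ∑-const Carrier M ⟩
        Q *ℤ M ∎
        where
        ∑-*ʳ-root : ∀ x → ∑ (λ a → ρ x *ℤ (h (act i (a ∙ e j) x) *ℤ H x)) ≡ H x *ℤ (ρ x *ℤ H x)
        ∑-*ʳ-root x = trans (∑-cong (λ a → swap (ρ x) (h (act i (a ∙ e j) x)) (H x))) (∑-*ʳ _ (ρ x *ℤ H x))
          where
          swap : ∀ r h H → r *ℤ (h *ℤ H) ≡ h *ℤ (r *ℤ H)
          swap = solve-∀

    root-norm : ∀ i j f → ‖ (λ x → Q *ℤ f x -ℤ root i j f x) ‖² ≡ Q *ℤ Q *ℤ ‖ f ‖² -ℤ ‖ root i j f ‖²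
    root-norm i j f = trans (∑-cong (λ x → sym (ℤ.*-identityˡ _))) (trans (variance i j (λ _ → 1ℤ) (λ _ _ → refl) f)
      (cong₂ (λ s t → Q *ℤ Q *ℤ s -ℤ t) (∑-cong (λ x → ℤ.*-identityˡ _)) (∑-cong (λ x → ℤ.*-identityˡ _))))

    root-norm-≤ : ∀ i j f → ‖ root i j f ‖² ≤ Q *ℤ Q *ℤ ‖ f ‖²
    root-norm-≤ i j f = ℤ.0≤i-j⇒j≤i (subst (0ℤ ≤_) (root-norm i j f) (‖‖²-nonneg (λ x → Q *ℤ f x -ℤ root i j f x)))

    root-S₂ : ∀ i j f → S₂ (λ x → Q *ℤ f x -ℤ root i j f x) ≡ Q *ℤ Q *ℤ S₂ f -ℤ S₂ (root i j f)
    root-S₂ i j f = trans (∑-cong (λ x → cong (λ t → γ x *ℤ (t *ℤ t)) (T-g x))) (trans (variance i j γ (γ-act i) (T f))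
      (cong (λ t → Q *ℤ Q *ℤ S₂ f -ℤ t) (∑-cong (λ x → cong (λ t → γ x *ℤ (t *ℤ t)) (sym (T-root i j f x))))))
      where
      T-g : ∀ x → T (λ x → Q *ℤ f x -ℤ root i j f x) x ≡ Q *ℤ T f x -ℤ root i j (T f) x
      T-g x = trans (∑-cong (λ y → distr (c y) Q (f (x *M adj y)) (root i j f (x *M adj y))))
        (trans (∑-- _ _) (cong₂ _-ℤ_ (∑-* Q _) (T-root i j f x)))
        where
        distr : ∀ c Q f r → c *ℤ (Q *ℤ f -ℤ r) ≡ Q *ℤ (c *ℤ f) -ℤ c *ℤ r
        distr = solve-∀

    -- By orthogonality the loss is exactly the energy of `Q *ℤ f x -ℤ root i j f x`. That function
    -- sums to zero along the whole row group, because the root subgroup lies inside it.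
    root-step : ∀ i j f → N *ℤ (Q *ℤ Q *ℤ S₂ f) ≤ N *ℤ S₂ (root i j f) +ℤ G *ℤ C *ℤ (Q *ℤ (Q *ℤ Q *ℤ ‖ f ‖²))
    root-step i j f = begin
      N *ℤ (Q *ℤ Q *ℤ S₂ f) ≡⟨ split N (Q *ℤ Q *ℤ S₂ f) (S₂ (root i j f)) ⟩
      N *ℤ S₂ (root i j f) +ℤ N *ℤ (Q *ℤ Q *ℤ S₂ f -ℤ S₂ (root i j f)) ≡⟨ cong (λ t → N *ℤ S₂ (root i j f) +ℤ N *ℤ t) (sym (root-S₂ i j f)) ⟩
      N *ℤ S₂ (root i j f) +ℤ N *ℤ S₂ g ≤⟨ ℤ.+-monoʳ-≤ (N *ℤ S₂ (root i j f)) (ℤ.≤-trans (mean-zero-bound i g mean0)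
        (*-monoˡ (*-nonneg 0≤G 0≤C) (*-monoˡ 0≤Q (subst (_≤ Q *ℤ Q *ℤ ‖ f ‖²) (sym (root-norm i j f))
          (ℤ.i≤j⇒i-k≤j ‖ root i j f ‖² {{nonNegative (‖‖²-nonneg (root i j f))}} ℤ.≤-refl))))) ⟩
      N *ℤ S₂ (root i j f) +ℤ G *ℤ C *ℤ (Q *ℤ (Q *ℤ Q *ℤ ‖ f ‖²)) ∎
      where
      open ℤ.≤-Reasoning
      g : Mat n → ℤ
      g x = Q *ℤ f x -ℤ root i j f x
      split : ∀ n a b → n *ℤ a ≡ n *ℤ b +ℤ n *ℤ (a -ℤ b)
      split = solve-∀
      mean0 : ∀ x → ∑ (λ k → g (act i k x)) ≡ 0ℤ
      mean0 x = trans (∑-- _ _) (trans (cong₂ _-ℤ_ (∑-* Q _) (trans (∑-swap _) (trans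
        (∑-cong (λ a → trans (∑-cong (λ k → cong f (trans (sym (act-⊹ i (a ∙ e j) k x)) (cong (λ v → act i v x) (⊹-comm (a ∙ e j) k)))))
          (Act.∑-⊞ i (a ∙ e j) (λ k → f (act i k x)))))
        (∑-const Carrier (∑ (λ k → f (act i k x))))))) (ℤ.i≡j⇒i-j≡0 {Q *ℤ ∑ (λ k → f (act i k x))} refl))

    Q²^ : ℕ → ℤ
    Q²^ zero = 1ℤ
    Q²^ (suc k) = Q *ℤ Q *ℤ Q²^ k

    rootWord-norm : ∀ W f → ‖ rootWord W f ‖² ≤ Q²^ (length W) *ℤ ‖ f ‖²
    rootWord-norm [] f = ℤ.≤-reflexive (sym (ℤ.*-identityˡ _))
    rootWord-norm ((i , j) ∷ W) f = ℤ.≤-trans (root-norm-≤ i j (rootWord W f))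
      (ℤ.≤-trans (*-monoˡ (*-nonneg 0≤Q 0≤Q) (rootWord-norm W f)) (ℤ.≤-reflexive (sym (ℤ.*-assoc (Q *ℤ Q) _ _))))

    -- Each letter adds one error; since the squared norm grows by at most `Q *ℤ Q` per letter, all
    -- errors have the same bound after scaling.
    rootWord-S₂ : ∀ W f → N *ℤ (Q²^ (length W) *ℤ S₂ f) ≤
      N *ℤ S₂ (rootWord W f) +ℤ + length W *ℤ (G *ℤ C *ℤ (Q *ℤ (Q²^ (length W) *ℤ ‖ f ‖²)))
    rootWord-S₂ [] f = ℤ.≤-reflexive (base N (S₂ f) (G *ℤ C *ℤ (Q *ℤ (1ℤ *ℤ ‖ f ‖²))))
      where
      base : ∀ n s z → n *ℤ (1ℤ *ℤ s) ≡ n *ℤ s +ℤ 0ℤ *ℤ z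
      base = solve-∀
    rootWord-S₂ ((i , j) ∷ W) f = begin
      N *ℤ (Q *ℤ Q *ℤ P *ℤ S₂ f) ≡⟨ front N Q P (S₂ f) ⟩
      Q *ℤ Q *ℤ (N *ℤ (P *ℤ S₂ f)) ≤⟨ *-monoˡ (*-nonneg 0≤Q 0≤Q) (rootWord-S₂ W f) ⟩
      Q *ℤ Q *ℤ (N *ℤ S₂ h +ℤ + k *ℤ (G *ℤ C *ℤ (Q *ℤ (P *ℤ ‖ f ‖²)))) ≡⟨ mid Q N (S₂ h) (+ k) (G *ℤ C) P ‖ f ‖² ⟩
      N *ℤ (Q *ℤ Q *ℤ S₂ h) +ℤ + k *ℤ (G *ℤ C *ℤ (Q *ℤ (Q *ℤ Q *ℤ P *ℤ ‖ f ‖²)))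
        ≤⟨ ℤ.+-monoˡ-≤ _ (ℤ.≤-trans (root-step i j h) (ℤ.+-monoʳ-≤ (N *ℤ S₂ (root i j h))
             (*-monoˡ (*-nonneg 0≤G 0≤C) (*-monoˡ 0≤Q (*-monoˡ (*-nonneg 0≤Q 0≤Q) (rootWord-norm W f)))))) ⟩
      (N *ℤ S₂ (root i j h) +ℤ G *ℤ C *ℤ (Q *ℤ (Q *ℤ Q *ℤ (P *ℤ ‖ f ‖²)))) +ℤ + k *ℤ (G *ℤ C *ℤ (Q *ℤ (Q *ℤ Q *ℤ P *ℤ ‖ f ‖²)))
        ≡⟨ end Q (N *ℤ S₂ (root i j h)) (+ k) (G *ℤ C) P ‖ f ‖² ⟩
      N *ℤ S₂ (root i j h) +ℤ (1ℤ +ℤ + k) *ℤ (G *ℤ C *ℤ (Q *ℤ (Q *ℤ Q *ℤ P *ℤ ‖ f ‖²))) ∎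
      where
      open ℤ.≤-Reasoning
      h = rootWord W f
      k = length W
      P = Q²^ (length W)
      front : ∀ n q p s → n *ℤ (q *ℤ q *ℤ p *ℤ s) ≡ q *ℤ q *ℤ (n *ℤ (p *ℤ s))
      front = solve-∀
      mid : ∀ q n s k g p f → q *ℤ q *ℤ (n *ℤ s +ℤ k *ℤ (g *ℤ (q *ℤ (p *ℤ f)))) ≡ n *ℤ (q *ℤ q *ℤ s) +ℤ k *ℤ (g *ℤ (q *ℤ (q *ℤ q *ℤ p *ℤ f)))
      mid = solve-∀
      end : ∀ q s k g p f → (s +ℤ g *ℤ (q *ℤ (q *ℤ q *ℤ (p *ℤ f)))) +ℤ k *ℤ (g *ℤ (q *ℤ (q *ℤ q *ℤ p *ℤ f))) ≡ s +ℤ (1ℤ +ℤ k) *ℤ (g *ℤ (q *ℤ (q *ℤ q *ℤ p *ℤ f)))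
      end = solve-∀

-- The energy bound and the size of the product set

module ProductSets where
  open import Data.Nat.Base as ℕ using (ℕ; zero; suc)
  open import Data.Fin.Base using (Fin; zero; suc)
  open import Data.Vec.Base using (Vec; []; _∷_)
  open import Data.List.Base using (List; []; _∷_; length)
  open import Data.Integer.Base using (ℤ; +_; 0ℤ; 1ℤ; _≤_; positive; _^_) renaming (_+_ to _+ℤ_; _*_ to _*ℤ_)
  import Data.Integer.Base as ℤᵇ
  import Data.Integer.Properties as ℤ
  open import Data.Integer.Tactic.RingSolver using (solve-∀)
  open import Data.Product.Base using (_×_; _,_)
  open import Relation.Nullary.Decidable using (Dec; yes; no)
  open import Relation.Binary.PropositionalEquality
  open FiniteSums
  open FieldAlgebra
  open Determinants
  open MatrixProducts
  open RowOperations
  open MatrixSums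
  open RootSubgroups
  open LeftTranslates

  module EnergyBound {q : ℕ} (F : FiniteField q) {m : ℕ} (3≤n : 3 ℕ.≤ suc m)
    (c : Vec (Vec (FiniteField.Carrier F) (suc m)) (suc m) → ℤ) (c-idem : ∀ y → c y *ℤ c y ≡ c y)
    (0≤c : ∀ y → 0ℤ ≤ c y) (c-SL : ∀ y → Matrices.det F y ≢ FiniteField.1# F → c y ≡ 0ℤ)
    (b : Vec (Vec (FiniteField.Carrier F) (suc m)) (suc m) → ℤ) (b-idem : ∀ y → b y *ℤ b y ≡ b y)
    (0≤b : ∀ y → 0ℤ ≤ b y) (b-SL : ∀ y → Matrices.det F y ≢ FiniteField.1# F → b y ≡ 0ℤ) where
    open FiniteField F
    open FieldSolver F
    open Matrices F
    open Determinant F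
    open MatrixAlgebra F
    open RowAction F
    open SumsOver F
    open RootWords F
    open Translates F 3≤n c c-idem 0≤c c-SL

    n = suc m
    B = ∑ b
    W = word m
    k = length W
    D = Q ^ dim m
    L = Q ^ k

    0≤B : 0ℤ ≤ B
    0≤B = ∑-nonneg 0≤b

    ∑-*M-adj : ∀ y → det y ≡ 1# → ∀ (f : Mat n → ℤ) → ∑ (λ x → f (x *M adj y)) ≡ ∑ f
    ∑-*M-adj y dy = ∑-bij (_*M adj y) (_*M y) (λ x → *M-cancelʳ x y dy) (λ x → *M-cancelʳ′ x y dy)

    rootWord-∑ : ∀ {A : Set} {{_ : Finite A}} (W : List (Fin n × Fin n)) (h : A → Mat n → ℤ) x →
      rootWord W (λ y → ∑ (λ z → h z y)) x ≡ ∑ (λ z → rootWord W (h z) x)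
    rootWord-∑ [] h x = refl
    rootWord-∑ ((i , j) ∷ W) h x = trans (∑-cong (λ a → rootWord-∑ W h _)) (∑-swap _)

    rootWord-nonneg : ∀ (W : List (Fin n × Fin n)) (f : Mat n → ℤ) → (∀ x → 0ℤ ≤ f x) → ∀ x → 0ℤ ≤ rootWord W f x
    rootWord-nonneg [] f 0≤f x = 0≤f x
    rootWord-nonneg ((i , j) ∷ W) f 0≤f x = ∑-nonneg λ a → rootWord-nonneg W f 0≤f _

    rootWord-mass : ∀ (W : List (Fin n × Fin n)) f → ∑ (rootWord W f) ≡ Q ^ length W *ℤ ∑ f
    rootWord-mass [] f = sym (ℤ.*-identityˡ _)
    rootWord-mass ((i , j) ∷ W) f = trans (∑-swap (λ x a → rootWord W f (act i (a ∙ e j) x)))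
      (trans (∑-cong (λ a → Act.∑-▹ i (a ∙ e j) (rootWord W f))) (trans (∑-const Carrier _)
      (trans (cong (Q *ℤ_) (rootWord-mass W f)) (sym (ℤ.*-assoc Q (Q ^ length W) (∑ f))))))

    0≤pow : ∀ k → 0ℤ ≤ Q ^ k
    0≤pow zero = ℤᵇ.+≤+ ℕ.z≤n
    0≤pow (suc k) = *-nonneg {Q} {Q ^ k} 0≤Q (0≤pow k)

    -- Split `b` into point masses; right translation by `adj x` turns each into a walk from the
    -- identity, to which `density` applies.
    rootWord-sup : ∀ x → det x ≡ 1# → D *ℤ rootWord W b x ≤ (+ 2) ^ m *ℤ L *ℤ B
    rootWord-sup x dx = begin
      D *ℤ rootWord W b x
        ≡⟨ cong (D *ℤ_) (trans (rootWord-cong W (λ y → trans (sym (∑-δ* y b)) (∑-cong (λ z → trans (ℤ.*-comm (δ z y) (b z)) (cong (b z *ℤ_) (δ-sym z y))))) x)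
             (trans (rootWord-∑ W (λ z y → b z *ℤ δ y z) x) (∑-cong (λ z → rootWord-* W (b z) (λ y → δ y z) x)))) ⟩
      D *ℤ ∑ (λ z → b z *ℤ rootWord W (λ y → δ y z) x) ≡⟨ sym (∑-* D (λ z → b z *ℤ rootWord W (λ y → δ y z) x)) ⟩
      ∑ (λ z → D *ℤ (b z *ℤ rootWord W (λ y → δ y z) x)) ≡⟨ ∑-cong (λ z → trans (shuffle D (b z) (rootWord W (λ y → δ y z) x)) (cong (λ t → b z *ℤ (D *ℤ t)) (to-Id z))) ⟩
      ∑ (λ z → b z *ℤ (D *ℤ rootWord W (λ y → δ y (z *M adj x)) (Id n))) ≤⟨ ∑-mono (λ z → *-monoˡ (0≤b z) (density m (z *M adj x))) ⟩
      ∑ (λ z → b z *ℤ ((+ 2) ^ m *ℤ L)) ≡⟨ trans (∑-*ʳ b ((+ 2) ^ m *ℤ L)) (ℤ.*-comm B ((+ 2) ^ m *ℤ L)) ⟩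
      (+ 2) ^ m *ℤ L *ℤ B ∎
      where
      open ℤ.≤-Reasoning
      shuffle : ∀ a b c → a *ℤ (b *ℤ c) ≡ b *ℤ (a *ℤ c)
      shuffle = solve-∀
      to-Id : ∀ z → rootWord W (λ y → δ y z) x ≡ rootWord W (λ y → δ y (z *M adj x)) (Id n)
      to-Id z = trans (cong (rootWord W (λ y → δ y z)) (sym (*M-identityˡ x))) (trans (rootWord-translate W (λ y → δ y z) (Id n) x)
        (rootWord-cong W (λ y → δ-cong (λ eq → trans (sym (*M-cancelʳ y x dx)) (cong (_*M adj x) eq)) (λ eq → trans (cong (_*M x) eq) (*M-cancelʳ′ z x dx))) (Id n)))

    T-sup : ∀ x → det x ≡ 1# → D *ℤ T (rootWord W b) x ≤ (+ 2) ^ m *ℤ L *ℤ B *ℤ C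
    T-sup x dx = begin
      D *ℤ T f x ≡⟨ sym (∑-* D (λ y → c y *ℤ f (x *M adj y))) ⟩
      ∑ (λ y → D *ℤ (c y *ℤ f (x *M adj y))) ≤⟨ ∑-mono le ⟩
      ∑ (λ y → c y *ℤ M) ≡⟨ trans (∑-*ʳ c M) (ℤ.*-comm C M) ⟩
      M *ℤ C ∎
      where
      open ℤ.≤-Reasoning
      f = rootWord W b
      M = (+ 2) ^ m *ℤ L *ℤ B
      shuffle : ∀ a b c → a *ℤ (b *ℤ c) ≡ b *ℤ (a *ℤ c)
      shuffle = solve-∀
      le : ∀ y → D *ℤ (c y *ℤ f (x *M adj y)) ≤ c y *ℤ M
      le y = subst (_≤ c y *ℤ M) (shuffle (c y) D (f (x *M adj y))) (cases (det y ≟ 1#))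
        where
        cases : Dec (det y ≡ 1#) → c y *ℤ (D *ℤ f (x *M adj y)) ≤ c y *ℤ M
        cases (yes dy) = *-monoˡ (0≤c y) (rootWord-sup (x *M adj y) (trans (det-* x (adj y)) (trans (cong₂ _*_ dx (det-adj y dy)) (*-identityˡ 1#))))
        cases (no ¬dy) = ℤ.≤-reflexive (trans (cong (_*ℤ (D *ℤ f (x *M adj y))) (c-SL y ¬dy)) (trans (ℤ.*-zeroˡ (D *ℤ f (x *M adj y)))
          (sym (trans (cong (_*ℤ M) (c-SL y ¬dy)) (ℤ.*-zeroˡ M)))))

    ∑T : ∀ f → ∑ (λ x → γ x *ℤ T f x) ≡ ∑ (λ y → c y *ℤ ∑ (λ x → γ x *ℤ f (x *M adj y)))
    ∑T f = trans (∑-cong (λ x → trans (sym (∑-* (γ x) (λ y → c y *ℤ f (x *M adj y)))) (∑-cong (λ y → shuffle (γ x) (c y) (f (x *M adj y))))))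
      (trans (∑-swap (λ x y → c y *ℤ (γ x *ℤ f (x *M adj y)))) (∑-cong (λ y → ∑-* (c y) (λ x → γ x *ℤ f (x *M adj y)))))
      where
      shuffle : ∀ a b c → a *ℤ (b *ℤ c) ≡ b *ℤ (a *ℤ c)
      shuffle = solve-∀

    T-mass : ∑ (λ x → γ x *ℤ T (rootWord W b) x) ≤ C *ℤ (L *ℤ B)
    T-mass = begin
      ∑ (λ x → γ x *ℤ T f x) ≡⟨ ∑T f ⟩
      ∑ (λ y → c y *ℤ ∑ (λ x → γ x *ℤ f (x *M adj y)))
        ≤⟨ ∑-mono (λ y → *-monoˡ (0≤c y) (∑-mono (λ x → ℤ.≤-trans
             (*-monoʳ (rootWord-nonneg W b 0≤b (x *M adj y)) ([]?≤1 (det x ≟ 1#))) (ℤ.≤-reflexive (ℤ.*-identityˡ (f (x *M adj y))))))) ⟩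
      ∑ (λ y → c y *ℤ ∑ (λ x → f (x *M adj y))) ≡⟨ ∑-cong (λ y → c-cong y (λ dy → trans (∑-*M-adj y dy f) (rootWord-mass W b))) ⟩
      ∑ (λ y → c y *ℤ (L *ℤ B)) ≡⟨ ∑-*ʳ c (L *ℤ B) ⟩
      C *ℤ (L *ℤ B) ∎
      where
      open ℤ.≤-Reasoning
      f = rootWord W b

    -- Supremum times mass: one factor `T f x` is bounded by `T-sup`, the other is summed by
    -- `T-mass`.
    smoothed-energy : D *ℤ S₂ (rootWord W b) ≤ (+ 2) ^ m *ℤ L *ℤ B *ℤ C *ℤ (C *ℤ (L *ℤ B))
    smoothed-energy = begin
      D *ℤ S₂ f ≡⟨ sym (∑-* D (λ x → γ x *ℤ (T f x *ℤ T f x))) ⟩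
      ∑ (λ x → D *ℤ (γ x *ℤ (T f x *ℤ T f x))) ≤⟨ ∑-mono le ⟩
      ∑ (λ x → M *ℤ (γ x *ℤ T f x)) ≡⟨ ∑-* M (λ x → γ x *ℤ T f x) ⟩
      M *ℤ ∑ (λ x → γ x *ℤ T f x) ≤⟨ *-monoˡ 0≤M T-mass ⟩
      M *ℤ (C *ℤ (L *ℤ B)) ∎
      where
      open ℤ.≤-Reasoning
      f = rootWord W b
      M = (+ 2) ^ m *ℤ L *ℤ B *ℤ C
      0≤2^ : ∀ k → 0ℤ ≤ (+ 2) ^ k
      0≤2^ zero = ℤᵇ.+≤+ ℕ.z≤n
      0≤2^ (suc k) = *-nonneg {+ 2} {(+ 2) ^ k} (ℤᵇ.+≤+ ℕ.z≤n) (0≤2^ k)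
      0≤M : 0ℤ ≤ M
      0≤M = *-nonneg {(+ 2) ^ m *ℤ L *ℤ B} {C} (*-nonneg {(+ 2) ^ m *ℤ L} {B} (*-nonneg {(+ 2) ^ m} {L} (0≤2^ m) (0≤pow k)) 0≤B) 0≤C
      0≤T : ∀ x → 0ℤ ≤ T f x
      0≤T x = ∑-nonneg λ y → *-nonneg (0≤c y) (rootWord-nonneg W b 0≤b (x *M adj y))
      arrange : ∀ d g t → d *ℤ (g *ℤ (t *ℤ t)) ≡ g *ℤ (d *ℤ t *ℤ t)
      arrange = solve-∀
      shuffle : ∀ a b c → a *ℤ (b *ℤ c) ≡ b *ℤ (a *ℤ c)
      shuffle = solve-∀
      le : ∀ x → D *ℤ (γ x *ℤ (T f x *ℤ T f x)) ≤ M *ℤ (γ x *ℤ T f x)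
      le x = begin
        D *ℤ (γ x *ℤ (T f x *ℤ T f x)) ≡⟨ arrange D (γ x) (T f x) ⟩
        γ x *ℤ (D *ℤ T f x *ℤ T f x) ≤⟨ cases (det x ≟ 1#) ⟩
        γ x *ℤ (M *ℤ T f x) ≡⟨ shuffle (γ x) M (T f x) ⟩
        M *ℤ (γ x *ℤ T f x) ∎
        where
        cases : (d : Dec (det x ≡ 1#)) → [ d ]? *ℤ (D *ℤ T f x *ℤ T f x) ≤ [ d ]? *ℤ (M *ℤ T f x)
        cases (yes dx) = *-monoˡ {D *ℤ T f x *ℤ T f x} {M *ℤ T f x} {1ℤ} (ℤᵇ.+≤+ ℕ.z≤n) (*-monoʳ {D *ℤ T f x} {M} (0≤T x) (T-sup x dx))
        cases (no _) = ℤ.≤-reflexive (trans (ℤ.*-zeroˡ (D *ℤ T f x *ℤ T f x)) (sym (ℤ.*-zeroˡ (M *ℤ T f x))))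

    Q²^≡ : ∀ k → Q²^ k ≡ Q ^ k *ℤ Q ^ k
    Q²^≡ zero = refl
    Q²^≡ (suc k) = trans (cong (Q *ℤ Q *ℤ_) (Q²^≡ k)) (arrange Q (Q ^ k))
      where
      arrange : ∀ q x → q *ℤ q *ℤ (x *ℤ x) ≡ q *ℤ x *ℤ (q *ℤ x)
      arrange = solve-∀

    pow-pos : ∀ k → 0ℤ ℤᵇ.< Q ^ k
    pow-pos zero = ℤᵇ.+<+ (ℕ.s≤s ℕ.z≤n)
    pow-pos (suc k) = subst (ℤᵇ._< Q *ℤ Q ^ k) (ℤ.*-zeroʳ Q) (ℤ.*-monoˡ-<-pos Q {{card-pos 0#}} (pow-pos k))

    -- After division by `D *ℤ N`, the energy is at most 2^m (|B||C|)² / q^(n²-1), as for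
    -- equidistributed products, plus k |SL_n||B||C| / q^(n-1) from the k smoothing steps.
    energy-bound : D *ℤ (N *ℤ S₂ b) ≤ N *ℤ ((+ 2) ^ m *ℤ (B *ℤ C *ℤ (B *ℤ C))) +ℤ D *ℤ (+ k *ℤ (G *ℤ C *ℤ (Q *ℤ B)))
    energy-bound = ℤ.*-cancelˡ-≤-pos _ _ L {{positive (pow-pos k)}} (ℤ.*-cancelˡ-≤-pos _ _ L {{positive (pow-pos k)}} (begin
      L *ℤ (L *ℤ (D *ℤ (N *ℤ S₂ b))) ≡⟨ arrange₁ L D N (S₂ b) ⟩
      D *ℤ (N *ℤ (L *ℤ L *ℤ S₂ b)) ≡⟨ cong (λ p → D *ℤ (N *ℤ (p *ℤ S₂ b))) (sym (Q²^≡ k)) ⟩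
      D *ℤ (N *ℤ (Q²^ k *ℤ S₂ b)) ≤⟨ *-monoˡ (0≤pow (dim m)) (rootWord-S₂ W b) ⟩
      D *ℤ (N *ℤ S₂ f +ℤ + k *ℤ (G *ℤ C *ℤ (Q *ℤ (Q²^ k *ℤ ‖ b ‖²))))
        ≡⟨ cong₂ (λ p s → D *ℤ (N *ℤ S₂ f +ℤ + k *ℤ (G *ℤ C *ℤ (Q *ℤ (p *ℤ s))))) (Q²^≡ k) (∑-cong b-idem) ⟩
      D *ℤ (N *ℤ S₂ f +ℤ + k *ℤ (G *ℤ C *ℤ (Q *ℤ (L *ℤ L *ℤ B)))) ≡⟨ arrange₂ D N (S₂ f) (+ k) (G *ℤ C) Q L B ⟩
      N *ℤ (D *ℤ S₂ f) +ℤ L *ℤ (L *ℤ (D *ℤ (+ k *ℤ (G *ℤ C *ℤ (Q *ℤ B))))) 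
        ≤⟨ ℤ.+-monoˡ-≤ (L *ℤ (L *ℤ (D *ℤ (+ k *ℤ (G *ℤ C *ℤ (Q *ℤ B)))))) (*-monoˡ {c = N} (ℤᵇ.+≤+ ℕ.z≤n) smoothed-energy) ⟩
      N *ℤ ((+ 2) ^ m *ℤ L *ℤ B *ℤ C *ℤ (C *ℤ (L *ℤ B))) +ℤ L *ℤ (L *ℤ (D *ℤ (+ k *ℤ (G *ℤ C *ℤ (Q *ℤ B)))))
        ≡⟨ arrange₃ N ((+ 2) ^ m) L B C (D *ℤ (+ k *ℤ (G *ℤ C *ℤ (Q *ℤ B)))) ⟩
      L *ℤ (L *ℤ (N *ℤ ((+ 2) ^ m *ℤ (B *ℤ C *ℤ (B *ℤ C))) +ℤ D *ℤ (+ k *ℤ (G *ℤ C *ℤ (Q *ℤ B))))) ∎))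
      where
      open ℤ.≤-Reasoning
      f = rootWord W b
      arrange₁ : ∀ l d n s → l *ℤ (l *ℤ (d *ℤ (n *ℤ s))) ≡ d *ℤ (n *ℤ (l *ℤ l *ℤ s))
      arrange₁ = solve-∀
      arrange₂ : ∀ d n s k g q l b → d *ℤ (n *ℤ s +ℤ k *ℤ (g *ℤ (q *ℤ (l *ℤ l *ℤ b)))) ≡ n *ℤ (d *ℤ s) +ℤ l *ℤ (l *ℤ (d *ℤ (k *ℤ (g *ℤ (q *ℤ b)))))
      arrange₂ = solve-∀
      arrange₃ : ∀ n t l b c z → n *ℤ (t *ℤ l *ℤ b *ℤ c *ℤ (c *ℤ (l *ℤ b))) +ℤ l *ℤ (l *ℤ z) ≡ l *ℤ (l *ℤ (n *ℤ (t *ℤ (b *ℤ c *ℤ (b *ℤ c))) +ℤ z))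
      arrange₃ = solve-∀

    total : ∑ (λ x → γ x *ℤ T b x) ≡ B *ℤ C
    total = trans (∑T b) (trans (∑-cong (λ y → c-cong y (λ dy → trans (∑-cong (term y dy)) (∑-*M-adj y dy b))))
      (trans (∑-*ʳ c B) (ℤ.*-comm C B)))
      where
      term : ∀ y → det y ≡ 1# → ∀ x → γ x *ℤ b (x *M adj y) ≡ b (x *M adj y)
      term y dy x with det x ≟ 1#
      ... | yes _ = ℤ.*-identityˡ (b (x *M adj y))
      ... | no ¬dx = trans (ℤ.*-zeroˡ (b (x *M adj y))) (sym (b-SL (x *M adj y) (λ d → ¬dx (trans (sym (*-identityʳ _))
        (trans (cong (det x *_) (sym (det-adj y dy))) (trans (sym (det-* x (adj y))) d))))))

    -- The indicator function of the product set BC.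
    s : Mat n → ℤ
    s z with (γ z *ℤ T b z) ℤ.≟ 0ℤ
    ... | yes _ = 0ℤ
    ... | no _ = 1ℤ

    s-idem : ∀ z → s z *ℤ s z ≡ s z
    s-idem z with (γ z *ℤ T b z) ℤ.≟ 0ℤ
    ... | yes _ = refl
    ... | no _ = refl

    s-support : ∀ z → s z *ℤ (γ z *ℤ T b z) ≡ γ z *ℤ T b z
    s-support z with (γ z *ℤ T b z) ℤ.≟ 0ℤ
    ... | yes eq = trans (ℤ.*-zeroˡ (γ z *ℤ T b z)) (sym eq)
    ... | no _ = ℤ.*-identityˡ (γ z *ℤ T b z)

    -- Cauchy-Schwarz for the representation function against the indicator of its support.
    product-set-energy : B *ℤ C *ℤ (B *ℤ C) ≤ ∑ s *ℤ S₂ b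
    product-set-energy = begin
      B *ℤ C *ℤ (B *ℤ C) ≡⟨ sym (cong₂ _*ℤ_ total′ total′) ⟩
      ∑ (λ z → s z *ℤ (γ z *ℤ T b z)) *ℤ ∑ (λ z → s z *ℤ (γ z *ℤ T b z)) ≤⟨ cauchy-schwarz s (λ z → γ z *ℤ T b z) ⟩
      ∑ (λ z → s z *ℤ s z) *ℤ ∑ (λ z → γ z *ℤ T b z *ℤ (γ z *ℤ T b z)) ≡⟨ cong₂ _*ℤ_ (∑-cong s-idem) (∑-cong γ-idem) ⟩
      ∑ s *ℤ S₂ b ∎
      where
      open ℤ.≤-Reasoning
      total′ : ∑ (λ z → s z *ℤ (γ z *ℤ T b z)) ≡ B *ℤ C
      total′ = trans (∑-cong s-support) total
      γ-idem : ∀ z → γ z *ℤ T b z *ℤ (γ z *ℤ T b z) ≡ γ z *ℤ (T b z *ℤ T b z)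
      γ-idem z with det z ≟ 1#
      ... | yes _ = arrange (T b z)
        where
        arrange : ∀ t → 1ℤ *ℤ t *ℤ (1ℤ *ℤ t) ≡ 1ℤ *ℤ (t *ℤ t)
        arrange = solve-∀
      ... | no _ = arrange (T b z)
        where
        arrange : ∀ t → 0ℤ *ℤ t *ℤ (0ℤ *ℤ t) ≡ 0ℤ *ℤ (t *ℤ t)
        arrange = solve-∀

    module InNaturals {d ν ε ρ θ β′ γ′ σ : ℕ} (D≡ : D ≡ + d) (N≡ : N ≡ + ν) (E≡ : S₂ b ≡ + ε) (G≡ : G ≡ + ρ)
      (t≡ : (+ 2) ^ m ≡ + θ) (B≡ : B ≡ + β′) (C≡ : C ≡ + γ′) (S≡ : ∑ s ≡ + σ) where
      energy-bound-ℕ : d ℕ.* (ν ℕ.* ε) ℕ.≤ ν ℕ.* (θ ℕ.* (β′ ℕ.* γ′ ℕ.* (β′ ℕ.* γ′))) ℕ.+ d ℕ.* (k ℕ.* (ρ ℕ.* γ′ ℕ.* (q ℕ.* β′)))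
      energy-bound-ℕ = to-ℕ (D≡ ⟨*⟩ (N≡ ⟨*⟩ E≡))
        ((N≡ ⟨*⟩ (t≡ ⟨*⟩ ((B≡ ⟨*⟩ C≡) ⟨*⟩ (B≡ ⟨*⟩ C≡)))) ⟨+⟩ (D≡ ⟨*⟩ (nat k ⟨*⟩ ((G≡ ⟨*⟩ C≡) ⟨*⟩ (nat q ⟨*⟩ B≡)))))
        energy-bound

      product-set-energy-ℕ : β′ ℕ.* γ′ ℕ.* (β′ ℕ.* γ′) ℕ.≤ σ ℕ.* ε
      product-set-energy-ℕ = to-ℕ ((B≡ ⟨*⟩ C≡) ⟨*⟩ (B≡ ⟨*⟩ C≡)) (S≡ ⟨*⟩ E≡) product-set-energy

-- Additive convolution by a function of the determinant

module SumSets where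
  open import Data.Nat.Base as ℕ using (ℕ; zero; suc)
  open import Data.Fin.Base as Fin using (Fin; zero; suc)
  import Data.Fin.Properties as Fin
  open import Data.Vec.Base using (Vec; []; _∷_; lookup; tabulate; _[_]≔_)
  import Data.Vec.Properties as Vec
  open import Data.List.Base as List using (List; []; _∷_)
  open import Data.Integer.Base using (ℤ; +_; 0ℤ; 1ℤ; _≤_; nonNegative; Positive; positive) renaming (_+_ to _+ℤ_; _*_ to _*ℤ_; _-_ to _-ℤ_; -_ to -ℤ_)
  import Data.Integer.Base as ℤᵇ
  import Data.Integer.Properties as ℤ
  open import Data.Integer.Tactic.RingSolver using (solve-∀)
  open import Data.Product.Base using (_,_; proj₁; proj₂)
  open import Function.Base using (_∘_)
  open import Relation.Nullary.Decidable using (Dec; yes; no; ¬?; decidable-stable)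
  open import Relation.Nullary.Negation using (contradiction)
  open import Relation.Binary.PropositionalEquality
  open FiniteSums
  open FieldAlgebra
  open Determinants
  open MatrixProducts
  open RowOperations
  open MatrixSums
  open RootSubgroups

  module AdditiveBound {q : ℕ} (F : FiniteField q) (m : ℕ) where
    open FiniteField F
    open FieldSolver F
    open Matrices F
    open Determinant F
    open MatrixAlgebra F
    open RowAction F
    open SumsOver F
    open RootWords F using (entry-root; entry-root-≢)

    n = suc m
    P = Q -ℤ 1ℤ

    0≤P : 0ℤ ≤ P
    0≤P = ℤ.i≤j⇒0≤j-i (lemma q (from-card (card-pos {Carrier} 0#)))
      where
      from-card : Positive (+ q) → Positive (+ q)
      from-card p = p
      lemma : ∀ q → Positive (+ q) → 1ℤ ≤ + q
      lemma (suc q) _ = ℤᵇ.+≤+ (ℕ.s≤s ℕ.z≤n)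

    P≤Q : P ≤ Q
    P≤Q = ℤ.i≤j⇒i-k≤j {i = Q} 1ℤ ℤ.≤-refl

    P-pos : Positive P
    P-pos = ℤᵇ.positive (ℤ.≤∧≢⇒< 0≤P (λ P≡0 → 0≢1 (collapse q size (ℤ.i-j≡0⇒i≡j Q 1ℤ (sym P≡0)) 0# 1#)))
      where
      open import Function.Bundles using (_↔_; Inverse)
      collapse : ∀ q → Carrier ↔ Fin q → + q ≡ 1ℤ → ∀ x y → x ≡ y
      collapse (suc zero) s _ x y = trans (sym (Inverse.strictlyInverseʳ s x)) (trans (cong (Inverse.from s) (one _ _)) (Inverse.strictlyInverseʳ s y))
        where
        one : ∀ (i j : Fin 1) → i ≡ j
        one zero zero = refl

    positive⇒nonZero : ∀ {i} → Positive i → ℤᵇ.NonZero i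
    positive⇒nonZero {+ suc _} _ = _

    -- Takes the value `P - 1` at 1, -1 at the other nonzero elements and 0 at 0. Both the zero
    -- total and the value at 0 enter the cancellation over linear forms.
    ω : Carrier → ℤ
    ω t = P *ℤ δ t 1# -ℤ (1ℤ -ℤ δ t 0#)

    ω-0 : ω 0# ≡ 0ℤ
    ω-0 = trans (cong₂ (λ a b → P *ℤ a -ℤ (1ℤ -ℤ b)) ([]?-no (0# ≟F 1#) 0≢1) ([]?-yes (0# ≟F 0#) refl)) (zero′ P)
      where
      zero′ : ∀ p → p *ℤ 0ℤ -ℤ (1ℤ -ℤ 1ℤ) ≡ 0ℤ
      zero′ = solve-∀

    ∑-δ-sub : ∀ (a : Carrier) → ∑ (λ θ → 1ℤ -ℤ δ θ a) ≡ P
    ∑-δ-sub a = trans (∑-- (λ _ → 1ℤ) (λ θ → δ θ a)) (cong₂ _-ℤ_ (trans (∑-const Carrier 1ℤ) (ℤ.*-identityʳ Q)) (∑-δ a))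

    ∑ω : ∑ ω ≡ 0ℤ
    ∑ω = trans (∑-- (λ t → P *ℤ δ t 1#) (λ t → 1ℤ -ℤ δ t 0#))
      (trans (cong₂ _-ℤ_ (trans (∑-* P (λ t → δ t 1#)) (trans (cong (P *ℤ_) (∑-δ 1#)) (ℤ.*-identityʳ P))) (∑-δ-sub 0#)) (ℤ.i≡j⇒i-j≡0 {P} refl))

    ∑-mul : ∀ θ → θ ≢ 0# → (f : Carrier → ℤ) → ∑ (λ t → f (t * θ)) ≡ ∑ f
    ∑-mul θ θ≢0 = ∑-bij (_* θ) (_* θ⁻¹)
      (λ t → trans (*-assoc t θ⁻¹ θ) (trans (cong (t *_) (trans (*-comm θ⁻¹ θ) θθ⁻¹)) (*-identityʳ t)))
      (λ t → trans (*-assoc t θ θ⁻¹) (trans (cong (t *_) θθ⁻¹) (*-identityʳ t)))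
      where
      θ⁻¹ = proj₁ (inverse θ θ≢0)
      θθ⁻¹ = proj₂ (inverse θ θ≢0)

    ∑ω-dilate : ∀ t → ∑ (λ θ → ω (θ * t)) ≡ 0ℤ
    ∑ω-dilate t with t ≟ 0#
    ... | yes refl = ∑-0 (λ θ → trans (cong ω (zeroʳ θ)) ω-0)
    ... | no t≢0 = trans (∑-mul t t≢0 ω) ∑ω

    ∑-∙ : ∀ {k} θ → θ ≢ 0# → (f : Row k → ℤ) → ∑ (λ z → f (θ ∙ z)) ≡ ∑ f
    ∑-∙ θ θ≢0 = ∑-bij (θ ∙_) (θ⁻¹ ∙_) (inv θ θ⁻¹ (proj₂ (inverse θ θ≢0))) (inv θ⁻¹ θ (trans (*-comm θ⁻¹ θ) (proj₂ (inverse θ θ≢0))))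
      where
      θ⁻¹ = proj₁ (inverse θ θ≢0)
      inv : ∀ a b → a * b ≡ 1# → ∀ z → a ∙ (b ∙ z) ≡ z
      inv a b ab z = lookup-ext λ i → trans (lookup-∙ a (b ∙ z) i) (trans (cong (a *_) (lookup-∙ b z i))
        (trans (sym (*-assoc a b _)) (trans (cong (_* lookup z i) ab) (*-identityˡ _))))

    -- A linear form takes all nonzero values equally often, and ω has mean zero over them.
    ∑ω-linear : ∀ (κ : Row n) → ∑ (λ z → ω (Σᶠ (λ s → lookup z s * lookup κ s))) ≡ 0ℤ
    ∑ω-linear κ = ℤ.*-cancelˡ-≡ P Y 0ℤ {{positive⇒nonZero P-pos}} (trans PY (sym (ℤ.*-zeroʳ P)))
      where
      open ≡-Reasoning
      ℓ : Row n → Carrier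
      ℓ z = Σᶠ (λ s → lookup z s * lookup κ s)
      Y = ∑ (λ z → ω (ℓ z))
      ℓ-∙ : ∀ θ z → ℓ (θ ∙ z) ≡ θ * ℓ z
      ℓ-∙ θ z = trans (Σᶠ-cong (λ s → trans (cong (_* lookup κ s) (lookup-∙ θ z s)) (*-assoc θ (lookup z s) (lookup κ s))))
        (Σᶠ-* θ (λ s → lookup z s * lookup κ s))
      dilated : ∀ θ → ∑ (λ z → ω (θ * ℓ z)) ≡ (1ℤ -ℤ δ θ 0#) *ℤ Y
      dilated θ with θ ≟F 0#
      ... | yes refl = trans (∑-0 (λ z → trans (cong ω (zeroˡ (ℓ z))) ω-0)) (sym (ℤ.*-zeroˡ Y))
      ... | no θ≢0 = trans (∑-cong (λ z → cong ω (sym (ℓ-∙ θ z)))) (trans (∑-∙ θ θ≢0 (λ z → ω (ℓ z))) (sym (ℤ.*-identityˡ Y)))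
      PY : P *ℤ Y ≡ 0ℤ
      PY = begin
        P *ℤ Y ≡⟨ sym (trans (∑-*ʳ (λ θ → 1ℤ -ℤ δ θ 0#) Y) (cong (_*ℤ Y) (∑-δ-sub 0#))) ⟩
        ∑ (λ θ → (1ℤ -ℤ δ θ 0#) *ℤ Y) ≡⟨ ∑-cong (λ θ → sym (dilated θ)) ⟩
        ∑ (λ θ → ∑ (λ z → ω (θ * ℓ z))) ≡⟨ ∑-swap (λ θ z → ω (θ * ℓ z)) ⟩
        ∑ (λ z → ∑ (λ θ → ω (θ * ℓ z))) ≡⟨ ∑-0 (λ z → ∑ω-dilate (ℓ z)) ⟩
        0ℤ ∎

    -- Gaussian elimination by multiples of the pivot row `i`, composed of single operations so that
    -- `det-act` applies to each.
    eliminate : Fin n → (Fin n → Carrier) → List (Fin n) → Mat n → Mat n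
    eliminate i μ [] x = x
    eliminate i μ (l ∷ ls) x with l Fin.≟ i
    ... | yes _ = eliminate i μ ls x
    ... | no _ = act l (μ l ∙ e i) (eliminate i μ ls x)

    det-eliminate : ∀ i μ ls x → det (eliminate i μ ls x) ≡ det x
    det-eliminate i μ [] x = refl
    det-eliminate i μ (l ∷ ls) x with l Fin.≟ i
    ... | yes _ = det-eliminate i μ ls x
    ... | no _ = trans (det-act l (μ l ∙ e i) (eliminate i μ ls x)) (det-eliminate i μ ls x)

    -- The total multiple of the pivot row that reaches row `r`.
    multiplier : (Fin n → Carrier) → List (Fin n) → Fin n → Carrier
    multiplier μ [] r = 0#
    multiplier μ (l ∷ ls) r = κ r l * μ l + multiplier μ ls r

    entry-eliminate-pivot : ∀ i μ ls x s → entry (eliminate i μ ls x) i s ≡ entry x i s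
    entry-eliminate-pivot i μ [] x s = refl
    entry-eliminate-pivot i μ (l ∷ ls) x s with l Fin.≟ i
    ... | yes _ = entry-eliminate-pivot i μ ls x s
    ... | no l≢i = trans (entry-root-≢ {i = l} i (μ l) (eliminate i μ ls x) {i} s (l≢i ∘ sym)) (entry-eliminate-pivot i μ ls x s)

    entry-eliminate : ∀ i μ → μ i ≡ 0# → ∀ ls x r s → entry (eliminate i μ ls x) r s ≡ entry x r s + multiplier μ ls r * entry x i s
    entry-eliminate i μ μi [] x r s = solve 2 (λ x y → x := x :+ con (+ 0) :* y) refl _ _
    entry-eliminate i μ μi (l ∷ ls) x r s with l Fin.≟ i
    ... | yes refl = trans (entry-eliminate i μ μi ls x r s) (cong (λ c → entry x r s + c * entry x i s)
      (sym (trans (cong (λ c → κ r i * c + multiplier μ ls r) μi) (solve 2 (λ k c → k :* con (+ 0) :+ c := c) refl _ _))))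
    ... | no l≢i = trans (entry-root l≢i (μ l) (eliminate i μ ls x) r s)
      (trans (cong₂ (λ a b → a + κ r l * (μ l * b)) (entry-eliminate i μ μi ls x r s) (entry-eliminate-pivot i μ ls x s))
      (solve 5 (λ x c y k m → (x :+ c :* y) :+ k :* (m :* y) := x :+ (k :* m :+ c) :* y) refl _ _ _ _ _))

    multiplier-all : ∀ μ r → multiplier μ (List.allFin n) r ≡ μ r
    multiplier-all μ r = trans (go n (λ i → i)) (Σᶠ-κ r μ)
      where
      go : ∀ k (f : Fin k → Fin n) → multiplier μ (List.tabulate f) r ≡ Σᶠ (λ j → κ r (f j) * μ (f j))
      go zero f = refl
      go (suc k) f = cong (_+_ (κ r (f zero) * μ (f zero))) (go k (f ∘ suc))

    outer : (Fin n → Carrier) → Row n → Mat n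
    outer w η = mk λ r s → w r * lookup η s

    τ : Mat n → ℤ
    τ z = ω (det z)

    -- Eliminating with the pivot row i turns x + w ηᵀ into a matrix in which only row i depends on η.
    ∑τ-outer : ∀ x w i → w i ≢ 0# → ∑ (λ η → τ (x +M outer w η)) ≡ 0ℤ
    ∑τ-outer x w i wi≢0 = begin
      ∑ (λ η → ω (det (x +M outer w η))) ≡⟨ ∑-cong (λ η → cong ω (trans (sym (det-eliminate i μ (List.allFin n) (x +M outer w η)))
        (trans (cong det (eliminated η)) (trans (det-update y i (lookup x i ⊹ w i ∙ η)) (Σᶠ-cong (λ s → cong (lookup (lookup x i ⊹ w i ∙ η) s *_)
          (sym (Vec.lookup∘tabulate (λ s → entry (adj y) s i) s)))))))) ⟩
      ∑ (λ η → f (lookup x i ⊹ w i ∙ η)) ≡⟨ ∑-∙ (w i) wi≢0 (λ η → f (lookup x i ⊹ η)) ⟩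
      ∑ (λ η → f (lookup x i ⊹ η)) ≡⟨ ∑-bij (lookup x i ⊹_) ((⊖ lookup x i) ⊹_)
        (λ z → trans (sym (⊹-assoc (lookup x i) (⊖ lookup x i) z)) (trans (cong (_⊹ z) (trans (⊹-comm (lookup x i) (⊖ lookup x i)) (⊹-inverseˡ (lookup x i)))) (⊹-identityˡ z)))
        (λ z → trans (sym (⊹-assoc (⊖ lookup x i) (lookup x i) z)) (trans (cong (_⊹ z) (⊹-inverseˡ (lookup x i))) (⊹-identityˡ z))) f ⟩
      ∑ f ≡⟨ ∑ω-linear (tabulate (λ s → entry (adj y) s i)) ⟩
      0ℤ ∎
      where
      open ≡-Reasoning
      w⁻¹ = proj₁ (inverse (w i) wi≢0)
      -- Chosen to cancel the `η` part of every other row against that of the pivot row; the mask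
      -- protects the pivot row.
      μ : Fin n → Carrier
      μ l = off i l * (- (w l * w⁻¹))
      μi : μ i ≡ 0#
      μi = trans (cong (_* (- (w i * w⁻¹))) (off-diag i)) (zeroˡ _)
      y = eliminate i μ (List.allFin n) x
      f : Row n → ℤ
      f z = ω (Σᶠ (λ s → lookup z s * lookup (tabulate (λ s → entry (adj y) s i)) s))
      entry-outer : ∀ η r s → entry (x +M outer w η) r s ≡ entry x r s + w r * lookup η s
      entry-outer η r s = trans (entry-+ x (outer w η) r s) (cong (_+_ (entry x r s)) (entry-mk (λ r s → w r * lookup η s) r s))
      entry-μ : ∀ z r s → entry (eliminate i μ (List.allFin n) z) r s ≡ entry z r s + μ r * entry z i s
      entry-μ z r s = trans (entry-eliminate i μ μi (List.allFin n) z r s) (cong (λ c → entry z r s + c * entry z i s) (multiplier-all μ r))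
      eliminated : ∀ η → eliminate i μ (List.allFin n) (x +M outer w η) ≡ y [ i ]≔ (lookup x i ⊹ w i ∙ η)
      eliminated η = mat-ext λ r s → trans (entry-μ (x +M outer w η) r s)
        (trans (cong₂ (λ a b → a + μ r * b) (entry-outer η r s) (entry-outer η i s)) (cases r s (r Fin.≟ i)))
        where
        cases : ∀ r s → Dec (r ≡ i) → (entry x r s + w r * lookup η s) + μ r * (entry x i s + w i * lookup η s) ≡ entry (y [ i ]≔ (lookup x i ⊹ w i ∙ η)) r s
        cases r s (yes refl) = trans (cong (λ c → (entry x i s + w i * lookup η s) + c * (entry x i s + w i * lookup η s)) μi)
          (trans (solve 1 (λ a → a :+ con (+ 0) :* a := a) refl _) (sym (trans (cong (λ v → lookup v s) (Vec.lookup∘update i y _))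
            (trans (lookup-⊹ (lookup x i) (w i ∙ η) s) (cong (_+_ (entry x i s)) (lookup-∙ (w i) η s))))))
        cases r s (no r≢i) = begin
          (entry x r s + w r * lookup η s) + μ r * (entry x i s + w i * lookup η s)
            ≡⟨ solve 6 (λ x w h m y v → (x :+ w :* h) :+ m :* (y :+ v :* h) := (x :+ m :* y) :+ (w :+ m :* v) :* h) refl _ _ _ _ _ _ ⟩
          (entry x r s + μ r * entry x i s) + (w r + μ r * w i) * lookup η s ≡⟨ cong (λ c → (entry x r s + μ r * entry x i s) + c * lookup η s) cancel ⟩
          (entry x r s + μ r * entry x i s) + 0# * lookup η s ≡⟨ solve 2 (λ a h → a :+ con (+ 0) :* h := a) refl _ _ ⟩
          entry x r s + μ r * entry x i s ≡⟨ sym (entry-μ x r s) ⟩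
          entry y r s ≡⟨ sym (cong (λ v → lookup v s) (Vec.lookup∘update′ r≢i y _)) ⟩
          entry (y [ i ]≔ (lookup x i ⊹ w i ∙ η)) r s ∎
          where
          cancel : w r + μ r * w i ≡ 0#
          cancel = begin
            w r + off i r * (- (w r * w⁻¹)) * w i ≡⟨ cong (λ o → w r + o * (- (w r * w⁻¹)) * w i) (off-off (r≢i ∘ sym)) ⟩
            w r + 1# * (- (w r * w⁻¹)) * w i ≡⟨ solve 3 (λ w i v → w :+ con (+ 1) :* (:- (w :* i)) :* v := w :+ :- (w :* (v :* i))) refl (w r) w⁻¹ (w i) ⟩
            w r + - (w r * (w i * w⁻¹)) ≡⟨ cong (λ c → w r + - (w r * c)) (proj₂ (inverse (w i) wi≢0)) ⟩
            w r + - (w r * 1#) ≡⟨ solve 1 (λ w → w :+ :- (w :* con (+ 1)) := con (+ 0)) refl (w r) ⟩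
            0# ∎

    scaleRow : Carrier → Mat n → Mat n
    scaleRow θ (r ∷ rs) = (θ ∙ r) ∷ rs

    det-scaleRow : ∀ θ z → det (scaleRow θ z) ≡ θ * det z
    det-scaleRow θ z@(r ∷ rs) = trans (det-update z zero (θ ∙ r))
      (trans (Σᶠ-cong (λ s → trans (cong (_* entry (adj z) s zero) (lookup-∙ θ r s)) (*-assoc θ (lookup r s) (entry (adj z) s zero))))
      (trans (Σᶠ-* θ (λ s → lookup r s * entry (adj z) s zero)) (cong (θ *_) (trans (adj-row z zero zero) (*-identityˡ _)))))

    G : ℤ
    G = ∑ {Mat n} γ

    ∣M∣ : ℤ
    ∣M∣ = + ∣ Mat n ∣F

    -- Scaling row 0 by `θ` maps determinant 1 bijectively to determinant `θ`.
    det-fibre : ∀ θ → θ ≢ 0# → ∑ {Mat n} (λ z → δ θ (det z)) ≡ G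
    det-fibre θ θ≢0 = begin
      ∑ (λ z → δ θ (det z)) ≡⟨ sym (∑-bij (scaleRow θ) (scaleRow θ⁻¹) (inv θ θ⁻¹ θθ⁻¹) (inv θ⁻¹ θ (trans (*-comm θ⁻¹ θ) θθ⁻¹)) (λ z → δ θ (det z))) ⟩
      ∑ (λ z → δ θ (det (scaleRow θ z))) ≡⟨ ∑-cong (λ z → []?-cong (θ ≟F det (scaleRow θ z)) (det z ≟ 1#)
        (λ eq → begin
          det z ≡⟨ sym (*-identityˡ _) ⟩
          1# * det z ≡⟨ cong (_* det z) (sym θθ⁻¹) ⟩
          θ * θ⁻¹ * det z ≡⟨ solve 3 (λ t i d → t :* i :* d := i :* (t :* d)) refl θ θ⁻¹ (det z) ⟩
          θ⁻¹ * (θ * det z) ≡⟨ cong (θ⁻¹ *_) (sym (trans eq (det-scaleRow θ z))) ⟩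
          θ⁻¹ * θ ≡⟨ trans (*-comm θ⁻¹ θ) θθ⁻¹ ⟩
          1# ∎)
        (λ eq → sym (trans (det-scaleRow θ z) (trans (cong (θ *_) eq) (*-identityʳ θ))))) ⟩
      G ∎
      where
      open ≡-Reasoning
      θ⁻¹ = proj₁ (inverse θ θ≢0)
      θθ⁻¹ = proj₂ (inverse θ θ≢0)
      inv : ∀ a b → a * b ≡ 1# → ∀ z → scaleRow a (scaleRow b z) ≡ z
      inv a b ab (r ∷ rs) = cong (_∷ rs) (lookup-ext λ i → trans (lookup-∙ a (b ∙ r) i) (trans (cong (a *_) (lookup-∙ b r i))
        (trans (sym (*-assoc a b _)) (trans (cong (_* lookup r i) ab) (*-identityˡ _)))))

    ∑-nonsingular : ∑ {Mat n} (λ z → 1ℤ -ℤ δ (det z) 0#) ≡ P *ℤ G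
    ∑-nonsingular = begin
      ∑ (λ z → 1ℤ -ℤ δ (det z) 0#) ≡⟨ ∑-cong (λ z → trans (sym (∑-δ* (det z) (λ θ → 1ℤ -ℤ δ θ 0#))) (∑-cong (λ θ → ℤ.*-comm (δ θ (det z)) (1ℤ -ℤ δ θ 0#)))) ⟩
      ∑ (λ z → ∑ (λ θ → (1ℤ -ℤ δ θ 0#) *ℤ δ θ (det z))) ≡⟨ ∑-swap (λ z θ → (1ℤ -ℤ δ θ 0#) *ℤ δ θ (det z)) ⟩
      ∑ (λ θ → ∑ (λ z → (1ℤ -ℤ δ θ 0#) *ℤ δ θ (det z))) ≡⟨ ∑-cong (λ θ → trans (∑-* (1ℤ -ℤ δ θ 0#) (λ z → δ θ (det z))) (cases θ)) ⟩
      ∑ (λ θ → (1ℤ -ℤ δ θ 0#) *ℤ G) ≡⟨ trans (∑-*ʳ (λ θ → 1ℤ -ℤ δ θ 0#) G) (cong (_*ℤ G) (∑-δ-sub 0#)) ⟩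
      P *ℤ G ∎
      where
      open ≡-Reasoning
      cases : ∀ θ → (1ℤ -ℤ δ θ 0#) *ℤ ∑ (λ z → δ θ (det z)) ≡ (1ℤ -ℤ δ θ 0#) *ℤ G
      cases θ with θ ≟F 0#
      ... | yes _ = trans (ℤ.*-zeroˡ (∑ {Mat n} (λ z → δ θ (det z)))) (sym (ℤ.*-zeroˡ G))
      ... | no θ≢0 = cong (1ℤ *ℤ_) (det-fibre θ θ≢0)

    -- The nonzero fibres of the determinant are disjoint and of equal size; this bounds |SL_n|
    -- without its order formula.
    P*G≤∣M∣ : P *ℤ G ≤ ∣M∣
    P*G≤∣M∣ = ℤ.≤-trans (ℤ.≤-reflexive (sym ∑-nonsingular)) (ℤ.≤-trans (∑-mono (λ z → ℤ.i≤j⇒i-k≤j {i = 1ℤ} (δ (det z) 0#) {{nonNegative (0≤[]? (det z ≟F 0#))}} ℤ.≤-refl))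
      (ℤ.≤-reflexive (trans (∑-const (Mat n) 1ℤ) (ℤ.*-identityʳ ∣M∣))))

    -- The value `P - 1` on one fibre and -1 on `P - 1` further fibres of size `G` give exactly
    -- `P (P - 1) G`.
    τ-norm : ‖ τ ‖² ≤ Q *ℤ Q *ℤ G
    τ-norm = begin
      ∑ (λ z → ω (det z) *ℤ ω (det z)) ≡⟨ ∑-cong (λ z → square z (det z ≟ 1#) (det z ≟F 1#) (det z ≟F 0#)) ⟩
      ∑ (λ z → (P *ℤ P -ℤ + 2 *ℤ P) *ℤ γ z +ℤ (1ℤ -ℤ δ (det z) 0#))
        ≡⟨ trans (∑-+ (λ z → (P *ℤ P -ℤ + 2 *ℤ P) *ℤ γ z) (λ z → 1ℤ -ℤ δ (det z) 0#)) (cong₂ _+ℤ_ (∑-* (P *ℤ P -ℤ + 2 *ℤ P) γ) ∑-nonsingular) ⟩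
      (P *ℤ P -ℤ + 2 *ℤ P) *ℤ G +ℤ P *ℤ G ≡⟨ simplify P G ⟩
      P *ℤ P *ℤ G -ℤ P *ℤ G ≤⟨ ℤ.i≤j⇒i-k≤j {i = P *ℤ P *ℤ G} (P *ℤ G) {{nonNegative (*-nonneg {P} {G} 0≤P 0≤G)}} ℤ.≤-refl ⟩
      P *ℤ P *ℤ G ≤⟨ *-monoʳ {P *ℤ P} {Q *ℤ Q} {G} 0≤G (ℤ.≤-trans (*-monoˡ {P} {Q} {P} 0≤P P≤Q) (*-monoʳ {P} {Q} {Q} (ℤᵇ.+≤+ ℕ.z≤n) P≤Q)) ⟩
      Q *ℤ Q *ℤ G ∎
      where
      open ℤ.≤-Reasoning
      0≤G : 0ℤ ≤ G
      0≤G = ∑-nonneg 0≤γ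
      simplify : ∀ p g → (p *ℤ p -ℤ + 2 *ℤ p) *ℤ g +ℤ p *ℤ g ≡ p *ℤ p *ℤ g -ℤ p *ℤ g
      simplify = solve-∀
      s₁ : ∀ p → (p *ℤ 1ℤ -ℤ (1ℤ -ℤ 0ℤ)) *ℤ (p *ℤ 1ℤ -ℤ (1ℤ -ℤ 0ℤ)) ≡ (p *ℤ p -ℤ + 2 *ℤ p) *ℤ 1ℤ +ℤ (1ℤ -ℤ 0ℤ)
      s₁ = solve-∀
      s₂ : ∀ p → (p *ℤ 0ℤ -ℤ (1ℤ -ℤ 1ℤ)) *ℤ (p *ℤ 0ℤ -ℤ (1ℤ -ℤ 1ℤ)) ≡ (p *ℤ p -ℤ + 2 *ℤ p) *ℤ 0ℤ +ℤ (1ℤ -ℤ 1ℤ)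
      s₂ = solve-∀
      s₃ : ∀ p → (p *ℤ 0ℤ -ℤ (1ℤ -ℤ 0ℤ)) *ℤ (p *ℤ 0ℤ -ℤ (1ℤ -ℤ 0ℤ)) ≡ (p *ℤ p -ℤ + 2 *ℤ p) *ℤ 0ℤ +ℤ (1ℤ -ℤ 0ℤ)
      s₃ = solve-∀
      square : ∀ z (d : Dec (det z ≡ 1#)) (d′ : Dec (det z ≡ 1#)) (d₀ : Dec (det z ≡ 0#)) →
        (P *ℤ [ d′ ]? -ℤ (1ℤ -ℤ [ d₀ ]?)) *ℤ (P *ℤ [ d′ ]? -ℤ (1ℤ -ℤ [ d₀ ]?)) ≡ (P *ℤ P -ℤ + 2 *ℤ P) *ℤ [ d ]? +ℤ (1ℤ -ℤ [ d₀ ]?)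
      square z (yes _) (yes _) (no _) = s₁ P
      square z (no _) (no _) (yes _) = s₂ P
      square z (no _) (no _) (no _) = s₃ P
      square z (yes d) (no ¬d) _ = contradiction d ¬d
      square z (no ¬d) (yes d) _ = contradiction d ¬d
      square z (yes d) _ (yes d₀) = contradiction (trans (sym d₀) d) 0≢1

    infixl 6 _∸M_
    _∸M_ : Mat n → Mat n → Mat n
    x ∸M y = mk λ i j → entry x i j + - entry y i j

    entry-∸ : ∀ x y i j → entry (x ∸M y) i j ≡ entry x i j + - entry y i j
    entry-∸ x y = entry-mk (λ i j → entry x i j + - entry y i j)

    private
      e+ = entry-+
      e- = entry-∸

    +M-comm : ∀ (x y : Mat n) → x +M y ≡ y +M x
    +M-comm x y = mat-ext λ i j → trans (e+ x y i j) (trans (+-comm _ _) (sym (e+ y x i j)))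

    [x+y]∸y : ∀ (x y : Mat n) → (x +M y) ∸M y ≡ x
    [x+y]∸y x y = mat-ext λ i j → trans (e- (x +M y) y i j) (trans (cong (_+ - entry y i j) (e+ x y i j))
      (solve 2 (λ x y → x :+ y :+ :- y := x) refl _ _))

    [x∸y]+y : ∀ (x y : Mat n) → (x ∸M y) +M y ≡ x
    [x∸y]+y x y = mat-ext λ i j → trans (e+ (x ∸M y) y i j) (trans (cong (_+ entry y i j) (e- x y i j))
      (solve 2 (λ x y → x :+ :- y :+ y := x) refl _ _))

    [x+y]∸z : ∀ (x y z : Mat n) → (x +M y) ∸M z ≡ (x ∸M z) +M y
    [x+y]∸z x y z = mat-ext λ i j → trans (e- (x +M y) z i j) (trans (cong (_+ - entry z i j) (e+ x y i j))
      (trans (solve 3 (λ x y z → x :+ y :+ :- z := x :+ :- z :+ y) refl _ _ _)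
      (sym (trans (e+ (x ∸M z) y i j) (cong (_+ entry y i j) (e- x z i j))))))

    ∑-+M : ∀ y (f : Mat n → ℤ) → ∑ (λ x → f (x +M y)) ≡ ∑ f
    ∑-+M y = ∑-bij (_+M y) (_∸M y) (λ x → [x∸y]+y x y) (λ x → [x+y]∸y x y)

    ∑-*M : ∀ d → det d ≡ 1# → (f : Mat n → ℤ) → ∑ (λ x → f (x *M d)) ≡ ∑ f
    ∑-*M d dd = ∑-bij (_*M d) (_*M adj d) (λ x → *M-cancelʳ′ x d dd) (λ x → *M-cancelʳ x d dd)

    shift : ∀ (k z z′ d : Mat n) → k +M (z′ *M d) ≡ (k +M (z *M d)) +M ((z′ ∸M z) *M d)
    shift k z z′ d = mat-ext λ i j → begin
      entry (k +M (z′ *M d)) i j ≡⟨ trans (e+ k (z′ *M d) i j) (cong (_+_ (entry k i j)) (entry-* z′ d i j)) ⟩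
      entry k i j + Σᶠ (λ t → entry z′ i t * entry d t j)
        ≡⟨ cong (_+_ (entry k i j)) (trans (Σᶠ-cong (λ t → solve 3 (λ z z′ d → z′ :* d := z :* d :+ (z′ :+ :- z) :* d) refl (entry z i t) (entry z′ i t) (entry d t j)))
             (Σᶠ-+ (λ t → entry z i t * entry d t j) (λ t → (entry z′ i t + - entry z i t) * entry d t j))) ⟩
      entry k i j + (Σᶠ (λ t → entry z i t * entry d t j) + Σᶠ (λ t → (entry z′ i t + - entry z i t) * entry d t j))
        ≡⟨ trans (sym (+-assoc _ _ _)) (cong₂ _+_ (sym (trans (e+ k (z *M d) i j) (cong (_+_ (entry k i j)) (entry-* z d i j))))
             (trans (Σᶠ-cong (λ t → cong (_* entry d t j) (sym (e- z′ z i t)))) (sym (entry-* (z′ ∸M z) d i j)))) ⟩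
      entry (k +M (z *M d)) i j + entry ((z′ ∸M z) *M d) i j ≡⟨ sym (e+ (k +M (z *M d)) ((z′ ∸M z) *M d) i j) ⟩
      entry ((k +M (z *M d)) +M ((z′ ∸M z) *M d)) i j ∎
      where open ≡-Reasoning

    column : Mat n → Fin n → Fin n → Carrier
    column h j r = entry h r j

    *M-outer : ∀ (k h d : Mat n) j η → k +M (h *M (d +M outer (κ j) η)) ≡ (k +M (h *M d)) +M outer (column h j) η
    *M-outer k h d j η = mat-ext λ r s → begin
      entry (k +M (h *M (d +M outer (κ j) η))) r s ≡⟨ trans (e+ k (h *M (d +M outer (κ j) η)) r s) (cong (_+_ (entry k r s)) (entry-* h (d +M outer (κ j) η) r s)) ⟩
      entry k r s + Σᶠ (λ t → entry h r t * entry (d +M outer (κ j) η) t s)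
        ≡⟨ cong (_+_ (entry k r s)) (trans (Σᶠ-cong (λ t → trans (cong (entry h r t *_) (trans (e+ d (outer (κ j) η) t s) (cong (_+_ (entry d t s)) (entry-mk (λ r s → κ j r * lookup η s) t s))))
             (solve 4 (λ h d k e → h :* (d :+ k :* e) := h :* d :+ k :* (h :* e)) refl (entry h r t) (entry d t s) (κ j t) (lookup η s))))
             (trans (Σᶠ-+ (λ t → entry h r t * entry d t s) (λ t → κ j t * (entry h r t * lookup η s)))
               (cong₂ _+_ (sym (entry-* h d r s)) (Σᶠ-κ j (λ t → entry h r t * lookup η s))))) ⟩
      entry k r s + (entry (h *M d) r s + entry h r j * lookup η s)
        ≡⟨ trans (sym (+-assoc _ _ _)) (sym (trans (e+ (k +M (h *M d)) (outer (column h j) η) r s)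
             (cong₂ _+_ (e+ k (h *M d) r s) (entry-mk (λ r s → column h j r * lookup η s) r s)))) ⟩
      entry ((k +M (h *M d)) +M outer (column h j) η) r s ∎
      where open ≡-Reasoning

    module Convolution (a : Mat n → ℤ) where
      u : Mat n → ℤ
      u x = ∑ λ y → a y *ℤ τ (x ∸M y)

      -- The adjoint convolution, applied to `u` rather than to an arbitrary function because `u`
      -- inherits the zero sums of `τ`.
      v : Mat n → ℤ
      v x = ∑ λ z → τ z *ℤ u (x +M z)

      ∑u-outer : ∀ x w i → w i ≢ 0# → ∑ (λ η → u (x +M outer w η)) ≡ 0ℤ
      ∑u-outer x w i wi≢0 = trans (∑-swap (λ η y → a y *ℤ τ ((x +M outer w η) ∸M y))) (∑-0 (λ y →
        trans (∑-* (a y) (λ η → τ ((x +M outer w η) ∸M y))) (trans (cong (a y *ℤ_)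
          (trans (∑-cong (λ η → cong τ ([x+y]∸z x (outer w η) y))) (∑τ-outer (x ∸M y) w i wi≢0))) (ℤ.*-zeroʳ (a y)))))

      -- Adding `outer (κ j) η` to `d` permutes all matrices and moves `h *M d` by column `j` of `h`
      -- times ηᵀ. That column is nonzero, so averaging over `η` gives zero.
      ∑u-translates : ∀ (k h : Mat n) i j → entry h i j ≢ 0# → ∑ (λ d → u (k +M (h *M d))) ≡ 0ℤ
      ∑u-translates k h i j hij≢0 = ℤ.*-cancelˡ-≡ ∣R∣ S 0ℤ {{positive⇒nonZero (card-pos {Row n} 𝟘)}} (begin
        ∣R∣ *ℤ S ≡⟨ sym (∑-const (Row n) S) ⟩
        ∑ {Row n} (λ η → S) ≡⟨ ∑-cong (λ η → sym (∑-+M (outer (κ j) η) (λ d → u (k +M (h *M d))))) ⟩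
        ∑ (λ η → ∑ (λ d → u (k +M (h *M (d +M outer (κ j) η))))) ≡⟨ ∑-swap (λ η d → u (k +M (h *M (d +M outer (κ j) η)))) ⟩
        ∑ (λ d → ∑ (λ η → u (k +M (h *M (d +M outer (κ j) η))))) ≡⟨ ∑-0 (λ d → trans (∑-cong (λ η → cong u (*M-outer k h d j η))) (∑u-outer (k +M (h *M d)) (column h j) i hij≢0)) ⟩
        0ℤ ≡⟨ sym (ℤ.*-zeroʳ ∣R∣) ⟩
        ∣R∣ *ℤ 0ℤ ∎)
        where
        open ≡-Reasoning
        ∣R∣ = + ∣ Row n ∣F
        S = ∑ (λ d → u (k +M (h *M d)))

      norm-u : ‖ u ‖² ≡ ∑ (λ y → a y *ℤ v y)
      norm-u = begin
        ∑ (λ x → u x *ℤ u x) ≡⟨ ∑-cong (λ x → trans (sym (∑-* (u x) (λ y → a y *ℤ τ (x ∸M y)))) (∑-cong (λ y → shuffle (u x) (a y) (τ (x ∸M y))))) ⟩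
        ∑ (λ x → ∑ (λ y → a y *ℤ (τ (x ∸M y) *ℤ u x))) ≡⟨ ∑-swap (λ x y → a y *ℤ (τ (x ∸M y) *ℤ u x)) ⟩
        ∑ (λ y → ∑ (λ x → a y *ℤ (τ (x ∸M y) *ℤ u x))) ≡⟨ ∑-cong (λ y → trans (∑-* (a y) (λ x → τ (x ∸M y) *ℤ u x)) (cong (a y *ℤ_)
          (trans (sym (∑-+M y (λ x → τ (x ∸M y) *ℤ u x))) (∑-cong (λ z → cong₂ (λ s t → τ s *ℤ u t) ([x+y]∸y z y) (+M-comm z y)))))) ⟩
        ∑ (λ y → a y *ℤ v y) ∎
        where
        open ≡-Reasoning
        shuffle : ∀ u a t → u *ℤ (a *ℤ t) ≡ a *ℤ (t *ℤ u)
        shuffle = solve-∀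

      dilated : Mat n → Mat n → ℤ
      dilated d k = ∑ λ z → τ z *ℤ u (k +M (z *M d))

      -- Substitute `z *M d` for `z`: only the determinant matters to `τ`.
      dilated-SL : ∀ d → det d ≡ 1# → ∀ k → dilated d k ≡ v k
      dilated-SL d dd k = trans (∑-cong (λ z → cong (_*ℤ u (k +M (z *M d))) (cong ω (sym (trans (det-* z d) (trans (cong (det z *_) dd) (*-identityʳ _)))))))
        (∑-*M d dd (λ z → τ z *ℤ u (k +M z)))

      -- After shifting `k`, only the difference `z′ ∸M z` matters, and a nonzero difference is
      -- killed by `∑u-translates`.
      pair : ∀ z z′ → ∑ (λ d → ∑ (λ k → u (k +M (z *M d)) *ℤ u (k +M (z′ *M d)))) ≡ δ z′ z *ℤ (∣M∣ *ℤ ‖ u ‖²)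
      pair z z′ = begin
        ∑ (λ d → ∑ (λ k → u (k +M (z *M d)) *ℤ u (k +M (z′ *M d))))
          ≡⟨ ∑-cong (λ d → trans (∑-cong (λ k → cong (λ t → u (k +M (z *M d)) *ℤ u t) (shift k z z′ d)))
               (∑-+M (z *M d) (λ k → u k *ℤ u (k +M ((z′ ∸M z) *M d))))) ⟩
        ∑ (λ d → ∑ (λ k → u k *ℤ u (k +M ((z′ ∸M z) *M d)))) ≡⟨ cases (z′ ≟F z) ⟩
        δ z′ z *ℤ (∣M∣ *ℤ ‖ u ‖²) ∎
        where
        open ≡-Reasoning
        cases : (eq? : Dec (z′ ≡ z)) → ∑ (λ d → ∑ (λ k → u k *ℤ u (k +M ((z′ ∸M z) *M d)))) ≡ [ eq? ]? *ℤ (∣M∣ *ℤ ‖ u ‖²)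
        cases (yes refl) = trans (∑-cong (λ d → ∑-cong (λ k → cong (λ t → u k *ℤ u t) (degenerate k d)))) (trans (∑-const (Mat n) ‖ u ‖²) (sym (ℤ.*-identityˡ _)))
          where
          degenerate : ∀ k d → k +M ((z ∸M z) *M d) ≡ k
          degenerate k d = mat-ext λ i j → trans (e+ k ((z ∸M z) *M d) i j) (trans (cong (_+_ (entry k i j)) (trans (entry-* (z ∸M z) d i j)
            (Σᶠ-0 (λ t → trans (cong (_* entry d t j) (trans (e- z z i t) (-‿inverseʳ _))) (zeroˡ _))))) (+-identityʳ _))
        cases (no z′≢z) with Fin.any? (λ i → Fin.any? (λ j → ¬? (entry (z′ ∸M z) i j ≟ 0#)))
        ... | yes (i , j , hij≢0) = trans (∑-swap (λ d k → u k *ℤ u (k +M ((z′ ∸M z) *M d)))) (trans (∑-0 (λ k →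
            trans (∑-* (u k) (λ d → u (k +M ((z′ ∸M z) *M d)))) (trans (cong (u k *ℤ_) (∑u-translates k (z′ ∸M z) i j hij≢0)) (ℤ.*-zeroʳ (u k)))))
            (sym (ℤ.*-zeroˡ (∣M∣ *ℤ ‖ u ‖²))))
        ... | no ¬∃ = contradiction (mat-ext λ i j → begin
            entry z′ i j ≡⟨ solve 2 (λ x y → x := (x :+ :- y) :+ y) refl (entry z′ i j) (entry z i j) ⟩
            (entry z′ i j + - entry z i j) + entry z i j ≡⟨ cong (_+ entry z i j) (trans (sym (e- z′ z i j))
              (decidable-stable (entry (z′ ∸M z) i j ≟ 0#) (λ hij≢0 → ¬∃ (i , j , hij≢0)))) ⟩
            0# + entry z i j ≡⟨ +-identityˡ _ ⟩
            entry z i j ∎) z′≢z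

      -- Summing over all matrices d, invertible or not, leaves only the diagonal terms by ∑u-translates.
      dilated-total : ∑ (λ d → ‖ dilated d ‖²) ≡ ‖ τ ‖² *ℤ (∣M∣ *ℤ ‖ u ‖²)
      dilated-total = begin
        ∑ (λ d → ∑ (λ k → dilated d k *ℤ dilated d k))
          ≡⟨ ∑-cong (λ d → ∑-cong (λ k → trans (∑-product (λ z → τ z *ℤ u (k +M (z *M d))) (λ z → τ z *ℤ u (k +M (z *M d))))
               (∑-cong (λ z → ∑-cong (λ z′ → shuffle (τ z) (u (k +M (z *M d))) (τ z′) (u (k +M (z′ *M d)))))))) ⟩
        ∑ (λ d → ∑ (λ k → ∑ (λ z → ∑ (λ z′ → τ z *ℤ τ z′ *ℤ (u (k +M (z *M d)) *ℤ u (k +M (z′ *M d)))))))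
          ≡⟨ ∑-swap² (λ d k z z′ → τ z *ℤ τ z′ *ℤ (u (k +M (z *M d)) *ℤ u (k +M (z′ *M d)))) ⟩
        ∑ (λ z → ∑ (λ z′ → ∑ (λ d → ∑ (λ k → τ z *ℤ τ z′ *ℤ (u (k +M (z *M d)) *ℤ u (k +M (z′ *M d)))))))
          ≡⟨ ∑-cong (λ z → ∑-cong (λ z′ → trans (∑-cong (λ d → ∑-* (τ z *ℤ τ z′) (λ k → u (k +M (z *M d)) *ℤ u (k +M (z′ *M d)))))
               (trans (∑-* (τ z *ℤ τ z′) (λ d → ∑ (λ k → u (k +M (z *M d)) *ℤ u (k +M (z′ *M d))))) (cong (τ z *ℤ τ z′ *ℤ_) (pair z z′))))) ⟩
        ∑ (λ z → ∑ (λ z′ → τ z *ℤ τ z′ *ℤ (δ z′ z *ℤ K))) ≡⟨ ∑-cong (λ z → trans (∑-cong (λ z′ → pull (τ z) (τ z′) (δ z′ z) K)) (∑-δ* z (λ z′ → τ z *ℤ τ z′ *ℤ K))) ⟩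
        ∑ (λ z → τ z *ℤ τ z *ℤ K) ≡⟨ ∑-*ʳ (λ z → τ z *ℤ τ z) K ⟩
        ‖ τ ‖² *ℤ K ∎
        where
        open ≡-Reasoning
        K = ∣M∣ *ℤ ‖ u ‖²
        shuffle : ∀ a b c d → a *ℤ b *ℤ (c *ℤ d) ≡ a *ℤ c *ℤ (b *ℤ d)
        shuffle = solve-∀
        pull : ∀ a b d k → a *ℤ b *ℤ (d *ℤ k) ≡ d *ℤ (a *ℤ b *ℤ k)
        pull = solve-∀

      Λ : ℤ
      Λ = Q *ℤ Q *ℤ ∣M∣

      -- Keep only the `d` in SL in `dilated-total`: each contributes `‖ v ‖²`, and their number `G`
      -- cancels against the factor `G` in `τ-norm`.
      norm-v : ‖ v ‖² ≤ Λ *ℤ ‖ u ‖²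
      norm-v = ℤ.*-cancelˡ-≤-pos ‖ v ‖² (Λ *ℤ ‖ u ‖²) G {{G-pos}} (begin
        G *ℤ ‖ v ‖² ≡⟨ sym (∑-*ʳ γ ‖ v ‖²) ⟩
        ∑ (λ d → γ d *ℤ ‖ v ‖²) ≤⟨ ∑-mono (λ d → le d (det d ≟ 1#)) ⟩
        ∑ (λ d → ‖ dilated d ‖²) ≡⟨ dilated-total ⟩
        ‖ τ ‖² *ℤ (∣M∣ *ℤ ‖ u ‖²) ≤⟨ *-monoʳ {‖ τ ‖²} {Q *ℤ Q *ℤ G} (*-nonneg {∣M∣} {‖ u ‖²} (ℤᵇ.+≤+ ℕ.z≤n) (‖‖²-nonneg u)) τ-norm ⟩
        Q *ℤ Q *ℤ G *ℤ (∣M∣ *ℤ ‖ u ‖²) ≡⟨ arrange Q G ∣M∣ ‖ u ‖² ⟩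
        G *ℤ (Λ *ℤ ‖ u ‖²) ∎)
        where
        open ℤ.≤-Reasoning
        arrange : ∀ q g m u → q *ℤ q *ℤ g *ℤ (m *ℤ u) ≡ g *ℤ (q *ℤ q *ℤ m *ℤ u)
        arrange = solve-∀
        G-pos : Positive G
        G-pos = positive (ℤ.<-≤-trans (ℤᵇ.+<+ (ℕ.s≤s ℕ.z≤n)) (ℤ.≤-trans (ℤ.≤-reflexive (sym (∑-δ (Id n))))
          (∑-mono (λ z → id-le z (z ≟F Id n)))))
          where
          id-le : ∀ z (d : Dec (z ≡ Id n)) → [ d ]? ≤ γ z
          id-le z (yes refl) = ℤ.≤-reflexive (sym ([]?-yes (det z ≟ 1#) (det-Id n)))
          id-le z (no _) = 0≤γ z
        le : ∀ d (d? : Dec (det d ≡ 1#)) → [ d? ]? *ℤ ‖ v ‖² ≤ ‖ dilated d ‖²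
        le d (yes dd) = ℤ.≤-reflexive (trans (ℤ.*-identityˡ ‖ v ‖²) (∑-cong (λ k → sym (cong₂ _*ℤ_ (dilated-SL d dd k) (dilated-SL d dd k)))))
        le d (no _) = ℤ.≤-trans (ℤ.≤-reflexive (ℤ.*-zeroˡ ‖ v ‖²)) (‖‖²-nonneg (dilated d))

      -- The TT* argument: ‖u‖⁴ = ⟨a, v⟩² is at most ‖a‖²‖v‖², hence at most Λ‖a‖²‖u‖²; a factor
      -- ‖u‖² cancels unless it is zero.
      norm-u-bound : ‖ u ‖² ≤ ‖ a ‖² *ℤ Λ
      norm-u-bound with ‖ u ‖² ℤ.≟ 0ℤ
      ... | yes eq = ℤ.≤-trans (ℤ.≤-reflexive eq) (*-nonneg {‖ a ‖²} {Λ} (‖‖²-nonneg a) (*-nonneg {Q *ℤ Q} {∣M∣} (sq-nonneg Q) (ℤᵇ.+≤+ ℕ.z≤n)))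
      ... | no u≢0 = ℤ.*-cancelʳ-≤-pos ‖ u ‖² (‖ a ‖² *ℤ Λ) ‖ u ‖² {{positive (ℤ.≤∧≢⇒< (‖‖²-nonneg u) (u≢0 ∘ sym))}} (begin
        ‖ u ‖² *ℤ ‖ u ‖² ≡⟨ cong₂ _*ℤ_ norm-u norm-u ⟩
        ∑ (λ y → a y *ℤ v y) *ℤ ∑ (λ y → a y *ℤ v y) ≤⟨ cauchy-schwarz a v ⟩
        ‖ a ‖² *ℤ ‖ v ‖² ≤⟨ *-monoˡ (‖‖²-nonneg a) norm-v ⟩
        ‖ a ‖² *ℤ (Λ *ℤ ‖ u ‖²) ≡⟨ sym (ℤ.*-assoc ‖ a ‖² Λ ‖ u ‖²) ⟩
        ‖ a ‖² *ℤ Λ *ℤ ‖ u ‖² ∎)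
        where open ℤ.≤-Reasoning

      sum-set-bound : (χ : Mat n → ℤ) → (∀ x → χ x *ℤ χ x ≡ χ x) → (∀ x → a x *ℤ a x ≡ a x) →
        ∑ (λ x → χ x *ℤ u x) *ℤ ∑ (λ x → χ x *ℤ u x) ≤ ∑ χ *ℤ (∑ a *ℤ Λ)
      sum-set-bound χ χ-idem a-idem = begin
        ∑ (λ x → χ x *ℤ u x) *ℤ ∑ (λ x → χ x *ℤ u x) ≤⟨ cauchy-schwarz χ u ⟩
        ‖ χ ‖² *ℤ ‖ u ‖² ≤⟨ *-monoˡ (‖‖²-nonneg χ) norm-u-bound ⟩
        ‖ χ ‖² *ℤ (‖ a ‖² *ℤ Λ) ≡⟨ cong₂ (λ s t → s *ℤ (t *ℤ Λ)) (∑-cong χ-idem) (∑-cong a-idem) ⟩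
        ∑ χ *ℤ (∑ a *ℤ Λ) ∎
        where open ℤ.≤-Reasoning

      -- The nonsingular differences contribute at most |A||X|, so no spectral information is needed for them.
      sum-set-count : (χ s : Mat n → ℤ) → (∀ x → 0ℤ ≤ χ x) → (∀ x → 0ℤ ≤ a x) → (∀ y z → a y *ℤ s z ≤ a y *ℤ (χ (y +M z) *ℤ γ z)) →
        P *ℤ (∑ a *ℤ ∑ s) -ℤ ∑ a *ℤ ∑ χ ≤ ∑ (λ x → χ x *ℤ u x)
      sum-set-count χ s 0≤χ 0≤a covers = begin
        P *ℤ (∑ a *ℤ ∑ s) -ℤ ∑ a *ℤ ∑ χ
          ≡⟨ cong₂ (λ p r → P *ℤ p -ℤ r) (∑-product a s) (trans (sym (∑-*ʳ a (∑ χ))) (∑-cong (λ y → trans (cong (a y *ℤ_) (sym (∑-+M′ y χ))) (sym (∑-* (a y) (λ z → χ (y +M z))))))) ⟩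
        P *ℤ ∑ (λ y → ∑ (λ z → a y *ℤ s z)) -ℤ ∑ (λ y → ∑ (λ z → a y *ℤ χ (y +M z)))
          ≡⟨ sym (trans (∑-cong (λ y → trans (∑-- (λ z → P *ℤ (a y *ℤ s z)) (λ z → a y *ℤ χ (y +M z))) (cong (_-ℤ ∑ (λ z → a y *ℤ χ (y +M z))) (∑-* P (λ z → a y *ℤ s z)))))
               (trans (∑-- (λ y → P *ℤ ∑ (λ z → a y *ℤ s z)) (λ y → ∑ (λ z → a y *ℤ χ (y +M z)))) (cong (_-ℤ ∑ (λ y → ∑ (λ z → a y *ℤ χ (y +M z)))) (∑-* P (λ y → ∑ (λ z → a y *ℤ s z)))))) ⟩
        ∑ (λ y → ∑ (λ z → P *ℤ (a y *ℤ s z) -ℤ a y *ℤ χ (y +M z))) ≤⟨ ∑-mono (λ y → ∑-mono (λ z → term y z)) ⟩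
        ∑ (λ y → ∑ (λ z → a y *ℤ (χ (y +M z) *ℤ τ z))) ≡⟨ ∑-cong (λ y → trans (∑-* (a y) (λ z → χ (y +M z) *ℤ τ z)) (trans (cong (a y *ℤ_) (unshift y)) (sym (∑-* (a y) (λ x → χ x *ℤ τ (x ∸M y)))))) ⟩
        ∑ (λ y → ∑ (λ x → a y *ℤ (χ x *ℤ τ (x ∸M y)))) ≡⟨ ∑-swap (λ y x → a y *ℤ (χ x *ℤ τ (x ∸M y))) ⟩
        ∑ (λ x → ∑ (λ y → a y *ℤ (χ x *ℤ τ (x ∸M y)))) ≡⟨ ∑-cong (λ x → trans (∑-cong (λ y → shuffle (a y) (χ x) (τ (x ∸M y)))) (∑-* (χ x) (λ y → a y *ℤ τ (x ∸M y)))) ⟩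
        ∑ (λ x → χ x *ℤ u x) ∎
        where
        open ℤ.≤-Reasoning
        shuffle : ∀ a b c → a *ℤ (b *ℤ c) ≡ b *ℤ (a *ℤ c)
        shuffle = solve-∀
        ∑-+M′ : ∀ y (f : Mat n → ℤ) → ∑ (λ z → f (y +M z)) ≡ ∑ f
        ∑-+M′ y f = trans (∑-cong (λ z → cong f (+M-comm y z))) (∑-+M y f)
        unshift : ∀ y → ∑ (λ z → χ (y +M z) *ℤ τ z) ≡ ∑ (λ x → χ x *ℤ τ (x ∸M y))
        unshift y = trans (∑-cong (λ z → cong₂ (λ s t → χ s *ℤ τ t) (+M-comm y z) (sym ([x+y]∸y z y)))) (∑-+M y (λ x → χ x *ℤ τ (x ∸M y)))
        expand : ∀ a x p d e → a *ℤ (x *ℤ (p *ℤ d -ℤ (1ℤ -ℤ e))) ≡ p *ℤ (a *ℤ (x *ℤ d)) -ℤ a *ℤ x +ℤ a *ℤ (x *ℤ e)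
        expand = solve-∀
        term : ∀ y z → P *ℤ (a y *ℤ s z) -ℤ a y *ℤ χ (y +M z) ≤ a y *ℤ (χ (y +M z) *ℤ τ z)
        term y z = begin
          P *ℤ (a y *ℤ s z) -ℤ a y *ℤ χ (y +M z) ≤⟨ ℤ.+-monoˡ-≤ (-ℤ (a y *ℤ χ (y +M z))) (*-monoˡ {a y *ℤ s z} {a y *ℤ (χ (y +M z) *ℤ γ z)} {P} 0≤P (covers y z)) ⟩
          P *ℤ (a y *ℤ (χ (y +M z) *ℤ γ z)) -ℤ a y *ℤ χ (y +M z)
            ≤⟨ ℤ.i≤i+j _ (a y *ℤ (χ (y +M z) *ℤ δ (det z) 0#)) {{nonNegative (*-nonneg {a y} (0≤a y) (*-nonneg {χ (y +M z)} (0≤χ (y +M z)) (0≤[]? (det z ≟F 0#))))}} ⟩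
          P *ℤ (a y *ℤ (χ (y +M z) *ℤ γ z)) -ℤ a y *ℤ χ (y +M z) +ℤ a y *ℤ (χ (y +M z) *ℤ δ (det z) 0#) ≡⟨ sym (expand (a y) (χ (y +M z)) P (γ z) (δ (det z) 0#)) ⟩
          a y *ℤ (χ (y +M z) *ℤ (P *ℤ γ z -ℤ (1ℤ -ℤ δ (det z) 0#))) ≡⟨ cong (λ d → a y *ℤ (χ (y +M z) *ℤ (P *ℤ d -ℤ (1ℤ -ℤ δ (det z) 0#)))) ([]?-cong (det z ≟ 1#) (det z ≟F 1#) (λ d → d) (λ d → d)) ⟩
          a y *ℤ (χ (y +M z) *ℤ τ z) ∎

-- Combining the two bounds in natural numbers

module Arithmetic where
  open import Data.Nat.Base
  open import Data.Nat.Properties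
  open import Data.Nat.Tactic.RingSolver using (solve-∀)
  open import Data.Sum.Base using (_⊎_; inj₁; inj₂)
  open import Relation.Binary.PropositionalEquality
  open import Function.Base using (it)
  open import Relation.Nullary.Decidable using (yes; no)

  module Numbers (q N Y A B C X S E G V k t : ℕ) .{{_ : NonZero q}} .{{_ : NonZero N}} .{{_ : NonZero Y}} .{{_ : NonZero t}} (2≤q : 2 ≤ q) where
    open ≤-Reasoning

    -- For N = q^n and Y = q^(n²-2n-2) these are R = q^(n²-n-1), Z = q^(n²-1), T₀ = q^(2n²-n-1) and
    -- W = |B||C|. Up to constants, `T₀` is the value of `W` at which the two terms of the energy
    -- bound balance.
    R Z K₀ T₀ W : ℕ
    R = q * N * Y
    Z = N * R
    K₀ = t + 2 * k
    T₀ = q * R * Z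
    W = B * C

    -- `G` is at most q / (q - 1) times `Z`, and q / (q - 1) is at most 2.
    G-bound : q * G ≤ G + q * Z → G ≤ 2 * Z
    G-bound h = *-cancelˡ-≤ q (+-cancelˡ-≤ (q * G) (q * G) (q * (2 * Z)) (begin
      q * G + q * G ≤⟨ +-mono-≤ h h ⟩
      (G + q * Z) + (G + q * Z) ≡⟨ regroup G q Z ⟩
      2 * G + q * (2 * Z) ≤⟨ +-monoˡ-≤ (q * (2 * Z)) (*-monoˡ-≤ G 2≤q) ⟩
      q * G + q * (2 * Z) ∎))
      where
      regroup : ∀ g q z → (g + q * z) + (g + q * z) ≡ 2 * g + q * (2 * z)
      regroup = solve-∀

    product-bound : q * G ≤ G + q * Z → Z * (N * E) ≤ N * (t * (W * W)) + Z * (k * (G * C * (q * B))) → W * W ≤ S * E →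
      .{{_ : NonZero W}} → Z * W ≤ S * (t * W + 2 * k * T₀)
    product-bound h₁ h₂ h₃ = *-cancelˡ-≤ W (*-cancelˡ-≤ N (begin
      N * (W * (Z * W)) ≡⟨ a₁ N W Z ⟩
      Z * N * (W * W) ≤⟨ *-monoʳ-≤ (Z * N) h₃ ⟩
      Z * N * (S * E) ≡⟨ a₂ Z N S E ⟩
      S * (Z * (N * E)) ≤⟨ *-monoʳ-≤ S h₂ ⟩
      S * (N * (t * (W * W)) + Z * (k * (G * C * (q * B)))) ≡⟨ cong (λ x → S * (N * (t * (W * W)) + x)) (a₃ Z k G C q B) ⟩
      S * (N * (t * (W * W)) + G * (Z * (k * (q * W)))) ≤⟨ *-monoʳ-≤ S (+-monoʳ-≤ (N * (t * (W * W))) (*-monoˡ-≤ (Z * (k * (q * W))) (G-bound h₁))) ⟩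
      S * (N * (t * (W * W)) + 2 * Z * (Z * (k * (q * W)))) ≡⟨ a₄ S N t W k q R ⟩
      N * (W * (S * (t * W + 2 * k * T₀))) ∎))
      where
      a₁ : ∀ n w z → n * (w * (z * w)) ≡ z * n * (w * w)
      a₁ = solve-∀
      a₂ : ∀ z n s e → z * n * (s * e) ≡ s * (z * (n * e))
      a₂ = solve-∀
      a₃ : ∀ z k g c q b → z * (k * (g * c * (q * b))) ≡ g * (z * (k * (q * (b * c))))
      a₃ = solve-∀
      a₄ : ∀ s n t w k q r → s * (n * (t * (w * w)) + 2 * (n * r) * (n * r * (k * (q * w)))) ≡ n * (w * (s * (t * w + 2 * k * (q * r * (n * r)))))
      a₄ = solve-∀

    -- Above `T₀` the equidistribution term of the energy dominates, below it the smoothing error.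
    product-set : q * G ≤ G + q * Z → Z * (N * E) ≤ N * (t * (W * W)) + Z * (k * (G * C * (q * B))) → W * W ≤ S * E →
      .{{_ : NonZero W}} → Z ≤ K₀ * S ⊎ W ≤ K₀ * S * (q * R)
    product-set h₁ h₂ h₃ with ≤-total T₀ W
    ... | inj₁ T₀≤W = inj₁ (*-cancelʳ-≤ Z (K₀ * S) W (begin
      Z * W ≤⟨ product-bound h₁ h₂ h₃ ⟩
      S * (t * W + 2 * k * T₀) ≤⟨ *-monoʳ-≤ S (+-monoʳ-≤ (t * W) (*-monoʳ-≤ (2 * k) T₀≤W)) ⟩
      S * (t * W + 2 * k * W) ≡⟨ collect S t k W ⟩
      K₀ * S * W ∎))
      where
      collect : ∀ s t k w → s * (t * w + 2 * k * w) ≡ (t + 2 * k) * s * w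
      collect = solve-∀
    ... | inj₂ W≤T₀ = inj₂ (*-cancelˡ-≤ Z {{m*n≢0 N R {{it}} {{m*n≢0 (q * N) Y {{m*n≢0 q N}}}}}} (begin
      Z * W ≤⟨ product-bound h₁ h₂ h₃ ⟩
      S * (t * W + 2 * k * T₀) ≤⟨ *-monoʳ-≤ S (+-monoˡ-≤ (2 * k * T₀) (*-monoʳ-≤ t W≤T₀)) ⟩
      S * (t * T₀ + 2 * k * T₀) ≡⟨ collect S t k q R Z ⟩
      Z * (K₀ * S * (q * R)) ∎))
      where
      collect : ∀ s t k q r z → s * (t * (q * r * z) + 2 * k * (q * r * z)) ≡ z * ((t + 2 * k) * s * (q * r))
      collect = solve-∀

    -- `K₀` is squared because the sum-set estimate is quadratic in |S|; 16 is the square of the 4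
    -- that separates large from small `X`.
    K : ℕ
    K = 16 * (K₀ * K₀)

    K₀-nonZero : NonZero K₀
    K₀-nonZero = >-nonZero (≤-trans (>-nonZero⁻¹ t) (m≤m+n t (2 * k)))

    4K₀≤K : 4 * K₀ ≤ K
    4K₀≤K = begin
      4 * K₀ ≤⟨ *-monoˡ-≤ K₀ {4} {16} (s≤s (s≤s (s≤s (s≤s z≤n)))) ⟩
      16 * K₀ ≡⟨ cong (16 *_) (sym (*-identityʳ K₀)) ⟩
      16 * (K₀ * 1) ≤⟨ *-monoʳ-≤ 16 (*-monoʳ-≤ K₀ (>-nonZero⁻¹ K₀ {{K₀-nonZero}})) ⟩
      16 * (K₀ * K₀) ∎

    -- The four alternatives are the four terms of the minimum; here q Z = q^(n²), R = q^(n²-n-1) and q²R⁴ = q^(4n²-4n-2).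
    Outcome : Set
    Outcome = (q * Z ≤ K * X) ⊎ (N * N * A ≤ K * X) ⊎ (A * (W * W) ≤ K * X * (q * q * (R * R * (R * R)))) ⊎ (W ≤ K * X * R)

    large-X : q * S ≤ 4 * X → Z ≤ K₀ * S ⊎ W ≤ K₀ * S * (q * R) → Outcome
    large-X qS≤4X (inj₁ Z≤) = inj₁ (begin
      q * Z ≤⟨ *-monoʳ-≤ q Z≤ ⟩
      q * (K₀ * S) ≡⟨ a₁ q K₀ S ⟩
      K₀ * (q * S) ≤⟨ *-monoʳ-≤ K₀ qS≤4X ⟩
      K₀ * (4 * X) ≡⟨ a₂ K₀ X ⟩
      4 * K₀ * X ≤⟨ *-monoˡ-≤ X 4K₀≤K ⟩
      K * X ∎)
      where
      a₁ : ∀ q k s → q * (k * s) ≡ k * (q * s)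
      a₁ = solve-∀
      a₂ : ∀ k x → k * (4 * x) ≡ 4 * k * x
      a₂ = solve-∀
    large-X qS≤4X (inj₂ W≤) = inj₂ (inj₂ (inj₂ (begin
      W ≤⟨ W≤ ⟩
      K₀ * S * (q * R) ≡⟨ a₁ K₀ S q R ⟩
      K₀ * R * (q * S) ≤⟨ *-monoʳ-≤ (K₀ * R) qS≤4X ⟩
      K₀ * R * (4 * X) ≡⟨ a₂ K₀ R X ⟩
      4 * K₀ * (X * R) ≤⟨ *-monoˡ-≤ (X * R) 4K₀≤K ⟩
      K * (X * R) ≡⟨ sym (*-assoc K X R) ⟩
      K * X * R ∎)))
      where
      a₁ : ∀ k s q r → k * s * (q * r) ≡ k * r * (q * s)
      a₁ = solve-∀
      a₂ : ∀ k r x → k * r * (4 * x) ≡ 4 * k * (x * r)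
      a₂ = solve-∀

    -- For small `X` the losses |A||S| and |A||X| take at most a half and a quarter of q |A||S|, so
    -- `V` is at least the remaining quarter; its square is bounded by `h₅`.
    small-X : .{{_ : NonZero A}} → 4 * X ≤ q * S → q * (A * S) ≤ A * S + A * X + V → V * V ≤ X * (A * (q * q * (q * Z))) → A * (S * S) ≤ 16 * X * (q * Z)
    small-X 4X≤qS h₄ h₅ = *-cancelˡ-≤ A (*-cancelˡ-≤ q (*-cancelˡ-≤ q (begin
      q * (q * (A * (A * (S * S)))) ≡⟨ a₁ q A S ⟩
      (q * (A * S)) * (q * (A * S)) ≤⟨ *-mono-≤ qAS≤4V qAS≤4V ⟩
      (4 * V) * (4 * V) ≡⟨ a₂ V ⟩
      16 * (V * V) ≤⟨ *-monoʳ-≤ 16 h₅ ⟩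
      16 * (X * (A * (q * q * (q * Z)))) ≡⟨ a₃ X A q (q * Z) ⟩
      q * (q * (A * (16 * X * (q * Z)))) ∎)))
      where
      a₁ : ∀ q a s → q * (q * (a * (a * (s * s)))) ≡ (q * (a * s)) * (q * (a * s))
      a₁ = solve-∀
      a₂ : ∀ v → (4 * v) * (4 * v) ≡ 16 * (v * v)
      a₂ = solve-∀
      a₃ : ∀ x a q z → 16 * (x * (a * (q * q * z))) ≡ q * (q * (a * (16 * x * z)))
      a₃ = solve-∀
      qAS≤4V : q * (A * S) ≤ 4 * V
      qAS≤4V = +-cancelˡ-≤ (3 * (q * (A * S))) (q * (A * S)) (4 * V) (begin
        3 * (q * (A * S)) + q * (A * S) ≡⟨ b₁ (q * (A * S)) ⟩
        4 * (q * (A * S)) ≤⟨ *-monoʳ-≤ 4 h₄ ⟩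
        4 * (A * S + A * X + V) ≡⟨ b₂ A S X V ⟩
        2 * (2 * (A * S)) + A * (4 * X) + 4 * V ≤⟨ +-monoˡ-≤ (4 * V) (+-mono-≤ (*-monoʳ-≤ 2 (*-monoˡ-≤ (A * S) 2≤q)) (*-monoʳ-≤ A 4X≤qS)) ⟩
        2 * (q * (A * S)) + A * (q * S) + 4 * V ≡⟨ b₃ A S q V ⟩
        3 * (q * (A * S)) + 4 * V ∎)
        where
        b₁ : ∀ x → 3 * x + x ≡ 4 * x
        b₁ = solve-∀
        b₂ : ∀ a s x v → 4 * (a * s + a * x + v) ≡ 2 * (2 * (a * s)) + a * (4 * x) + 4 * v
        b₂ = solve-∀
        b₃ : ∀ a s q v → 2 * (q * (a * s)) + a * (q * s) + 4 * v ≡ 3 * (q * (a * s)) + 4 * v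
        b₃ = solve-∀

    -- Insert the lower bound for `S` into the quadratic estimate. In both cases a factor `Y` of at
    -- least 1 is given up.
    from-small-X : A * (S * S) ≤ 16 * X * (q * Z) → Z ≤ K₀ * S ⊎ W ≤ K₀ * S * (q * R) → Outcome
    from-small-X h (inj₁ Z≤) = inj₂ (inj₁ (*-cancelˡ-≤ (q * q * N * N * Y) {{m*n≢0 (q * q * N * N) Y {{m*n≢0 (q * q * N) N {{m*n≢0 (q * q) N {{m*n≢0 q q}}}}}}}} (begin
      q * q * N * N * Y * (N * N * A) ≤⟨ *-monoʳ-≤ (q * q * N * N * Y) (m≤n*m (N * N * A) Y) ⟩
      q * q * N * N * Y * (Y * (N * N * A)) ≡⟨ a₁ q N Y A ⟩
      A * (Z * Z) ≤⟨ *-monoʳ-≤ A (*-mono-≤ Z≤ Z≤) ⟩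
      A * (K₀ * S * (K₀ * S)) ≡⟨ a₂ A K₀ S ⟩
      K₀ * K₀ * (A * (S * S)) ≤⟨ *-monoʳ-≤ (K₀ * K₀) h ⟩
      K₀ * K₀ * (16 * X * (q * Z)) ≡⟨ a₃ K₀ X q N Y ⟩
      q * q * N * N * Y * (K * X) ∎)))
      where
      a₁ : ∀ q n y a → q * q * n * n * y * (y * (n * n * a)) ≡ a * (n * (q * n * y) * (n * (q * n * y)))
      a₁ = solve-∀
      a₂ : ∀ a k s → a * (k * s * (k * s)) ≡ k * k * (a * (s * s))
      a₂ = solve-∀
      a₃ : ∀ k x q n y → k * k * (16 * x * (q * (n * (q * n * y)))) ≡ q * q * n * n * y * (16 * (k * k) * x)
      a₃ = solve-∀
    from-small-X h (inj₂ W≤) = inj₂ (inj₂ (inj₁ (begin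
      A * (W * W) ≤⟨ *-monoʳ-≤ A (*-mono-≤ W≤ W≤) ⟩
      A * (K₀ * S * (q * R) * (K₀ * S * (q * R))) ≡⟨ a₁ A K₀ S (q * R) ⟩
      K₀ * K₀ * (q * R) * (q * R) * (A * (S * S)) ≤⟨ *-monoʳ-≤ (K₀ * K₀ * (q * R) * (q * R)) h ⟩
      K₀ * K₀ * (q * R) * (q * R) * (16 * X * (q * Z)) ≡⟨ a₂ K₀ q R X N ⟩
      K * X * (q * q * (R * R)) * (R * (q * N)) ≤⟨ *-monoʳ-≤ (K * X * (q * q * (R * R))) (*-monoʳ-≤ R (m≤m*n (q * N) Y)) ⟩
      K * X * (q * q * (R * R)) * (R * R) ≡⟨ a₃ (K * X) q R ⟩
      K * X * (q * q * (R * R * (R * R))) ∎)))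
      where
      a₁ : ∀ a k s r → a * (k * s * r * (k * s * r)) ≡ k * k * r * r * (a * (s * s))
      a₁ = solve-∀
      a₂ : ∀ k q r x n → k * k * (q * r) * (q * r) * (16 * x * (q * (n * r))) ≡ 16 * (k * k) * x * (q * q * (r * r)) * (r * (q * n))
      a₂ = solve-∀
      a₃ : ∀ z q r → z * (q * q * (r * r)) * (r * r) ≡ z * (q * q * (r * r * (r * r)))
      a₃ = solve-∀

    outcome : q * G ≤ G + q * Z → Z * (N * E) ≤ N * (t * (W * W)) + Z * (k * (G * C * (q * B))) → W * W ≤ S * E →
      q * (A * S) ≤ A * S + A * X + V → V * V ≤ X * (A * (q * q * (q * Z))) → Outcome
    outcome h₁ h₂ h₃ h₄ h₅ with W ≟ 0 | A ≟ 0
    -- If `W` or `A` is zero, the last or the second term of the minimum is zero; the other cases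
    -- may cancel by both.
    ... | yes W≡0 | _ = inj₂ (inj₂ (inj₂ (subst (_≤ K * X * R) (sym W≡0) z≤n)))
    ... | no _ | yes refl = inj₂ (inj₁ (subst (_≤ K * X) (sym (*-zeroʳ (N * N))) z≤n))
    ... | no W≢0 | no A≢0 with ≤-total (q * S) (4 * X)
    ... | inj₁ qS≤4X = large-X qS≤4X (product-set h₁ h₂ h₃ {{≢-nonZero W≢0}})
    ... | inj₂ 4X≤qS = from-small-X (small-X {{≢-nonZero A≢0}} 4X≤qS h₄ h₅) (product-set h₁ h₂ h₃ {{≢-nonZero W≢0}})

-- Passage to rational inequalities

module Rationals where
  open import Data.Nat.Base as ℕ using (ℕ; suc)
  import Data.Nat.Properties as ℕ
  open import Data.Integer.Base as ℤ using (+_)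
  import Data.Integer.Properties as ℤ
  open import Data.Rational.Base
  import Data.Rational.Properties as ℚ
  open import Data.Rational.Unnormalised.Base as ℚᵘ using (mkℚᵘ; *≤*; *≡*)
  import Data.Rational.Unnormalised.Properties as ℚᵘ
  open import Relation.Binary.PropositionalEquality

  fromℚᵘ-mono-≤ : ∀ {p r} → p ℚᵘ.≤ r → fromℚᵘ p ≤ fromℚᵘ r
  fromℚᵘ-mono-≤ {p} {r} p≤r = ℚ.toℚᵘ-cancel-≤ (ℚᵘ.≤-respˡ-≃ (ℚᵘ.≃-sym (ℚ.toℚᵘ-fromℚᵘ p)) (ℚᵘ.≤-respʳ-≃ (ℚᵘ.≃-sym (ℚ.toℚᵘ-fromℚᵘ r)) p≤r))

  over-≤ : ∀ a d b .{{_ : ℕ.NonZero d}} → a ℕ.≤ b ℕ.* d → a over d ≤ ℕ→ℚ b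
  over-≤ a (suc d) b a≤bd = fromℚᵘ-mono-≤ {mkℚᵘ (+ a) d} {mkℚᵘ (+ b) 0} (*≤* (subst₂ ℤ._≤_ (sym (ℤ.*-identityʳ (+ a))) (ℤ.pos-* b (suc d)) (ℤ.+≤+ a≤bd)))

  ℕ→ℚ-mono : ∀ {a b} → a ℕ.≤ b → ℕ→ℚ a ≤ ℕ→ℚ b
  ℕ→ℚ-mono {a} {b} a≤b = over-≤ a 1 b (subst (a ℕ.≤_) (sym (ℕ.*-identityʳ b)) a≤b)

  1/_⁺ : ∀ K → .{{_ : ℕ.NonZero K}} → ℚ
  1/ suc K ⁺ = (+ 1) / suc K

  1/⁺-pos : ∀ K .{{_ : ℕ.NonZero K}} → 0ℚ < 1/ K ⁺
  1/⁺-pos (suc K) = ℚ.positive⁻¹ _ {{ℚ.normalize-pos 1 (suc K)}}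

  scale-≤ : ∀ K .{{_ : ℕ.NonZero K}} {r} X → r ≤ ℕ→ℚ (K ℕ.* X) → 1/ K ⁺ * r ≤ ℕ→ℚ X
  scale-≤ K@(suc K-1) {r} X r≤ = ℚ.≤-trans (ℚ.*-monoˡ-≤-nonNeg (1/ K ⁺) {{ℚ.pos⇒nonNeg (1/ K ⁺) {{positive (1/⁺-pos K)}}}} r≤) (ℚ.≤-reflexive (ℚ.toℚᵘ-injective (begin
    toℚᵘ (1/ K ⁺ * ℕ→ℚ (K ℕ.* X)) ≈⟨ ℚ.toℚᵘ-homo-* (1/ K ⁺) (ℕ→ℚ (K ℕ.* X)) ⟩
    toℚᵘ (1/ K ⁺) ℚᵘ.* toℚᵘ (ℕ→ℚ (K ℕ.* X)) ≈⟨ ℚᵘ.*-cong (ℚ.toℚᵘ-fromℚᵘ (mkℚᵘ (+ 1) K-1)) (ℚ.toℚᵘ-fromℚᵘ (mkℚᵘ (+ (K ℕ.* X)) 0)) ⟩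
    mkℚᵘ (+ 1) K-1 ℚᵘ.* mkℚᵘ (+ (K ℕ.* X)) 0 ≈⟨ *≡* (trans (ℤ.*-identityʳ _) (trans (ℤ.*-identityˡ _) (trans (ℤ.pos-* K X) (trans (ℤ.*-comm (+ K) (+ X)) (cong (λ k → + X ℤ.* + k) (sym (ℕ.*-identityʳ K))))))) ⟩
    mkℚᵘ (+ X) 0 ≈⟨ ℚ.toℚᵘ-fromℚᵘ (mkℚᵘ (+ X) 0) ⟨
    toℚᵘ (ℕ→ℚ X) ∎)))
    where open ℚᵘ.≃-Reasoning

-- Indicators of lists, exponents and assembly

module Conclusion where
  open import Data.Nat.Base as ℕ using (ℕ; zero; suc)
  import Data.Nat.Properties as ℕ
  import Data.Nat.Tactic.RingSolver as ℕ-Ring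
  open import Data.List.Base as List using (List; []; _∷_; length; deduplicate; concatMap)
  open import Data.List.Relation.Unary.Any using (here; there)
  open import Data.List.Relation.Unary.All as All using (All; []; _∷_)
  open import Data.List.Relation.Unary.AllPairs using ([]; _∷_)
  open import Data.List.Relation.Unary.Unique.Propositional using (Unique)
  import Data.List.Relation.Unary.Unique.DecPropositional.Properties as Unique
  import Data.List.Membership.DecPropositional as DecMembership
  open import Data.List.Membership.Propositional using (_∈_; lose)
  open import Data.List.Membership.Propositional.Properties using (∈-deduplicate⁺; ∈-deduplicate⁻; ∈-concatMap⁺; ∈-map⁺)
  open import Data.Integer.Base using (ℤ; +_; 0ℤ; 1ℤ; _≤_; _^_; ∣_∣) renaming (_+_ to _+ℤ_; _*_ to _*ℤ_; _-_ to _-ℤ_; -_ to -ℤ_)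
  import Data.Integer.Base as ℤᵇ
  import Data.Integer.Properties as ℤ
  open import Data.Integer.Tactic.RingSolver using (solve-∀)
  open import Data.Rational.Base as ℚ using (ℚ)
  import Data.Rational.Properties as ℚ
  open import Data.Sum.Base using (inj₁; inj₂)
  open import Relation.Nullary.Decidable using (Dec; yes; no)
  open import Relation.Nullary.Negation using (contradiction)
  open import Relation.Binary.PropositionalEquality
  open FiniteSums
  open FieldAlgebra
  open Determinants
  open MatrixProducts
  open MatrixSums
  open RootSubgroups
  open LeftTranslates
  open ProductSets
  open SumSets
  open Arithmetic
  open Rationals

  module Indicators {q : ℕ} (F : FiniteField q) {n : ℕ} where
    open FiniteField F
    open Matrices F
    open SumsOver F
    open DecMembership (_≟M_ {n}) using (_∈?_)

    𝟙 : List (Mat n) → Mat n → ℤ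
    𝟙 L x = [ x ∈? L ]?

    0≤𝟙 : ∀ L x → 0ℤ ≤ 𝟙 L x
    0≤𝟙 L x = 0≤[]? (x ∈? L)

    𝟙-idem : ∀ L x → 𝟙 L x *ℤ 𝟙 L x ≡ 𝟙 L x
    𝟙-idem L x with x ∈? L
    ... | yes _ = refl
    ... | no _ = refl

    ∑𝟙-unique : ∀ L → Unique L → ∑ (𝟙 L) ≡ + length L
    ∑𝟙-unique [] _ = ∑-0 (λ _ → refl)
    ∑𝟙-unique (x ∷ L) (x∉ ∷ uL) = trans (∑-cong (λ y → split y (y ∈? (x ∷ L)) (y ≟F x) (y ∈? L)))
      (trans (∑-+ (λ y → δ y x) (𝟙 L)) (cong₂ _+ℤ_ (∑-δ x) (∑𝟙-unique L uL)))
      where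
      split : ∀ y (d : Dec (y ∈ x ∷ L)) (d₁ : Dec (y ≡ x)) (d₂ : Dec (y ∈ L)) → [ d ]? ≡ [ d₁ ]? +ℤ [ d₂ ]?
      split y (yes _) (yes refl) (yes x∈L) = contradiction refl (All.lookup x∉ x∈L)
      split y (yes _) (yes _) (no _) = refl
      split y (yes _) (no _) (yes _) = refl
      split y (yes (here y≡x)) (no y≢x) (no _) = contradiction y≡x y≢x
      split y (yes (there y∈L)) (no _) (no y∉L) = contradiction y∈L y∉L
      split y (no ∉) (yes y≡x) _ = contradiction (here y≡x) ∉
      split y (no ∉) (no _) (yes y∈L) = contradiction (there y∈L) ∉
      split y (no _) (no _) (no _) = refl

    -- Membership is unaffected by removing repetitions, and without repetitions the indicator
    -- splits into point masses.
    ∑𝟙 : ∀ L → ∑ (𝟙 L) ≡ + card L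
    ∑𝟙 L = trans (∑-cong (λ x → []?-cong (x ∈? L) (x ∈? deduplicate _≟M_ L) (∈-deduplicate⁺ _≟M_) (∈-deduplicate⁻ _≟M_ L)))
      (∑𝟙-unique (deduplicate _≟M_ L) (Unique.deduplicate-! _≟M_ L))

    𝟙-SL : ∀ L → All InSL L → ∀ y → det y ≢ 1# → 𝟙 L y ≡ 0ℤ
    𝟙-SL L inSL y ¬d with y ∈? L
    ... | yes y∈L = contradiction (All.lookup inSL y∈L) ¬d
    ... | no _ = refl

    ∈-fImg : ∀ {A B C : List (Mat n)} {a b c : Mat n} → a ∈ A → b ∈ B → c ∈ C → (a +M (b *M c)) ∈ fImg A B C
    ∈-fImg {A} {B} {C} {a} {b} {c} a∈ b∈ c∈ = ∈-concatMap⁺ (λ a → concatMap (λ b → List.map (λ c → a +M (b *M c)) C) B)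
      (lose a∈ (∈-concatMap⁺ (λ b → List.map (λ c → a +M (b *M c)) C) (lose b∈ (∈-map⁺ (λ c → a +M (b *M c)) c∈))))

  module Main {q : ℕ} (F : FiniteField q) (m : ℕ) (3≤n : 3 ℕ.≤ suc m) (y : ℕ)
    (n²≡ : suc m ℕ.* suc m ≡ suc (suc m ℕ.+ (1 ℕ.+ suc m ℕ.+ y)))
    (A B C : List (Matrices.Mat F (suc m))) (B-SL : All (Matrices.InSL F) B) (C-SL : All (Matrices.InSL F) C) where
    open FiniteField F
    open Matrices F
    open MatrixAlgebra F
    open SumsOver F
    open Indicators F {suc m}
    private
      n = suc m
    module Grow = EnergyBound F {m} 3≤n (𝟙 C) (𝟙-idem C) (0≤𝟙 C) (𝟙-SL C C-SL) (𝟙 B) (𝟙-idem B) (0≤𝟙 B) (𝟙-SL B B-SL)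
    module Trans = Translates F {n} 3≤n (𝟙 C) (𝟙-idem C) (0≤𝟙 C) (𝟙-SL C C-SL)
    open AdditiveBound F m using (P; P*G≤∣M∣; G; ∣M∣)
    module Conv = AdditiveBound.Convolution F m (𝟙 A)

    X = fImg A B C

    -- A nonzero `s z` means that some `w` in `C` has `z *M adj w` in `B`, so `y +M z` lies in `X`.
    -- The witness is never extracted: were the sum outside `X`, every term of `Trans.T (𝟙 B) z`
    -- would vanish.
    covers : ∀ y z → 𝟙 A y *ℤ Grow.s z ≤ 𝟙 A y *ℤ (𝟙 X (y +M z) *ℤ γ z)
    covers y z = cases (y ∈? A)
      where
      open DecMembership (_≟M_ {n}) using (_∈?_)
      inX : y ∈ A → ∀ (d : Dec ((y +M z) ∈ X)) (d₁ : Dec (det z ≡ 1#)) → [ d₁ ]? *ℤ Trans.T (𝟙 B) z ≢ 0ℤ → 1ℤ ≤ [ d ]? *ℤ [ d₁ ]?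
      inX y∈A (yes _) (yes _) _ = ℤ.≤-refl
      inX y∈A _ (no _) ≢0 = contradiction (ℤ.*-zeroˡ (Trans.T (𝟙 B) z)) ≢0
      inX y∈A (no ∉X) (yes _) ≢0 = contradiction (trans (ℤ.*-identityˡ (Trans.T (𝟙 B) z)) (∑-0 (λ w → vanish w (w ∈? C) ((z *M adj w) ∈? B)))) ≢0
        where
        vanish : ∀ w (d : Dec (w ∈ C)) (d₁ : Dec ((z *M adj w) ∈ B)) → [ d ]? *ℤ [ d₁ ]? ≡ 0ℤ
        vanish w (no _) d₁ = ℤ.*-zeroˡ [ d₁ ]?
        vanish w (yes _) (no _) = refl
        vanish w (yes w∈C) (yes b∈B) = contradiction (subst (λ t → (y +M t) ∈ X) (*M-cancelʳ′ z w (All.lookup C-SL w∈C)) (∈-fImg y∈A b∈B w∈C)) ∉X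
      s-le : y ∈ A → Grow.s z ≤ 𝟙 X (y +M z) *ℤ γ z
      s-le y∈A with (γ z *ℤ Trans.T (𝟙 B) z) ℤ.≟ 0ℤ
      ... | yes _ = *-nonneg (0≤𝟙 X (y +M z)) (0≤γ z)
      ... | no ≢0 = inX y∈A ((y +M z) ∈? X) (det z ≟ 1#) ≢0
      cases : (d : Dec (y ∈ A)) → [ d ]? *ℤ Grow.s z ≤ [ d ]? *ℤ (𝟙 X (y +M z) *ℤ γ z)
      cases (yes y∈A) = *-monoˡ {c = 1ℤ} (ℤᵇ.+≤+ ℕ.z≤n) (s-le y∈A)
      cases (no _) = ℤ.≤-reflexive (trans (ℤ.*-zeroˡ (Grow.s z)) (sym (ℤ.*-zeroˡ (𝟙 X (y +M z) *ℤ γ z))))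

    N Y k t : ℕ
    N = q ℕ.^ n
    Y = q ℕ.^ y
    k = length (word m)
    t = 2 ℕ.^ m

    private
      ∣G∣ = ∣ G ∣
      ∣S∣ = ∣ ∑ Grow.s ∣
      ∣E∣ = ∣ Trans.S₂ (𝟙 B) ∣
      V = ∑ (λ x → 𝟙 X x *ℤ Conv.u x)

    instance
      q≢0 : ℕ.NonZero q
      q≢0 = positive-card q (card-pos {Carrier} 0#)
        where
        open import Data.Integer.Base using (Positive)
        positive-card : ∀ q → Positive (+ q) → ℕ.NonZero q
        positive-card (suc _) _ = _
      N≢0 : ℕ.NonZero N
      N≢0 = ℕ.m^n≢0 q n
      Y≢0 : ℕ.NonZero Y
      Y≢0 = ℕ.m^n≢0 q y
      t≢0 : ℕ.NonZero t
      t≢0 = ℕ.m^n≢0 2 m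

    2≤q : 2 ℕ.≤ q
    2≤q = two q (AdditiveBound.P-pos F m)
      where
      open import Data.Integer.Base using (Positive)
      two : ∀ q → Positive (+ q -ℤ 1ℤ) → 2 ℕ.≤ q
      two (suc (suc q)) _ = ℕ.s≤s (ℕ.s≤s ℕ.z≤n)

    open Numbers q N Y (card A) (card B) (card C) (card X) ∣S∣ ∣E∣ ∣G∣ ∣ V ∣ k t 2≤q

    R≡ : R ≡ q ℕ.^ (1 ℕ.+ n ℕ.+ y)
    R≡ = sym (trans (ℕ.^-distribˡ-+-* q (1 ℕ.+ n) y) refl)

    Z≡ : Z ≡ q ℕ.^ (n ℕ.+ (1 ℕ.+ n ℕ.+ y))
    Z≡ = trans (cong (N ℕ.*_) R≡) (sym (ℕ.^-distribˡ-+-* q n (1 ℕ.+ n ℕ.+ y)))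

    dim≡ : ∀ m → suc (dim m) ≡ suc m ℕ.* suc m
    dim≡ zero = refl
    dim≡ (suc m) = trans (cong (ℕ._+ (2 ℕ.* suc m ℕ.+ 1)) (dim≡ m)) (square m)
      where
      square : ∀ m → suc m ℕ.* suc m ℕ.+ (2 ℕ.* suc m ℕ.+ 1) ≡ suc (suc m) ℕ.* suc (suc m)
      square = ℕ-Ring.solve-∀

    q*Z≡ : q ℕ.* Z ≡ q ℕ.^ (n ℕ.* n)
    q*Z≡ = trans (cong (q ℕ.*_) Z≡) (cong (q ℕ.^_) (sym n²≡))

    D≡ : Q ^ dim m ≡ + Z
    D≡ = trans (pos-^ q (dim m)) (cong +_ (trans (cong (q ℕ.^_) (ℕ.suc-injective (trans (dim≡ m) n²≡))) (sym Z≡)))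

    ∣M∣≡ : ∣M∣ ≡ + (q ℕ.* Z)
    ∣M∣≡ = cong +_ (trans (ℕ.^-*-assoc q n n) (sym q*Z≡))

    G≡ : G ≡ + ∣G∣
    G≡ = abs Trans.0≤G

    S≡ : ∑ Grow.s ≡ + ∣S∣
    S≡ = abs (∑-nonneg (λ z → subst (0ℤ ≤_) (Grow.s-idem z) (sq-nonneg (Grow.s z))))

    E≡ : Trans.S₂ (𝟙 B) ≡ + ∣E∣
    E≡ = abs (sum-sq-nonneg (Trans.T (𝟙 B)))

    h₁ : q ℕ.* ∣G∣ ℕ.≤ ∣G∣ ℕ.+ q ℕ.* Z
    h₁ = to-ℕ (nat q ⟨*⟩ G≡) (G≡ ⟨+⟩ ∣M∣≡) (begin
      Q *ℤ G ≡⟨ regroup Q G ⟩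
      G +ℤ P *ℤ G ≤⟨ ℤ.+-monoʳ-≤ G P*G≤∣M∣ ⟩
      G +ℤ ∣M∣ ∎)
      where
      open ℤ.≤-Reasoning
      regroup : ∀ q g → q *ℤ g ≡ g +ℤ (q -ℤ 1ℤ) *ℤ g
      regroup = solve-∀

    module Gℕ = Grow.InNaturals D≡ (nat N) E≡ G≡ (pos-^ 2 m) (∑𝟙 B) (∑𝟙 C) S≡

    h₄ : q ℕ.* (card A ℕ.* ∣S∣) ℕ.≤ card A ℕ.* ∣S∣ ℕ.+ card A ℕ.* card X ℕ.+ ∣ V ∣
    h₄ = to-ℕ (nat q ⟨*⟩ (∑𝟙 A ⟨*⟩ S≡)) ((∑𝟙 A ⟨*⟩ S≡) ⟨+⟩ (∑𝟙 A ⟨*⟩ ∑𝟙 X) ⟨+⟩ nat ∣ V ∣) (begin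
      Q *ℤ AS ≡⟨ regroup Q AS AX ⟩
      AS +ℤ AX +ℤ (P *ℤ AS -ℤ AX) ≤⟨ ℤ.+-monoʳ-≤ (AS +ℤ AX) (ℤ.≤-trans (Conv.sum-set-count (𝟙 X) Grow.s (0≤𝟙 X) (0≤𝟙 A) covers) (i≤∣i∣ V)) ⟩
      AS +ℤ AX +ℤ + ∣ V ∣ ∎)
      where
      open ℤ.≤-Reasoning
      AS = ∑ (𝟙 A) *ℤ ∑ Grow.s
      AX = ∑ (𝟙 A) *ℤ ∑ (𝟙 X)
      regroup : ∀ q s x → q *ℤ s ≡ s +ℤ x +ℤ ((q -ℤ 1ℤ) *ℤ s -ℤ x)
      regroup = solve-∀

    h₅ : ∣ V ∣ ℕ.* ∣ V ∣ ℕ.≤ card X ℕ.* (card A ℕ.* (q ℕ.* q ℕ.* (q ℕ.* Z)))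
    h₅ = to-ℕ (∣i∣²≡i² V) (∑𝟙 X ⟨*⟩ (∑𝟙 A ⟨*⟩ ((nat q ⟨*⟩ nat q) ⟨*⟩ ∣M∣≡))) (Conv.sum-set-bound (𝟙 X) (𝟙-idem X) (𝟙-idem A))

    K≢0 : ℕ.NonZero K
    K≢0 = ℕ.m*n≢0 16 (K₀ ℕ.* K₀) {{_}} {{ℕ.m*n≢0 K₀ K₀ {{K₀-nonZero}} {{K₀-nonZero}}}}

    exponent₃ : q ℕ.^ (4 ℕ.* (n ℕ.* n) ℕ.∸ 4 ℕ.* n ℕ.∸ 2) ≡ q ℕ.* q ℕ.* (R ℕ.* R ℕ.* (R ℕ.* R))
    exponent₃ = begin
      q ℕ.^ (4 ℕ.* (n ℕ.* n) ℕ.∸ 4 ℕ.* n ℕ.∸ 2) ≡⟨ cong (λ e → q ℕ.^ (e ℕ.∸ 4 ℕ.* n ℕ.∸ 2)) (trans (cong (4 ℕ.*_) n²≡) (regroup n ε)) ⟩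
      q ℕ.^ (2 ℕ.+ (ε ℕ.+ ε ℕ.+ (ε ℕ.+ ε)) ℕ.+ 2 ℕ.+ 4 ℕ.* n ℕ.∸ 4 ℕ.* n ℕ.∸ 2)
        ≡⟨ cong (q ℕ.^_) (trans (cong (ℕ._∸ 2) (ℕ.m+n∸n≡m (2 ℕ.+ (ε ℕ.+ ε ℕ.+ (ε ℕ.+ ε)) ℕ.+ 2) (4 ℕ.* n))) (ℕ.m+n∸n≡m (2 ℕ.+ (ε ℕ.+ ε ℕ.+ (ε ℕ.+ ε))) 2)) ⟩
      q ℕ.^ (2 ℕ.+ (ε ℕ.+ ε ℕ.+ (ε ℕ.+ ε))) ≡⟨ sym (ℕ.*-assoc q q (q ℕ.^ (ε ℕ.+ ε ℕ.+ (ε ℕ.+ ε)))) ⟩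
      q ℕ.* q ℕ.* q ℕ.^ (ε ℕ.+ ε ℕ.+ (ε ℕ.+ ε))
        ≡⟨ cong (q ℕ.* q ℕ.*_) (trans (ℕ.^-distribˡ-+-* q (ε ℕ.+ ε) (ε ℕ.+ ε)) (cong (λ r → r ℕ.* r) (trans (ℕ.^-distribˡ-+-* q ε ε) (cong (λ r → r ℕ.* r) (sym R≡))))) ⟩
      q ℕ.* q ℕ.* (R ℕ.* R ℕ.* (R ℕ.* R)) ∎
      where
      open ≡-Reasoning
      -- This is n² - n - 1, and 4n² - 4n - 2 is 4ε + 2. Writing 4n² as a sum first shows that the
      -- truncated subtractions are exact.
      ε = 1 ℕ.+ n ℕ.+ y
      regroup : ∀ n e → 4 ℕ.* suc (n ℕ.+ e) ≡ 2 ℕ.+ (e ℕ.+ e ℕ.+ (e ℕ.+ e)) ℕ.+ 2 ℕ.+ 4 ℕ.* n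
      regroup = ℕ-Ring.solve-∀

    exponent₄ : q ℕ.^ (n ℕ.* n ℕ.∸ n ℕ.∸ 1) ≡ R
    exponent₄ = trans (cong (λ e → q ℕ.^ (e ℕ.∸ n ℕ.∸ 1)) (trans n²≡ (regroup n (1 ℕ.+ n ℕ.+ y))))
      (trans (cong (q ℕ.^_) (trans (cong (ℕ._∸ 1) (ℕ.m+n∸n≡m (1 ℕ.+ n ℕ.+ y ℕ.+ 1) n)) (ℕ.m+n∸n≡m (1 ℕ.+ n ℕ.+ y) 1))) (sym R≡))
      where
      regroup : ∀ n e → suc (n ℕ.+ e) ≡ e ℕ.+ 1 ℕ.+ n
      regroup = ℕ-Ring.solve-∀

    minimum : ℚ
    minimum = ℕ→ℚ (q ℕ.^ (n ℕ.* n)) ℚ.⊓ ℕ→ℚ (q ℕ.^ (2 ℕ.* n) ℕ.* card A)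
      ℚ.⊓ ((card A ℕ.* (card B ℕ.^ 2) ℕ.* (card C ℕ.^ 2)) over (q ℕ.^ (4 ℕ.* (n ℕ.* n) ℕ.∸ 4 ℕ.* n ℕ.∸ 2)))
      ℚ.⊓ ((card B ℕ.* card C) over (q ℕ.^ (n ℕ.* n ℕ.∸ n ℕ.∸ 1)))

    minimum-≤ : Outcome → minimum ℚ.≤ ℕ→ℚ (K ℕ.* card X)
    minimum-≤ o = by o
      where
      t₁ = ℕ→ℚ (q ℕ.^ (n ℕ.* n))
      t₂ = ℕ→ℚ (q ℕ.^ (2 ℕ.* n) ℕ.* card A)
      t₃ = (card A ℕ.* (card B ℕ.^ 2) ℕ.* (card C ℕ.^ 2)) over (q ℕ.^ (4 ℕ.* (n ℕ.* n) ℕ.∸ 4 ℕ.* n ℕ.∸ 2))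
      t₄ = (card B ℕ.* card C) over (q ℕ.^ (n ℕ.* n ℕ.∸ n ℕ.∸ 1))
      numerator : ∀ a b c → a ℕ.* (b ℕ.* (b ℕ.* 1)) ℕ.* (c ℕ.* (c ℕ.* 1)) ≡ a ℕ.* (b ℕ.* c ℕ.* (b ℕ.* c))
      numerator = ℕ-Ring.solve-∀
      by : Outcome → minimum ℚ.≤ ℕ→ℚ (K ℕ.* card X)
      by (inj₁ o) = ℚ.≤-trans (ℚ.≤-trans (ℚ.p⊓q≤p (t₁ ℚ.⊓ t₂ ℚ.⊓ t₃) t₄) (ℚ.≤-trans (ℚ.p⊓q≤p (t₁ ℚ.⊓ t₂) t₃) (ℚ.p⊓q≤p t₁ t₂)))
        (ℕ→ℚ-mono (subst (ℕ._≤ K ℕ.* card X) q*Z≡ o))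
      by (inj₂ (inj₁ o)) = ℚ.≤-trans (ℚ.≤-trans (ℚ.p⊓q≤p (t₁ ℚ.⊓ t₂ ℚ.⊓ t₃) t₄) (ℚ.≤-trans (ℚ.p⊓q≤p (t₁ ℚ.⊓ t₂) t₃) (ℚ.p⊓q≤q t₁ t₂)))
        (ℕ→ℚ-mono (subst (λ s → s ℕ.* card A ℕ.≤ K ℕ.* card X) (trans (sym (ℕ.^-distribˡ-+-* q n n)) (cong (λ e → q ℕ.^ (n ℕ.+ e)) (sym (ℕ.+-identityʳ n)))) o))
      by (inj₂ (inj₂ (inj₁ o))) = ℚ.≤-trans (ℚ.≤-trans (ℚ.p⊓q≤p (t₁ ℚ.⊓ t₂ ℚ.⊓ t₃) t₄) (ℚ.p⊓q≤q (t₁ ℚ.⊓ t₂) t₃))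
        (over-≤ (card A ℕ.* (card B ℕ.^ 2) ℕ.* (card C ℕ.^ 2)) (q ℕ.^ (4 ℕ.* (n ℕ.* n) ℕ.∸ 4 ℕ.* n ℕ.∸ 2)) (K ℕ.* card X) {{ℕ.m^n≢0 q (4 ℕ.* (n ℕ.* n) ℕ.∸ 4 ℕ.* n ℕ.∸ 2)}}
          (subst₂ ℕ._≤_ (sym (numerator (card A) (card B) (card C))) (cong (K ℕ.* card X ℕ.*_) (sym exponent₃)) o))
      by (inj₂ (inj₂ (inj₂ o))) = ℚ.≤-trans (ℚ.p⊓q≤q (t₁ ℚ.⊓ t₂ ℚ.⊓ t₃) t₄)
        (over-≤ (card B ℕ.* card C) (q ℕ.^ (n ℕ.* n ℕ.∸ n ℕ.∸ 1)) (K ℕ.* card X) {{ℕ.m^n≢0 q (n ℕ.* n ℕ.∸ n ℕ.∸ 1)}}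
          (subst (λ r → W ℕ.≤ K ℕ.* card X ℕ.* r) (sym exponent₄) o))

    conclusion : (1/ K ⁺) {{K≢0}} ℚ.* minimum ℚ.≤ ℕ→ℚ (card X)
    conclusion = scale-≤ K {{K≢0}} (card X) (minimum-≤ (outcome h₁ Gℕ.energy-bound-ℕ Gℕ.product-set-energy-ℕ h₄ h₅))

  -- The constant `K` again, as a function of `m` alone, since it has to be chosen before the field
  -- and the sets.
  bound : ℕ → ℕ
  bound m = 16 ℕ.* ((2 ℕ.^ m ℕ.+ 2 ℕ.* length (word m)) ℕ.* (2 ℕ.^ m ℕ.+ 2 ℕ.* length (word m)))

  bound≢0 : ∀ m → ℕ.NonZero (bound m)
  bound≢0 m = ℕ.m*n≢0 16 _ {{_}} {{ℕ.m*n≢0 _ _ {{nz}} {{nz}}}}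
    where
    nz : ℕ.NonZero (2 ℕ.^ m ℕ.+ 2 ℕ.* length (word m))
    nz = ℕ.>-nonZero (ℕ.≤-trans (ℕ.m^n>0 2 m) (ℕ.m≤m+n (2 ℕ.^ m) (2 ℕ.* length (word m))))

open import Data.Nat using (ℕ; _≤_; _*_; _+_; _∸_; _^_)
open import Data.Rational using (ℚ; 0ℚ; _<_; _⊓_) renaming (_≤_ to _≤ℚ_; _*_ to _*ℚ_)
open import Data.Product using (Σ; _×_)
open import Data.List using (List)
open import Data.List.Relation.Unary.All using (All)
open import Data.Nat using (suc; z≤n; s≤s)
open import Data.Nat.Tactic.RingSolver using (solve-∀)
open import Data.Product using (_,_)
open import Relation.Binary.PropositionalEquality using (_≡_)
open Rationals using (1/_⁺; 1/⁺-pos)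
open Conclusion using (bound; bound≢0; module Main)

theorem1p3 : (n : ℕ) → 3 ≤ n →
    Σ ℚ λ c → (0ℚ < c) ×
    ((q : ℕ) → OddPrimePower q → (F : FiniteField q) →
    let open Matrices F in
    (A B C : List (Mat n)) → All InSL B → All InSL C →
    c *ℚ (ℕ→ℚ (q ^ (n * n))
    ⊓ ℕ→ℚ (q ^ (2 * n) * card A)
    ⊓ ((card A * (card B ^ 2) * (card C ^ 2)) over (q ^ (4 * (n * n) ∸ 4 * n ∸ 2)))
    ⊓ ((card B * card C) over (q ^ (n * n ∸ n ∸ 1))))
    ≤ℚ ℕ→ℚ (card (fImg A B C)))
theorem1p3 (suc (suc (suc p))) 3≤n@(s≤s (s≤s (s≤s z≤n))) =
  (1/ bound m ⁺) {{bound≢0 m}} , 1/⁺-pos (bound m) {{bound≢0 m}} ,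
  -- With n = p + 3, the polynomial is n² - 2n - 2, the exponent of `Y`; `n ≥ 3` makes it a natural
  -- number.
  λ q _ F A B C B-SL C-SL → Main.conclusion F m 3≤n (1 + 4 * p + p * p) (square p) A B C B-SL C-SL
  where
  m = suc (suc p)
  square : ∀ p → suc (suc (suc p)) * suc (suc (suc p)) ≡ suc (suc (suc (suc p)) + (1 + suc (suc (suc p)) + (1 + 4 * p + p * p)))
  square = solve-∀
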